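{- Consider the term calculus $\mathbf{ILL}_p^{\lozenge}$, the non-associative category $\mathscr D$ of its terms, the category $\mathscr P_t$ of positive types and thunkable morphisms of $\mathscr D$, the category $\mathscr N_l$ of negative types and linear morphisms of $\mathscr D$, and the adjoint functors $\Uparrow=\mathbf 1\multimap-:\mathscr P_t\to\mathscr N_l$ and $\Downarrow=\mathbf 1\otimes-:\mathscr N_l\to\mathscr P_t$ (with $\Uparrow\dashv\Downarrow$), all recalled in the context. Then: (1) the assignment $N\mapsto\,!N$ ($N$ a negative type) underlies a relative comonad $!:\mathscr N_l\to\mathscr P_t$ on $\Downarrow:\mathscr N_l\to\mathscr P_t$, given by the rules of $!$: under the bijection $\mathscr P_t(P,\Downarrow M)\cong\mathscr D(P,M)$, the counit $\varepsilon_N\in\mathscr P_t(!N,\Downarrow N)$ corresponds to the command $\langle x\,\|\,!\alpha\rangle^+:(x:{!N}\vdash\alpha:N)$, and the coextension of the morphism corresponding to $c:(x:{!N}\vdash\alpha:M)$ is given by the value $x:{!N}\vdash\mu{!\alpha}.c:{!M}\mid$, that is, by the command $\langle\mu{!\alpha}.c\,\|\,\gamma\rangle^+:(x:{!N}\vdash\gamma:{!M})$; (2) the assignment $P\mapsto\lozenge P$ ($P$ a positive type) underlies a relative monad $\lozenge:\mathscr P_t\to\mathscr N_l$ on $\Uparrow:\mathscr P_t\to\mathscr N_l$, given dually by the rules of $\lozenge$: under the bijection $\mathscr N_l(\Uparrow P,N)\cong\mathscr D(P,N)$, the unit $\eta_P\in\mathscr N_l(\Uparrow P,\lozenge P)$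 corresponds to $\langle\diamond x\,\|\,\alpha\rangle^-:(x:P\vdash\alpha:\lozenge P)$, and the extension of the morphism corresponding to $c:(x:P\vdash\alpha:\lozenge Q)$ is given by the stack $\mid\bar\mu{\diamond x}.c:\lozenge P\vdash\alpha:\lozenge Q$, that is, by the command $\langle z\,\|\,\bar\mu{\diamond x}.c\rangle^-:(z:\lozenge P\vdash\alpha:\lozenge Q)$.
   Context: **Types.** Polarities $\varepsilon\in\{+,-\}$. Positive types $P,Q::=X^+\mid\mathbf 1\mid A\otimes B\mid A\oplus B\mid\mathbf 0\mid{!A}$; negative types $N,M::=X^-\mid A\multimap B\mid A\,\&\,B\mid\top\mid\lozenge A$; types $A,B::=P\mid N$. $A_\varepsilon$ denotes a type of polarity $\varepsilon$. **Pseudo-terms** (variables $x,y$; co-variables $\alpha,\beta$; up to $\alpha$-conversion; $i\in\{1,2\}$). Values: $V,W::=x\mid\mu\alpha^-.c\mid()\mid V\otimes W\mid\iota_i(V)\mid\mu(x\cdot\alpha).c\mid\mu\langle\alpha.c;\beta.c'\rangle\mid\mu\langle V\rangle\mid\mu{!\alpha}.c\mid\diamond V$. Stacks: $S::=\alpha\mid\bar\mu x^+.c\mid\bar\mu().c\mid\bar\mu(x\otimes y).c\mid\bar\mu[x.c\,|\,y.c']\mid V\cdot S\mid\pi_i\cdot S\mid\bar\mu[S]\mid{!S}\mid\bar\mu{\diamond x}.c$. Expressions: $t,u::=V\mid\mu\alpha^+.c$. Contexts: $e::=S\mid\bar\mu x^-.c$. Commands: $c::=\langle V\|e\rangle^-\mid\langle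 t\|S\rangle^+$. **Reductions** $\triangleright_R$: $\langle V\|\bar\mu x^\varepsilon.c\rangle^\varepsilon\triangleright c[V/x]$; $\langle\mu\alpha^\varepsilon.c\|S\rangle^\varepsilon\triangleright c[S/\alpha]$; $\langle()\|\bar\mu().c\rangle^+\triangleright c$; $\langle V\otimes W\|\bar\mu(x\otimes y).c\rangle^+\triangleright c[V/x,W/y]$; $\langle\iota_i(V)\|\bar\mu[x_1.c_1|x_2.c_2]\rangle^+\triangleright c_i[V/x_i]$; $\langle\mu(x\cdot\alpha).c\|V\cdot S\rangle^-\triangleright c[V/x,S/\alpha]$; $\langle\mu\langle\alpha_1.c_1;\alpha_2.c_2\rangle\|\pi_i\cdot S\rangle^-\triangleright c_i[S/\alpha_i]$; $\langle\mu{!\alpha}.c\|{!S}\rangle^+\triangleright c[S/\alpha]$; $\langle\diamond V\|\bar\mu{\diamond x}.c\rangle^-\triangleright c[V/x]$. **Expansions** $\triangleright_E$ (bound variables fresh): $e\triangleright\bar\mu x^\varepsilon.\langle x\|e\rangle^\varepsilon$; $t\triangleright\mu\alpha^\varepsilon.\langle t\|\alpha\rangle^\varepsilon$; $S\triangleright\bar\mu().\langle()\|S\rangle^+$; $S\triangleright\bar\mu(x\otimes y).\langle x\otimes y\|S\rangle^+$; $S\triangleright\bar\mu[x.\langle\iota_1(x)\|S\rangle^+|y.\langle\iota_2(y)\|S\rangle^+]$; $V\triangleright\mu(x\cdot\alpha).\langle V\|x\cdot\alpha\rangle^-$; $V\triangleright\mu\langle\alpha.\langle V\|\pi_1\cdot\alpha\rangle^-;\beta.\langle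 V\|\pi_2\cdot\beta\rangle^-\rangle$; $V\triangleright\mu\langle x_1\otimes\cdots\otimes x_n\rangle$ (type $\top$); $S\triangleright\bar\mu[x_1\cdots x_n\cdot\alpha]$ (type $\mathbf 0$); $V\triangleright\mu{!\alpha}.\langle V\|{!\alpha}\rangle^+$; $S\triangleright\bar\mu{\diamond x}.\langle\diamond x\|S\rangle^-$. $\simeq_{RE}$ is the well-typed restriction of the compatible equivalence closure of $\triangleright_R\cup\triangleright_E$ (steps relate terms with the same typing judgement, with expansions applied at the type whose connective they mention). **Typing.** Judgements $\Gamma\vdash t:A\mid$, $\ \Gamma\mid e:A\vdash\Delta$, $\ c:(\Gamma\vdash\Delta)$; $\Gamma$ is an ordered list of distinct typed variables, $\Delta$ is a single $\alpha:A$; $!\Gamma$ means all types are of the form $!A_i$; $\lozenge\Delta$ means $\alpha:\lozenge A$. Rules (premises $\Rightarrow$ conclusion): $x:A\vdash x:A\mid$; $\ \mid\alpha:A\vdash\alpha:A$; $c:(\Gamma,x:A_\varepsilon\vdash\Delta)\Rightarrow\Gamma\mid\bar\mu x^\varepsilon.c:A_\varepsilon\vdash\Delta$; $c:(\Gamma\vdash\alpha:A_\varepsilon)\Rightarrow\Gamma\vdash\mu\alpha^\varepsilon.c:A_\varepsilon\mid$; $\Gamma\vdash t:A_\varepsilon\mid$ and $\Gamma'\mid e:A_\varepsilon\vdash\Delta\Rightarrow\langle t\|e\rangle^\varepsilon:(\Gamma,\Gamma'\vdash\Delta)$; structural: any judgement with context $\Gamma$ may be renamed along $\sigma$ to context $\Gamma'$,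 where $\sigma:\mathrm{dom}\,\Gamma\to\mathrm{dom}\,\Gamma'$ is type-preserving and is bijective on variables whose type is not of the form $!A$ (so exchange always, weakening and contraction only on $!A$); $\Gamma\vdash V:A\mid$, $\Gamma'\mid S:B\vdash\Delta\Rightarrow\Gamma,\Gamma'\mid V\cdot S:A\multimap B\vdash\Delta$; $c:(\Gamma,x:A\vdash\alpha:B)\Rightarrow\Gamma\vdash\mu(x\cdot\alpha).c:A\multimap B\mid$; $\Gamma\vdash V:A\mid$, $\Gamma'\vdash W:B\mid\Rightarrow\Gamma,\Gamma'\vdash V\otimes W:A\otimes B\mid$; $c:(\Gamma,x:A,y:B\vdash\Delta)\Rightarrow\Gamma\mid\bar\mu(x\otimes y).c:A\otimes B\vdash\Delta$; $c:(\Gamma\vdash\alpha:A)$, $c':(\Gamma\vdash\beta:B)\Rightarrow\Gamma\vdash\mu\langle\alpha.c;\beta.c'\rangle:A\&B\mid$; $\Gamma\mid S:A_i\vdash\Delta\Rightarrow\Gamma\mid\pi_i\cdot S:A_1\&A_2\vdash\Delta$; $c:(\Gamma,x:A\vdash\Delta)$, $c':(\Gamma,y:B\vdash\Delta)\Rightarrow\Gamma\mid\bar\mu[x.c|y.c']:A\oplus B\vdash\Delta$; $\Gamma\vdash V:A_i\mid\Rightarrow\Gamma\vdash\iota_i(V):A_1\oplus A_2\mid$; $\vdash():\mathbf 1\mid$; $c:(\Gamma\vdash\Delta)\Rightarrow\Gamma\mid\bar\mu().c:\mathbf 1\vdash\Delta$; $\Gamma\vdash V:A\mid\Rightarrow\Gamma\vdash\mu\langle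 V\rangle:\top\mid$; $\Gamma\mid S:A\vdash\Delta\Rightarrow\Gamma\mid\bar\mu[S]:\mathbf 0\vdash\Delta$; $c:(!\Gamma\vdash\alpha:A)\Rightarrow{!\Gamma}\vdash\mu{!\alpha}.c:{!A}\mid$; $\Gamma\mid S:A\vdash\Delta\Rightarrow\Gamma\mid{!S}:{!A}\vdash\Delta$; $\Gamma\vdash V:A\mid\Rightarrow\Gamma\vdash\diamond V:\lozenge A\mid$; $c:(!\Gamma,x:A\vdash\lozenge\Delta)\Rightarrow{!\Gamma}\mid\bar\mu{\diamond x}.c:\lozenge A\vdash\lozenge\Delta$. **Non-associative category $\mathscr D$** (a category without the associativity axiom): objects are types; $\mathscr D(A,B)$ is the set of $\simeq_{RE}$-classes of commands $c:(x:A\vdash\alpha:B)$ (up to renaming $x,\alpha$); the identity is $\langle x\|\alpha\rangle$; the composite of $c:(x:A\vdash\alpha:B_\varepsilon)$ followed by $c':(y:B_\varepsilon\vdash\beta:C)$ is $\langle\mu\alpha^\varepsilon.c\|\bar\mu y^\varepsilon.c'\rangle^\varepsilon$. A morphism $f$ is thunkable if $(h\circ g)\circ f=h\circ(g\circ f)$ for all composable $g,h$; a morphism $h$ is linear if $(h\circ g)\circ f=h\circ(g\circ f)$ for all composable $f,g$. $\mathscr P_t$ (positive types, thunkable maps) and $\mathscr N_l$ (negative types, linear maps) are ordinary categories. **Shifts.** $\Downarrow N=\mathbf 1\otimes N$, sending $c:(x:N\vdash\alpha:M)$ to $\langle z\|\bar\mu(u\otimes x).\langle u\otimes\mu\alpha^-.c\|\gamma\rangle^+\rangle^+$;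 $\Uparrow P=\mathbf 1\multimap P$, sending $c:(x:P\vdash\alpha:Q)$ to $\langle\mu(u\cdot\alpha).\langle z\|u\cdot\bar\mu x^+.c\rangle^-\|\gamma\rangle^-$. The bijection $\mathscr D(P,M)\cong\mathscr P_t(P,\Downarrow M)$ sends $c:(x:P\vdash\alpha:M)$ to $\langle()\otimes\mu\alpha^-.c\|\gamma\rangle^+$; the bijection $\mathscr D(P,N)\cong\mathscr N_l(\Uparrow P,N)$ sends $c:(x:P\vdash\alpha:N)$ to $\langle z\|()\cdot\bar\mu x^+.c\rangle^-$. **Relative (co)monads.** A relative monad on a functor $L:\mathscr A\to\mathscr B$: an object map $T:|\mathscr A|\to|\mathscr B|$, maps $\eta_A\in\mathscr B(LA,TA)$, and for each $f\in\mathscr B(LA,TB)$ a map $f^*\in\mathscr B(TA,TB)$ with $f=f^*\circ\eta_A$, $\eta_A^*=\mathrm{id}$, $(f^*\circ g)^*=f^*\circ g^*$. A relative comonad on $R:\mathscr B\to\mathscr A$: an object map $S:|\mathscr B|\to|\mathscr A|$, maps $\varepsilon_B\in\mathscr A(SB,RB)$, and for each $f\in\mathscr A(SA,RB)$ a map ${}^*f\in\mathscr A(SA,SB)$ with $f=\varepsilon_B\circ{}^*f$, ${}^*\varepsilon_B=\mathrm{id}$, ${}^*(f\circ{}^*g)={}^*f\circ{}^*g$. -}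

module Defs where

open import Data.Empty using (⊥-elim)
open import Data.Fin.Base using (Fin; zero; suc; _↑ˡ_; _↑ʳ_; join; splitAt)
open import Data.Fin.Properties
  using (suc-injective; ↑ˡ-injective; ↑ʳ-injective; join-splitAt; splitAt-join; splitAt-↑ˡ; splitAt-↑ʳ)
open import Data.Nat.Base using (ℕ; zero; suc; _+_)
open import Data.Product.Base as Product using (Σ; ∃; _×_; _,_; proj₁; proj₂)
open import Data.Sum.Base as Sum using (_⊎_; inj₁; inj₂)
open import Data.Sum.Properties using (inj₁-injective; inj₂-injective)
open import Data.Unit.Base using () renaming (⊤ to Unit)
open import Data.Vec.Base using (Vec; []; _∷_; _++_; lookup; tabulate)
open import Data.Vec.Properties using (lookup-++ˡ; lookup-++ʳ)
open import Function.Bundles using (Inverse)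
open import Level using (0ℓ)
open import Relation.Binary.Bundles using (Setoid)
open import Relation.Binary.PropositionalEquality
  using (_≡_; refl; sym; trans; cong; cong₂; subst; subst₂)
open import Relation.Binary.Structures using (IsEquivalence)
open import Relation.Nullary using (¬_; Dec; yes; no)

private
  variable
    n m k : ℕ

data Polarity : Set where
  pos neg : Polarity

private
  variable
    ε δ : Polarity

data Ix : Set where
  one two : Ix

pick : {X : Set} → Ix → X → X → X
pick one x y = x
pick two x y = y

infixr 7 _⊗_ _⊕_ _&_
infixr 6 _⊸_

data Ty : Polarity → Set

Type : Set
Type = ∃ Ty

data Ty where
  X⁺      : ℕ → Ty pos
  𝟏       : Ty pos
  _⊗_ _⊕_ : Type → Type → Ty pos
  𝟎       : Ty pos
  !_      : Type → Ty pos
  X⁻      : ℕ → Ty neg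
  _⊸_ _&_ : Type → Type → Ty neg
  ⊤       : Ty neg
  ◇_      : Type → Ty neg

-- A positive cut pairs an expression with a stack and a negative cut a value
-- with a context.  Sorting values and contexts under `neg`, expressions and
-- stacks under `pos`, makes μα^ε, μ̄x^ε and ⟨_‖_⟩^ε uniform in ε.

data Sort : Set where
  term coterm : Polarity → Sort
  command     : Sort

pattern value      = term neg
pattern expression = term pos
pattern stack      = coterm pos
pattern context    = coterm neg

private
  variable
    s : Sort

-- Variables are de Bruijn indices.  Every judgement has at most one
-- co-variable: values and expressions have none free, while stacks, contexts
-- and commands have exactly one in scope, denoted `covar`.  The binders of
-- co-variables (μ, μlam, μwith, μbang) therefore capture `covar`.

data Tm : Sort → ℕ → Set where
  μ     : ∀ ε → Tm command n → Tm (term ε) n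
  μ̄     : ∀ ε → Tm command (suc n) → Tm (coterm ε) n
  cut   : ∀ ε → Tm (term ε) n → Tm (coterm ε) n → Tm command n
  ↑_    : Tm value n → Tm expression n
  ↓_    : Tm stack n → Tm context n

  var   : Fin n → Tm value n
  unit  : Tm value n
  pair  : Tm value n → Tm value n → Tm value n
  ι     : Ix → Tm value n → Tm value n
  μlam  : Tm command (suc n) → Tm value n                -- μ(x·α).c
  μwith : Tm command n → Tm command n → Tm value n       -- μ⟨α.c;β.c′⟩
  μtop  : Tm value n → Tm value n                        -- μ⟨V⟩
  μbang : Tm command n → Tm value n                      -- μ!α.c
  dia   : Tm value n → Tm value n                        -- ◇V

  covar  : Tm stack n
  μ̄unit  : Tm command n → Tm stack n                     -- μ̄().c
  μ̄pair  : Tm command (suc (suc n)) → Tm stack n         -- μ̄(x⊗y).c, y is zero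
  μ̄case  : Tm command (suc n) → Tm command (suc n) → Tm stack n  -- μ̄[x.c|y.c′]
  push   : Tm value n → Tm stack n → Tm stack n          -- V·S
  π      : Ix → Tm stack n → Tm stack n
  μ̄zero  : Tm stack n → Tm stack n                       -- μ̄[S]
  bang   : Tm stack n → Tm stack n                       -- !S
  μ̄dia   : Tm command (suc n) → Tm stack n               -- μ̄◇x.c

-- Values seen as left-hand sides, stacks as right-hand sides, of an ε-cut.

ret : ∀ ε → Tm value n → Tm (term ε) n
ret pos V = ↑ V
ret neg V = V

stk : ∀ ε → Tm stack n → Tm (coterm ε) n
stk pos S = S
stk neg S = ↓ S

lift : (Fin n → Fin m) → Fin (suc n) → Fin (suc m)
lift ρ zero    = zero
lift ρ (suc i) = suc (ρ i)

rename : (Fin n → Fin m) → Tm s n → Tm s m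
rename ρ (μ ε c)       = μ ε (rename ρ c)
rename ρ (μ̄ ε c)       = μ̄ ε (rename (lift ρ) c)
rename ρ (cut ε t e)   = cut ε (rename ρ t) (rename ρ e)
rename ρ (↑ V)         = ↑ rename ρ V
rename ρ (↓ S)         = ↓ rename ρ S
rename ρ (var i)       = var (ρ i)
rename ρ unit          = unit
rename ρ (pair V W)    = pair (rename ρ V) (rename ρ W)
rename ρ (ι i V)       = ι i (rename ρ V)
rename ρ (μlam c)      = μlam (rename (lift ρ) c)
rename ρ (μwith c d)   = μwith (rename ρ c) (rename ρ d)
rename ρ (μtop V)      = μtop (rename ρ V)
rename ρ (μbang c)     = μbang (rename ρ c)
rename ρ (dia V)       = dia (rename ρ V)
rename ρ covar         = covar
rename ρ (μ̄unit c)     = μ̄unit (rename ρ c)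
rename ρ (μ̄pair c)     = μ̄pair (rename (lift (lift ρ)) c)
rename ρ (μ̄case c d)   = μ̄case (rename (lift ρ) c) (rename (lift ρ) d)
rename ρ (push V S)    = push (rename ρ V) (rename ρ S)
rename ρ (π i S)       = π i (rename ρ S)
rename ρ (μ̄zero S)     = μ̄zero (rename ρ S)
rename ρ (bang S)      = bang (rename ρ S)
rename ρ (μ̄dia c)      = μ̄dia (rename (lift ρ) c)

wk : Tm s n → Tm s (suc n)
wk = rename suc

lifts : (Fin n → Tm value m) → Fin (suc n) → Tm value (suc m)
lifts θ zero    = var zero
lifts θ (suc i) = wk (θ i)

sub : (Fin n → Tm value m) → Tm s n → Tm s m
sub θ (μ ε c)       = μ ε (sub θ c)
sub θ (μ̄ ε c)       = μ̄ ε (sub (lifts θ) c)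
sub θ (cut ε t e)   = cut ε (sub θ t) (sub θ e)
sub θ (↑ V)         = ↑ sub θ V
sub θ (↓ S)         = ↓ sub θ S
sub θ (var i)       = θ i
sub θ unit          = unit
sub θ (pair V W)    = pair (sub θ V) (sub θ W)
sub θ (ι i V)       = ι i (sub θ V)
sub θ (μlam c)      = μlam (sub (lifts θ) c)
sub θ (μwith c d)   = μwith (sub θ c) (sub θ d)
sub θ (μtop V)      = μtop (sub θ V)
sub θ (μbang c)     = μbang (sub θ c)
sub θ (dia V)       = dia (sub θ V)
sub θ covar         = covar
sub θ (μ̄unit c)     = μ̄unit (sub θ c)
sub θ (μ̄pair c)     = μ̄pair (sub (lifts (lifts θ)) c)
sub θ (μ̄case c d)   = μ̄case (sub (lifts θ) c) (sub (lifts θ) d)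
sub θ (push V S)    = push (sub θ V) (sub θ S)
sub θ (π i S)       = π i (sub θ S)
sub θ (μ̄zero S)     = μ̄zero (sub θ S)
sub θ (bang S)      = bang (sub θ S)
sub θ (μ̄dia c)      = μ̄dia (sub (lifts θ) c)

-- `plug S` substitutes S for the free co-variable; terms have none.

plug : Tm stack n → Tm s n → Tm s n
plug {s = term _} S t = t
plug S (μ̄ ε c)     = μ̄ ε (plug (wk S) c)
plug S (cut ε t e) = cut ε t (plug S e)
plug S (↓ S′)      = ↓ plug S S′
plug S covar       = S
plug S (μ̄unit c)   = μ̄unit (plug S c)
plug S (μ̄pair c)   = μ̄pair (plug (wk (wk S)) c)
plug S (μ̄case c d) = μ̄case (plug (wk S) c) (plug (wk S) d)
plug S (push V S′) = push V (plug S S′)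
plug S (π i S′)    = π i (plug S S′)
plug S (μ̄zero S′)  = μ̄zero (plug S S′)
plug S (bang S′)   = bang (plug S S′)
plug S (μ̄dia c)    = μ̄dia (plug (wk S) c)

infixr 5 _◂_

_◂_ : Tm value m → (Fin n → Tm value m) → Fin (suc n) → Tm value m
(V ◂ θ) zero    = V
(V ◂ θ) (suc i) = θ i

infix 8 _[_] _[_⨾_]

_[_] : Tm s (suc n) → Tm value n → Tm s n
t [ V ] = sub (V ◂ var) t

_[_⨾_] : Tm s (suc (suc n)) → Tm value n → Tm value n → Tm s n
t [ V ⨾ W ] = sub (W ◂ V ◂ var) t

infix 4 _⊳_

data _⊳_ {n : ℕ} : Tm command n → Tm command n → Set where
  R-μ̄    : ∀ ε V c → cut ε (ret ε V) (μ̄ ε c) ⊳ c [ V ]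
  R-μ    : ∀ ε c S → cut ε (μ ε c) (stk ε S) ⊳ plug S c
  R-unit : ∀ c → cut pos (↑ unit) (μ̄unit c) ⊳ c
  R-pair : ∀ V W c → cut pos (↑ pair V W) (μ̄pair c) ⊳ c [ V ⨾ W ]
  R-ι    : ∀ i V c₁ c₂ → cut pos (↑ ι i V) (μ̄case c₁ c₂) ⊳ pick i c₁ c₂ [ V ]
  R-lam  : ∀ c V S → cut neg (μlam c) (↓ push V S) ⊳ plug S (c [ V ])
  R-with : ∀ i c₁ c₂ S → cut neg (μwith c₁ c₂) (↓ π i S) ⊳ plug S (pick i c₁ c₂)
  R-bang : ∀ c S → cut pos (↑ μbang c) (bang S) ⊳ plug S c
  R-dia  : ∀ V c → cut neg (dia V) (↓ μ̄dia c) ⊳ c [ V ]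

-- Contexts list the most recent variable first: Γ,x:A is A ∷ Γ.

data IsBang : Type → Set where
  isBang : ∀ {A} → IsBang (pos , ! A)

Banged : Vec Type n → Set
Banged Γ = ∀ i → IsBang (lookup Γ i)

record Structural {I J : Set} (Γ : I → Type) (Γ′ : J → Type) (σ : I → J) : Set where
  field
    preserves : ∀ i → Γ′ (σ i) ≡ Γ i
    bijective : ∀ j → ¬ IsBang (Γ′ j) → Σ I λ i → σ i ≡ j × (∀ i′ → σ i′ ≡ j → i ≡ i′)

infix 4 _↝_
record _↝_ (Γ : Vec Type n) (Γ′ : Vec Type m) : Set where
  constructor along
  field
    fun        : Fin n → Fin m
    structural : Structural (lookup Γ) (lookup Γ′) fun
open _↝_ public

-- `A ∣` is the judgement Γ ⊢ t : A ∣, `A ⊢ B` is Γ ∣ e : A ⊢ α : B and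
-- `⊢ B` is c : (Γ ⊢ α : B).

infix 5 _⊢_ ⊢_ _∣

data Judgement : Sort → Set where
  _∣  : Type → Judgement (term ε)
  _⊢_ : Type → Type → Judgement (coterm ε)
  ⊢_  : Type → Judgement command

private
  variable
    Γ Γ′ : Vec Type n
    A B C : Type
    T : Ty ε
    J : Judgement s

infix 3 _⊢_∶_

data _⊢_∶_ : Vec Type n → Tm s n → Judgement s → Set where
  T-var    : (A ∷ []) ⊢ var zero ∶ A ∣
  T-covar  : [] ⊢ covar ∶ A ⊢ A
  T-↑      : ∀ {V} → Γ ⊢ V ∶ A ∣ → Γ ⊢ ↑ V ∶ A ∣
  T-↓      : ∀ {S} → Γ ⊢ S ∶ A ⊢ B → Γ ⊢ ↓ S ∶ A ⊢ B
  T-μ̄      : ∀ {c} → ((ε , T) ∷ Γ) ⊢ c ∶ ⊢ B → Γ ⊢ μ̄ ε c ∶ (ε , T) ⊢ B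
  T-μ      : ∀ {c} → Γ ⊢ c ∶ ⊢ (ε , T) → Γ ⊢ μ ε c ∶ (ε , T) ∣
  T-cut    : ∀ {Γ : Vec Type n} {Γ′ : Vec Type m} {t e} →
             Γ ⊢ t ∶ (ε , T) ∣ → Γ′ ⊢ e ∶ (ε , T) ⊢ B →
             (Γ ++ Γ′) ⊢ cut ε (rename (_↑ˡ m) t) (rename (n ↑ʳ_) e) ∶ ⊢ B
  T-struct : ∀ {t : Tm s n} (σ : Γ ↝ Γ′) → Γ ⊢ t ∶ J → Γ′ ⊢ rename (fun σ) t ∶ J
  T-push   : ∀ {Γ : Vec Type n} {Γ′ : Vec Type m} {V S} →
             Γ ⊢ V ∶ A ∣ → Γ′ ⊢ S ∶ B ⊢ C →
             (Γ ++ Γ′) ⊢ push (rename (_↑ˡ m) V) (rename (n ↑ʳ_) S) ∶ (neg , A ⊸ B) ⊢ C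
  T-lam    : ∀ {c} → (A ∷ Γ) ⊢ c ∶ ⊢ B → Γ ⊢ μlam c ∶ (neg , A ⊸ B) ∣
  T-pair   : ∀ {Γ : Vec Type n} {Γ′ : Vec Type m} {V W} →
             Γ ⊢ V ∶ A ∣ → Γ′ ⊢ W ∶ B ∣ →
             (Γ ++ Γ′) ⊢ pair (rename (_↑ˡ m) V) (rename (n ↑ʳ_) W) ∶ (pos , A ⊗ B) ∣
  T-μ̄pair  : ∀ {c} → (B ∷ A ∷ Γ) ⊢ c ∶ ⊢ C → Γ ⊢ μ̄pair c ∶ (pos , A ⊗ B) ⊢ C
  T-with   : ∀ {c d} → Γ ⊢ c ∶ ⊢ A → Γ ⊢ d ∶ ⊢ B → Γ ⊢ μwith c d ∶ (neg , A & B) ∣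
  T-π      : ∀ {i S} → Γ ⊢ S ∶ pick i A B ⊢ C → Γ ⊢ π i S ∶ (neg , A & B) ⊢ C
  T-case   : ∀ {c d} → (A ∷ Γ) ⊢ c ∶ ⊢ C → (B ∷ Γ) ⊢ d ∶ ⊢ C →
             Γ ⊢ μ̄case c d ∶ (pos , A ⊕ B) ⊢ C
  T-ι      : ∀ {i V} → Γ ⊢ V ∶ pick i A B ∣ → Γ ⊢ ι i V ∶ (pos , A ⊕ B) ∣
  T-unit   : [] ⊢ unit ∶ (pos , 𝟏) ∣
  T-μ̄unit  : ∀ {c} → Γ ⊢ c ∶ ⊢ B → Γ ⊢ μ̄unit c ∶ (pos , 𝟏) ⊢ B
  T-top    : ∀ {V} → Γ ⊢ V ∶ A ∣ → Γ ⊢ μtop V ∶ (neg , ⊤) ∣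
  T-zero   : ∀ {S} → Γ ⊢ S ∶ A ⊢ B → Γ ⊢ μ̄zero S ∶ (pos , 𝟎) ⊢ B
  T-μbang  : ∀ {c} → Banged Γ → Γ ⊢ c ∶ ⊢ A → Γ ⊢ μbang c ∶ (pos , ! A) ∣
  T-bang   : ∀ {S} → Γ ⊢ S ∶ A ⊢ B → Γ ⊢ bang S ∶ (pos , ! A) ⊢ B
  T-dia    : ∀ {V} → Γ ⊢ V ∶ A ∣ → Γ ⊢ dia V ∶ (neg , ◇ A) ∣
  T-μ̄dia   : ∀ {c} → Banged Γ → (A ∷ Γ) ⊢ c ∶ ⊢ (neg , ◇ B) →
             Γ ⊢ μ̄dia c ∶ (neg , ◇ A) ⊢ (neg , ◇ B)

-- At `tabulate var` these are x₁⊗⋯⊗xₙ and x₁⋯xₙ·α over the variables in scope,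
-- xₙ being index zero.

tensor : ∀ {k} → Vec (Tm value n) k → Tm value n
tensor []           = unit
tensor (V ∷ [])     = V
tensor (V ∷ W ∷ Vs) = pair (tensor (W ∷ Vs)) V

pushes : ∀ {k} → Vec (Tm value n) k → Tm stack n → Tm stack n
pushes []       S = S
pushes (V ∷ Vs) S = pushes Vs (push V S)

-- E-top and E-zero mention every variable of the judgement's context.

data Expansion {n : ℕ} : Tm s n → Tm s n → Judgement s → Set where
  E-μ̄    : ∀ (e : Tm (coterm ε) n) →
           Expansion e (μ̄ ε (cut ε (ret ε (var zero)) (wk e))) ((ε , T) ⊢ B)
  E-μ    : ∀ (t : Tm (term ε) n) →
           Expansion t (μ ε (cut ε t (stk ε covar))) ((ε , T) ∣)
  E-unit : ∀ S → Expansion S (μ̄unit (cut pos (↑ unit) S)) ((pos , 𝟏) ⊢ B)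
  E-pair : ∀ S → Expansion S
             (μ̄pair (cut pos (↑ pair (var (suc zero)) (var zero)) (wk (wk S))))
             ((pos , A ⊗ B) ⊢ C)
  E-case : ∀ S → Expansion S
             (μ̄case (cut pos (↑ ι one (var zero)) (wk S)) (cut pos (↑ ι two (var zero)) (wk S)))
             ((pos , A ⊕ B) ⊢ C)
  E-lam  : ∀ V → Expansion V (μlam (cut neg (wk V) (↓ push (var zero) covar))) ((neg , A ⊸ B) ∣)
  E-with : ∀ V → Expansion V
             (μwith (cut neg V (↓ π one covar)) (cut neg V (↓ π two covar)))
             ((neg , A & B) ∣)
  E-top  : ∀ V → Expansion V (μtop (tensor (tabulate var))) ((neg , ⊤) ∣)
  E-zero : ∀ S → Expansion S (μ̄zero (pushes (tabulate var) covar)) ((pos , 𝟎) ⊢ B)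
  E-bang : ∀ V → Expansion V (μbang (cut pos (↑ V) (bang covar))) ((pos , ! A) ∣)
  E-dia  : ∀ S → Expansion S (μ̄dia (cut neg (dia (var zero)) (↓ wk S))) ((neg , ◇ A) ⊢ B)

infix 3 _⊢_≃_∶_

data _⊢_≃_∶_ : Vec Type n → Tm s n → Tm s n → Judgement s → Set where
  ≃-R      : ∀ {c c′} → c ⊳ c′ → Γ ⊢ c ∶ J → Γ ⊢ c′ ∶ J → Γ ⊢ c ≃ c′ ∶ J
  ≃-E      : ∀ {t t′ : Tm s n} → Expansion t t′ J → Γ ⊢ t ∶ J → Γ ⊢ t′ ∶ J → Γ ⊢ t ≃ t′ ∶ J
  ≃-refl   : ∀ {t : Tm s n} → Γ ⊢ t ∶ J → Γ ⊢ t ≃ t ∶ J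
  ≃-sym    : ∀ {t u : Tm s n} → Γ ⊢ t ≃ u ∶ J → Γ ⊢ u ≃ t ∶ J
  ≃-trans  : ∀ {t u v : Tm s n} → Γ ⊢ t ≃ u ∶ J → Γ ⊢ u ≃ v ∶ J → Γ ⊢ t ≃ v ∶ J
  ≃-↑      : ∀ {V V′} → Γ ⊢ V ≃ V′ ∶ A ∣ → Γ ⊢ ↑ V ≃ ↑ V′ ∶ A ∣
  ≃-↓      : ∀ {S S′} → Γ ⊢ S ≃ S′ ∶ A ⊢ B → Γ ⊢ ↓ S ≃ ↓ S′ ∶ A ⊢ B
  ≃-μ̄      : ∀ {c c′} → ((ε , T) ∷ Γ) ⊢ c ≃ c′ ∶ ⊢ B → Γ ⊢ μ̄ ε c ≃ μ̄ ε c′ ∶ (ε , T) ⊢ B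
  ≃-μ      : ∀ {c c′} → Γ ⊢ c ≃ c′ ∶ ⊢ (ε , T) → Γ ⊢ μ ε c ≃ μ ε c′ ∶ (ε , T) ∣
  ≃-cut    : ∀ {Γ : Vec Type n} {Γ′ : Vec Type m} {t t′ e e′} →
             Γ ⊢ t ≃ t′ ∶ (ε , T) ∣ → Γ′ ⊢ e ≃ e′ ∶ (ε , T) ⊢ B →
             (Γ ++ Γ′) ⊢ cut ε (rename (_↑ˡ m) t) (rename (n ↑ʳ_) e)
                       ≃ cut ε (rename (_↑ˡ m) t′) (rename (n ↑ʳ_) e′) ∶ ⊢ B
  ≃-struct : ∀ {t u : Tm s n} (σ : Γ ↝ Γ′) → Γ ⊢ t ≃ u ∶ J →
             Γ′ ⊢ rename (fun σ) t ≃ rename (fun σ) u ∶ J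
  ≃-push   : ∀ {Γ : Vec Type n} {Γ′ : Vec Type m} {V V′ S S′} →
             Γ ⊢ V ≃ V′ ∶ A ∣ → Γ′ ⊢ S ≃ S′ ∶ B ⊢ C →
             (Γ ++ Γ′) ⊢ push (rename (_↑ˡ m) V) (rename (n ↑ʳ_) S)
                       ≃ push (rename (_↑ˡ m) V′) (rename (n ↑ʳ_) S′) ∶ (neg , A ⊸ B) ⊢ C
  ≃-lam    : ∀ {c c′} → (A ∷ Γ) ⊢ c ≃ c′ ∶ ⊢ B → Γ ⊢ μlam c ≃ μlam c′ ∶ (neg , A ⊸ B) ∣
  ≃-pair   : ∀ {Γ : Vec Type n} {Γ′ : Vec Type m} {V V′ W W′} →
             Γ ⊢ V ≃ V′ ∶ A ∣ → Γ′ ⊢ W ≃ W′ ∶ B ∣ →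
             (Γ ++ Γ′) ⊢ pair (rename (_↑ˡ m) V) (rename (n ↑ʳ_) W)
                       ≃ pair (rename (_↑ˡ m) V′) (rename (n ↑ʳ_) W′) ∶ (pos , A ⊗ B) ∣
  ≃-μ̄pair  : ∀ {c c′} → (B ∷ A ∷ Γ) ⊢ c ≃ c′ ∶ ⊢ C →
             Γ ⊢ μ̄pair c ≃ μ̄pair c′ ∶ (pos , A ⊗ B) ⊢ C
  ≃-with   : ∀ {c c′ d d′} → Γ ⊢ c ≃ c′ ∶ ⊢ A → Γ ⊢ d ≃ d′ ∶ ⊢ B →
             Γ ⊢ μwith c d ≃ μwith c′ d′ ∶ (neg , A & B) ∣
  ≃-π      : ∀ {i S S′} → Γ ⊢ S ≃ S′ ∶ pick i A B ⊢ C → Γ ⊢ π i S ≃ π i S′ ∶ (neg , A & B) ⊢ C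
  ≃-case   : ∀ {c c′ d d′} → (A ∷ Γ) ⊢ c ≃ c′ ∶ ⊢ C → (B ∷ Γ) ⊢ d ≃ d′ ∶ ⊢ C →
             Γ ⊢ μ̄case c d ≃ μ̄case c′ d′ ∶ (pos , A ⊕ B) ⊢ C
  ≃-ι      : ∀ {i V V′} → Γ ⊢ V ≃ V′ ∶ pick i A B ∣ → Γ ⊢ ι i V ≃ ι i V′ ∶ (pos , A ⊕ B) ∣
  ≃-μ̄unit  : ∀ {c c′} → Γ ⊢ c ≃ c′ ∶ ⊢ B → Γ ⊢ μ̄unit c ≃ μ̄unit c′ ∶ (pos , 𝟏) ⊢ B
  ≃-top    : ∀ {V V′} → Γ ⊢ V ≃ V′ ∶ A ∣ → Γ ⊢ μtop V ≃ μtop V′ ∶ (neg , ⊤) ∣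
  ≃-zero   : ∀ {S S′} → Γ ⊢ S ≃ S′ ∶ A ⊢ B → Γ ⊢ μ̄zero S ≃ μ̄zero S′ ∶ (pos , 𝟎) ⊢ B
  ≃-μbang  : ∀ {c c′} → Banged Γ → Γ ⊢ c ≃ c′ ∶ ⊢ A → Γ ⊢ μbang c ≃ μbang c′ ∶ (pos , ! A) ∣
  ≃-bang   : ∀ {S S′} → Γ ⊢ S ≃ S′ ∶ A ⊢ B → Γ ⊢ bang S ≃ bang S′ ∶ (pos , ! A) ⊢ B
  ≃-dia    : ∀ {V V′} → Γ ⊢ V ≃ V′ ∶ A ∣ → Γ ⊢ dia V ≃ dia V′ ∶ (neg , ◇ A) ∣
  ≃-μ̄dia   : ∀ {c c′} → Banged Γ → (A ∷ Γ) ⊢ c ≃ c′ ∶ ⊢ (neg , ◇ B) →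
             Γ ⊢ μ̄dia c ≃ μ̄dia c′ ∶ (neg , ◇ A) ⊢ (neg , ◇ B)

lift-cong : {ρ ρ′ : Fin n → Fin m} → (∀ i → ρ i ≡ ρ′ i) → ∀ i → lift ρ i ≡ lift ρ′ i
lift-cong eq zero    = refl
lift-cong eq (suc i) = cong suc (eq i)

rename-cong : {ρ ρ′ : Fin n → Fin m} → (∀ i → ρ i ≡ ρ′ i) → (t : Tm s n) → rename ρ t ≡ rename ρ′ t
rename-cong eq (μ ε t) = cong (μ ε) (rename-cong eq t)
rename-cong eq (μ̄ ε t) = cong (μ̄ ε) (rename-cong (lift-cong eq) t)
rename-cong eq (cut ε t u) = cong₂ (cut ε) (rename-cong eq t) (rename-cong eq u)
rename-cong eq (↑ t) = cong ↑_ (rename-cong eq t)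
rename-cong eq (↓ t) = cong ↓_ (rename-cong eq t)
rename-cong eq (var i) = cong var (eq i)
rename-cong eq unit = refl
rename-cong eq (pair t u) = cong₂ pair (rename-cong eq t) (rename-cong eq u)
rename-cong eq (ι i t) = cong (ι i) (rename-cong eq t)
rename-cong eq (μlam t) = cong μlam (rename-cong (lift-cong eq) t)
rename-cong eq (μwith t u) = cong₂ μwith (rename-cong eq t) (rename-cong eq u)
rename-cong eq (μtop t) = cong μtop (rename-cong eq t)
rename-cong eq (μbang t) = cong μbang (rename-cong eq t)
rename-cong eq (dia t) = cong dia (rename-cong eq t)
rename-cong eq covar = refl
rename-cong eq (μ̄unit t) = cong μ̄unit (rename-cong eq t)
rename-cong eq (μ̄pair t) = cong μ̄pair (rename-cong (lift-cong (lift-cong eq)) t)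
rename-cong eq (μ̄case t u) = cong₂ μ̄case (rename-cong (lift-cong eq) t) (rename-cong (lift-cong eq) u)
rename-cong eq (push t u) = cong₂ push (rename-cong eq t) (rename-cong eq u)
rename-cong eq (π i t) = cong (π i) (rename-cong eq t)
rename-cong eq (μ̄zero t) = cong μ̄zero (rename-cong eq t)
rename-cong eq (bang t) = cong bang (rename-cong eq t)
rename-cong eq (μ̄dia t) = cong μ̄dia (rename-cong (lift-cong eq) t)

lifts-cong : {θ θ′ : Fin n → Tm value m} → (∀ i → θ i ≡ θ′ i) → ∀ i → lifts θ i ≡ lifts θ′ i
lifts-cong eq zero    = refl
lifts-cong eq (suc i) = cong wk (eq i)

sub-cong : {θ θ′ : Fin n → Tm value m} → (∀ i → θ i ≡ θ′ i) → (t : Tm s n) → sub θ t ≡ sub θ′ t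
sub-cong eq (μ ε t) = cong (μ ε) (sub-cong eq t)
sub-cong eq (μ̄ ε t) = cong (μ̄ ε) (sub-cong (lifts-cong eq) t)
sub-cong eq (cut ε t u) = cong₂ (cut ε) (sub-cong eq t) (sub-cong eq u)
sub-cong eq (↑ t) = cong ↑_ (sub-cong eq t)
sub-cong eq (↓ t) = cong ↓_ (sub-cong eq t)
sub-cong eq (var i) = eq i
sub-cong eq unit = refl
sub-cong eq (pair t u) = cong₂ pair (sub-cong eq t) (sub-cong eq u)
sub-cong eq (ι i t) = cong (ι i) (sub-cong eq t)
sub-cong eq (μlam t) = cong μlam (sub-cong (lifts-cong eq) t)
sub-cong eq (μwith t u) = cong₂ μwith (sub-cong eq t) (sub-cong eq u)
sub-cong eq (μtop t) = cong μtop (sub-cong eq t)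
sub-cong eq (μbang t) = cong μbang (sub-cong eq t)
sub-cong eq (dia t) = cong dia (sub-cong eq t)
sub-cong eq covar = refl
sub-cong eq (μ̄unit t) = cong μ̄unit (sub-cong eq t)
sub-cong eq (μ̄pair t) = cong μ̄pair (sub-cong (lifts-cong (lifts-cong eq)) t)
sub-cong eq (μ̄case t u) = cong₂ μ̄case (sub-cong (lifts-cong eq) t) (sub-cong (lifts-cong eq) u)
sub-cong eq (push t u) = cong₂ push (sub-cong eq t) (sub-cong eq u)
sub-cong eq (π i t) = cong (π i) (sub-cong eq t)
sub-cong eq (μ̄zero t) = cong μ̄zero (sub-cong eq t)
sub-cong eq (bang t) = cong bang (sub-cong eq t)
sub-cong eq (μ̄dia t) = cong μ̄dia (sub-cong (lifts-cong eq) t)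

lifts-var : {θ : Fin n → Tm value n} → (∀ i → θ i ≡ var i) → ∀ i → lifts θ i ≡ var i
lifts-var eq zero    = refl
lifts-var eq (suc i) = cong wk (eq i)

sub-id : {θ : Fin n → Tm value n} → (∀ i → θ i ≡ var i) → (t : Tm s n) → sub θ t ≡ t
sub-id eq (μ ε t) = cong (μ ε) (sub-id eq t)
sub-id eq (μ̄ ε t) = cong (μ̄ ε) (sub-id (lifts-var eq) t)
sub-id eq (cut ε t u) = cong₂ (cut ε) (sub-id eq t) (sub-id eq u)
sub-id eq (↑ t) = cong ↑_ (sub-id eq t)
sub-id eq (↓ t) = cong ↓_ (sub-id eq t)
sub-id eq (var i) = eq i
sub-id eq unit = refl
sub-id eq (pair t u) = cong₂ pair (sub-id eq t) (sub-id eq u)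
sub-id eq (ι i t) = cong (ι i) (sub-id eq t)
sub-id eq (μlam t) = cong μlam (sub-id (lifts-var eq) t)
sub-id eq (μwith t u) = cong₂ μwith (sub-id eq t) (sub-id eq u)
sub-id eq (μtop t) = cong μtop (sub-id eq t)
sub-id eq (μbang t) = cong μbang (sub-id eq t)
sub-id eq (dia t) = cong dia (sub-id eq t)
sub-id eq covar = refl
sub-id eq (μ̄unit t) = cong μ̄unit (sub-id eq t)
sub-id eq (μ̄pair t) = cong μ̄pair (sub-id (lifts-var (lifts-var eq)) t)
sub-id eq (μ̄case t u) = cong₂ μ̄case (sub-id (lifts-var eq) t) (sub-id (lifts-var eq) u)
sub-id eq (push t u) = cong₂ push (sub-id eq t) (sub-id eq u)
sub-id eq (π i t) = cong (π i) (sub-id eq t)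
sub-id eq (μ̄zero t) = cong μ̄zero (sub-id eq t)
sub-id eq (bang t) = cong bang (sub-id eq t)
sub-id eq (μ̄dia t) = cong μ̄dia (sub-id (lifts-var eq) t)

lift-comp : {ρ : Fin n → Fin m} {ρ′ : Fin m → Fin k} {ρ″ : Fin n → Fin k} →
            (∀ i → ρ′ (ρ i) ≡ ρ″ i) → ∀ i → lift ρ′ (lift ρ i) ≡ lift ρ″ i
lift-comp eq zero    = refl
lift-comp eq (suc i) = cong suc (eq i)

rename-rename : {ρ : Fin n → Fin m} {ρ′ : Fin m → Fin k} {ρ″ : Fin n → Fin k} →
                (∀ i → ρ′ (ρ i) ≡ ρ″ i) → (t : Tm s n) → rename ρ′ (rename ρ t) ≡ rename ρ″ t
rename-rename eq (μ ε t) = cong (μ ε) (rename-rename eq t)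
rename-rename eq (μ̄ ε t) = cong (μ̄ ε) (rename-rename (lift-comp eq) t)
rename-rename eq (cut ε t u) = cong₂ (cut ε) (rename-rename eq t) (rename-rename eq u)
rename-rename eq (↑ t) = cong ↑_ (rename-rename eq t)
rename-rename eq (↓ t) = cong ↓_ (rename-rename eq t)
rename-rename eq (var i) = cong var (eq i)
rename-rename eq unit = refl
rename-rename eq (pair t u) = cong₂ pair (rename-rename eq t) (rename-rename eq u)
rename-rename eq (ι i t) = cong (ι i) (rename-rename eq t)
rename-rename eq (μlam t) = cong μlam (rename-rename (lift-comp eq) t)
rename-rename eq (μwith t u) = cong₂ μwith (rename-rename eq t) (rename-rename eq u)
rename-rename eq (μtop t) = cong μtop (rename-rename eq t)
rename-rename eq (μbang t) = cong μbang (rename-rename eq t)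
rename-rename eq (dia t) = cong dia (rename-rename eq t)
rename-rename eq covar = refl
rename-rename eq (μ̄unit t) = cong μ̄unit (rename-rename eq t)
rename-rename eq (μ̄pair t) = cong μ̄pair (rename-rename (lift-comp (lift-comp eq)) t)
rename-rename eq (μ̄case t u) = cong₂ μ̄case (rename-rename (lift-comp eq) t) (rename-rename (lift-comp eq) u)
rename-rename eq (push t u) = cong₂ push (rename-rename eq t) (rename-rename eq u)
rename-rename eq (π i t) = cong (π i) (rename-rename eq t)
rename-rename eq (μ̄zero t) = cong μ̄zero (rename-rename eq t)
rename-rename eq (bang t) = cong bang (rename-rename eq t)
rename-rename eq (μ̄dia t) = cong μ̄dia (rename-rename (lift-comp eq) t)

lifts-lift : {ρ : Fin n → Fin m} {θ : Fin m → Tm value k} {θ′ : Fin n → Tm value k} →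
             (∀ i → θ (ρ i) ≡ θ′ i) → ∀ i → lifts θ (lift ρ i) ≡ lifts θ′ i
lifts-lift eq zero    = refl
lifts-lift eq (suc i) = cong wk (eq i)

sub-rename : {ρ : Fin n → Fin m} {θ : Fin m → Tm value k} {θ′ : Fin n → Tm value k} →
             (∀ i → θ (ρ i) ≡ θ′ i) → (t : Tm s n) → sub θ (rename ρ t) ≡ sub θ′ t
sub-rename eq (μ ε t) = cong (μ ε) (sub-rename eq t)
sub-rename eq (μ̄ ε t) = cong (μ̄ ε) (sub-rename (lifts-lift eq) t)
sub-rename eq (cut ε t u) = cong₂ (cut ε) (sub-rename eq t) (sub-rename eq u)
sub-rename eq (↑ t) = cong ↑_ (sub-rename eq t)
sub-rename eq (↓ t) = cong ↓_ (sub-rename eq t)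
sub-rename eq (var i) = eq i
sub-rename eq unit = refl
sub-rename eq (pair t u) = cong₂ pair (sub-rename eq t) (sub-rename eq u)
sub-rename eq (ι i t) = cong (ι i) (sub-rename eq t)
sub-rename eq (μlam t) = cong μlam (sub-rename (lifts-lift eq) t)
sub-rename eq (μwith t u) = cong₂ μwith (sub-rename eq t) (sub-rename eq u)
sub-rename eq (μtop t) = cong μtop (sub-rename eq t)
sub-rename eq (μbang t) = cong μbang (sub-rename eq t)
sub-rename eq (dia t) = cong dia (sub-rename eq t)
sub-rename eq covar = refl
sub-rename eq (μ̄unit t) = cong μ̄unit (sub-rename eq t)
sub-rename eq (μ̄pair t) = cong μ̄pair (sub-rename (lifts-lift (lifts-lift eq)) t)
sub-rename eq (μ̄case t u) = cong₂ μ̄case (sub-rename (lifts-lift eq) t) (sub-rename (lifts-lift eq) u)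
sub-rename eq (push t u) = cong₂ push (sub-rename eq t) (sub-rename eq u)
sub-rename eq (π i t) = cong (π i) (sub-rename eq t)
sub-rename eq (μ̄zero t) = cong μ̄zero (sub-rename eq t)
sub-rename eq (bang t) = cong bang (sub-rename eq t)
sub-rename eq (μ̄dia t) = cong μ̄dia (sub-rename (lifts-lift eq) t)

wk-rename : (ρ : Fin n → Fin m) (t : Tm s n) → rename (lift ρ) (wk t) ≡ wk (rename ρ t)
wk-rename ρ t = trans (rename-rename (λ _ → refl) t) (sym (rename-rename (λ _ → refl) t))

lift-lifts : {θ : Fin n → Tm value m} {ρ : Fin m → Fin k} {θ′ : Fin n → Tm value k} →
             (∀ i → rename ρ (θ i) ≡ θ′ i) → ∀ i → rename (lift ρ) (lifts θ i) ≡ lifts θ′ i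
lift-lifts eq zero = refl
lift-lifts {θ = θ} {ρ} eq (suc i) = trans (wk-rename ρ (θ i)) (cong wk (eq i))

rename-sub : {θ : Fin n → Tm value m} {ρ : Fin m → Fin k} {θ′ : Fin n → Tm value k} →
             (∀ i → rename ρ (θ i) ≡ θ′ i) → (t : Tm s n) → rename ρ (sub θ t) ≡ sub θ′ t
rename-sub eq (μ ε t) = cong (μ ε) (rename-sub eq t)
rename-sub eq (μ̄ ε t) = cong (μ̄ ε) (rename-sub (lift-lifts eq) t)
rename-sub eq (cut ε t u) = cong₂ (cut ε) (rename-sub eq t) (rename-sub eq u)
rename-sub eq (↑ t) = cong ↑_ (rename-sub eq t)
rename-sub eq (↓ t) = cong ↓_ (rename-sub eq t)
rename-sub eq (var i) = eq i
rename-sub eq unit = refl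
rename-sub eq (pair t u) = cong₂ pair (rename-sub eq t) (rename-sub eq u)
rename-sub eq (ι i t) = cong (ι i) (rename-sub eq t)
rename-sub eq (μlam t) = cong μlam (rename-sub (lift-lifts eq) t)
rename-sub eq (μwith t u) = cong₂ μwith (rename-sub eq t) (rename-sub eq u)
rename-sub eq (μtop t) = cong μtop (rename-sub eq t)
rename-sub eq (μbang t) = cong μbang (rename-sub eq t)
rename-sub eq (dia t) = cong dia (rename-sub eq t)
rename-sub eq covar = refl
rename-sub eq (μ̄unit t) = cong μ̄unit (rename-sub eq t)
rename-sub eq (μ̄pair t) = cong μ̄pair (rename-sub (lift-lifts (lift-lifts eq)) t)
rename-sub eq (μ̄case t u) = cong₂ μ̄case (rename-sub (lift-lifts eq) t) (rename-sub (lift-lifts eq) u)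
rename-sub eq (push t u) = cong₂ push (rename-sub eq t) (rename-sub eq u)
rename-sub eq (π i t) = cong (π i) (rename-sub eq t)
rename-sub eq (μ̄zero t) = cong μ̄zero (rename-sub eq t)
rename-sub eq (bang t) = cong bang (rename-sub eq t)
rename-sub eq (μ̄dia t) = cong μ̄dia (rename-sub (lift-lifts eq) t)

wk-sub : (θ : Fin n → Tm value m) (t : Tm s n) → sub (lifts θ) (wk t) ≡ wk (sub θ t)
wk-sub θ t = trans (sub-rename (λ _ → refl) t) (sym (rename-sub (λ _ → refl) t))

lifts-lifts : {θ : Fin n → Tm value m} {θ′ : Fin m → Tm value k} {θ″ : Fin n → Tm value k} →
              (∀ i → sub θ′ (θ i) ≡ θ″ i) → ∀ i → sub (lifts θ′) (lifts θ i) ≡ lifts θ″ i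
lifts-lifts eq zero = refl
lifts-lifts {θ = θ} {θ′} eq (suc i) = trans (wk-sub θ′ (θ i)) (cong wk (eq i))

sub-sub : {θ : Fin n → Tm value m} {θ′ : Fin m → Tm value k} {θ″ : Fin n → Tm value k} →
          (∀ i → sub θ′ (θ i) ≡ θ″ i) → (t : Tm s n) → sub θ′ (sub θ t) ≡ sub θ″ t
sub-sub eq (μ ε t) = cong (μ ε) (sub-sub eq t)
sub-sub eq (μ̄ ε t) = cong (μ̄ ε) (sub-sub (lifts-lifts eq) t)
sub-sub eq (cut ε t u) = cong₂ (cut ε) (sub-sub eq t) (sub-sub eq u)
sub-sub eq (↑ t) = cong ↑_ (sub-sub eq t)
sub-sub eq (↓ t) = cong ↓_ (sub-sub eq t)
sub-sub eq (var i) = eq i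
sub-sub eq unit = refl
sub-sub eq (pair t u) = cong₂ pair (sub-sub eq t) (sub-sub eq u)
sub-sub eq (ι i t) = cong (ι i) (sub-sub eq t)
sub-sub eq (μlam t) = cong μlam (sub-sub (lifts-lifts eq) t)
sub-sub eq (μwith t u) = cong₂ μwith (sub-sub eq t) (sub-sub eq u)
sub-sub eq (μtop t) = cong μtop (sub-sub eq t)
sub-sub eq (μbang t) = cong μbang (sub-sub eq t)
sub-sub eq (dia t) = cong dia (sub-sub eq t)
sub-sub eq covar = refl
sub-sub eq (μ̄unit t) = cong μ̄unit (sub-sub eq t)
sub-sub eq (μ̄pair t) = cong μ̄pair (sub-sub (lifts-lifts (lifts-lifts eq)) t)
sub-sub eq (μ̄case t u) = cong₂ μ̄case (sub-sub (lifts-lifts eq) t) (sub-sub (lifts-lifts eq) u)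
sub-sub eq (push t u) = cong₂ push (sub-sub eq t) (sub-sub eq u)
sub-sub eq (π i t) = cong (π i) (sub-sub eq t)
sub-sub eq (μ̄zero t) = cong μ̄zero (sub-sub eq t)
sub-sub eq (bang t) = cong bang (sub-sub eq t)
sub-sub eq (μ̄dia t) = cong μ̄dia (sub-sub (lifts-lifts eq) t)

lifts-ren : {ρ : Fin n → Fin m} {θ : Fin n → Tm value m} →
            (∀ i → θ i ≡ var (ρ i)) → ∀ i → lifts θ i ≡ var (lift ρ i)
lifts-ren eq zero    = refl
lifts-ren eq (suc i) = cong wk (eq i)

sub-ren : {ρ : Fin n → Fin m} {θ : Fin n → Tm value m} →
          (∀ i → θ i ≡ var (ρ i)) → (t : Tm s n) → sub θ t ≡ rename ρ t
sub-ren eq (μ ε t) = cong (μ ε) (sub-ren eq t)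
sub-ren eq (μ̄ ε t) = cong (μ̄ ε) (sub-ren (lifts-ren eq) t)
sub-ren eq (cut ε t u) = cong₂ (cut ε) (sub-ren eq t) (sub-ren eq u)
sub-ren eq (↑ t) = cong ↑_ (sub-ren eq t)
sub-ren eq (↓ t) = cong ↓_ (sub-ren eq t)
sub-ren eq (var i) = eq i
sub-ren eq unit = refl
sub-ren eq (pair t u) = cong₂ pair (sub-ren eq t) (sub-ren eq u)
sub-ren eq (ι i t) = cong (ι i) (sub-ren eq t)
sub-ren eq (μlam t) = cong μlam (sub-ren (lifts-ren eq) t)
sub-ren eq (μwith t u) = cong₂ μwith (sub-ren eq t) (sub-ren eq u)
sub-ren eq (μtop t) = cong μtop (sub-ren eq t)
sub-ren eq (μbang t) = cong μbang (sub-ren eq t)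
sub-ren eq (dia t) = cong dia (sub-ren eq t)
sub-ren eq covar = refl
sub-ren eq (μ̄unit t) = cong μ̄unit (sub-ren eq t)
sub-ren eq (μ̄pair t) = cong μ̄pair (sub-ren (lifts-ren (lifts-ren eq)) t)
sub-ren eq (μ̄case t u) = cong₂ μ̄case (sub-ren (lifts-ren eq) t) (sub-ren (lifts-ren eq) u)
sub-ren eq (push t u) = cong₂ push (sub-ren eq t) (sub-ren eq u)
sub-ren eq (π i t) = cong (π i) (sub-ren eq t)
sub-ren eq (μ̄zero t) = cong μ̄zero (sub-ren eq t)
sub-ren eq (bang t) = cong bang (sub-ren eq t)
sub-ren eq (μ̄dia t) = cong μ̄dia (sub-ren (lifts-ren eq) t)

rename-id : {ρ : Fin n → Fin n} → (∀ i → ρ i ≡ i) → (t : Tm s n) → rename ρ t ≡ t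
rename-id eq t = trans (sym (sub-ren (λ _ → refl) t)) (sub-id (λ i → cong var (eq i)) t)

plug-covar : (t : Tm s n) → plug covar t ≡ t
plug-covar {s = term _} t = refl
plug-covar  (μ̄ ε t) = cong (μ̄ ε) (plug-covar t)
plug-covar  (cut ε t u) = cong₂ (cut ε) refl (plug-covar u)
plug-covar  (↓ t) = cong ↓_ (plug-covar t)
plug-covar  covar = refl
plug-covar  (μ̄unit t) = cong μ̄unit (plug-covar t)
plug-covar  (μ̄pair t) = cong μ̄pair (plug-covar t)
plug-covar  (μ̄case t u) = cong₂ μ̄case (plug-covar t) (plug-covar u)
plug-covar  (push t u) = cong₂ push refl (plug-covar u)
plug-covar  (π i t) = cong (π i) (plug-covar t)
plug-covar  (μ̄zero t) = cong μ̄zero (plug-covar t)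
plug-covar  (bang t) = cong bang (plug-covar t)
plug-covar  (μ̄dia t) = cong μ̄dia (plug-covar t)

rename-plug : (ρ : Fin n → Fin m) (S : Tm stack n) (t : Tm s n) →
              rename ρ (plug S t) ≡ plug (rename ρ S) (rename ρ t)
rename-plug {s = term _} ρ S t = refl
rename-plug ρ S (μ̄ ε t) = cong (μ̄ ε) (trans (rename-plug (lift ρ) (wk S) t) (cong (λ S′ → plug S′ (rename (lift ρ) t)) (wk-rename ρ S)))
rename-plug ρ S (cut ε t u) = cong₂ (cut ε) refl (rename-plug ρ S u)
rename-plug ρ S (↓ t) = cong ↓_ (rename-plug ρ S t)
rename-plug ρ S covar = refl
rename-plug ρ S (μ̄unit t) = cong μ̄unit (rename-plug ρ S t)
rename-plug ρ S (μ̄pair t) = cong μ̄pair (trans (rename-plug (lift (lift ρ)) (wk (wk S)) t) (cong (λ S′ → plug S′ (rename (lift (lift ρ)) t)) (trans (wk-rename (lift ρ) (wk S)) (cong wk (wk-rename ρ S)))))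
rename-plug ρ S (μ̄case t u) = cong₂ μ̄case (trans (rename-plug (lift ρ) (wk S) t) (cong (λ S′ → plug S′ (rename (lift ρ) t)) (wk-rename ρ S))) (trans (rename-plug (lift ρ) (wk S) u) (cong (λ S′ → plug S′ (rename (lift ρ) u)) (wk-rename ρ S)))
rename-plug ρ S (push t u) = cong₂ push refl (rename-plug ρ S u)
rename-plug ρ S (π i t) = cong (π i) (rename-plug ρ S t)
rename-plug ρ S (μ̄zero t) = cong μ̄zero (rename-plug ρ S t)
rename-plug ρ S (bang t) = cong bang (rename-plug ρ S t)
rename-plug ρ S (μ̄dia t) = cong μ̄dia (trans (rename-plug (lift ρ) (wk S) t) (cong (λ S′ → plug S′ (rename (lift ρ) t)) (wk-rename ρ S)))

sub-plug : (θ : Fin n → Tm value m) (S : Tm stack n) (t : Tm s n) →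
           sub θ (plug S t) ≡ plug (sub θ S) (sub θ t)
sub-plug {s = term _} θ S t = refl
sub-plug θ S (μ̄ ε t) = cong (μ̄ ε) (trans (sub-plug (lifts θ) (wk S) t) (cong (λ S′ → plug S′ (sub (lifts θ) t)) (wk-sub θ S)))
sub-plug θ S (cut ε t u) = cong₂ (cut ε) refl (sub-plug θ S u)
sub-plug θ S (↓ t) = cong ↓_ (sub-plug θ S t)
sub-plug θ S covar = refl
sub-plug θ S (μ̄unit t) = cong μ̄unit (sub-plug θ S t)
sub-plug θ S (μ̄pair t) = cong μ̄pair (trans (sub-plug (lifts (lifts θ)) (wk (wk S)) t) (cong (λ S′ → plug S′ (sub (lifts (lifts θ)) t)) (trans (wk-sub (lifts θ) (wk S)) (cong wk (wk-sub θ S)))))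
sub-plug θ S (μ̄case t u) = cong₂ μ̄case (trans (sub-plug (lifts θ) (wk S) t) (cong (λ S′ → plug S′ (sub (lifts θ) t)) (wk-sub θ S))) (trans (sub-plug (lifts θ) (wk S) u) (cong (λ S′ → plug S′ (sub (lifts θ) u)) (wk-sub θ S)))
sub-plug θ S (push t u) = cong₂ push refl (sub-plug θ S u)
sub-plug θ S (π i t) = cong (π i) (sub-plug θ S t)
sub-plug θ S (μ̄zero t) = cong μ̄zero (sub-plug θ S t)
sub-plug θ S (bang t) = cong bang (sub-plug θ S t)
sub-plug θ S (μ̄dia t) = cong μ̄dia (trans (sub-plug (lifts θ) (wk S) t) (cong (λ S′ → plug S′ (sub (lifts θ) t)) (wk-sub θ S)))

plug-plug : (S S′ : Tm stack n) (t : Tm s n) → plug S (plug S′ t) ≡ plug (plug S S′) t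
plug-plug {s = term _} S S′ t = refl
plug-plug S S′ (μ̄ ε t) = cong (μ̄ ε) (trans (plug-plug (wk S) (wk S′) t) (cong (λ S″ → plug S″ t) (sym (rename-plug suc S S′))))
plug-plug S S′ (cut ε t u) = cong₂ (cut ε) refl (plug-plug S S′ u)
plug-plug S S′ (↓ t) = cong ↓_ (plug-plug S S′ t)
plug-plug S S′ covar = refl
plug-plug S S′ (μ̄unit t) = cong μ̄unit (plug-plug S S′ t)
plug-plug S S′ (μ̄pair t) = cong μ̄pair (trans (plug-plug (wk (wk S)) (wk (wk S′)) t) (cong (λ S″ → plug S″ t) (sym (trans (cong wk (rename-plug suc S S′)) (rename-plug suc (wk S) (wk S′))))))
plug-plug S S′ (μ̄case t u) = cong₂ μ̄case (trans (plug-plug (wk S) (wk S′) t) (cong (λ S″ → plug S″ t) (sym (rename-plug suc S S′)))) (trans (plug-plug (wk S) (wk S′) u) (cong (λ S″ → plug S″ u) (sym (rename-plug suc S S′))))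
plug-plug S S′ (push t u) = cong₂ push refl (plug-plug S S′ u)
plug-plug S S′ (π i t) = cong (π i) (plug-plug S S′ t)
plug-plug S S′ (μ̄zero t) = cong μ̄zero (plug-plug S S′ t)
plug-plug S S′ (bang t) = cong bang (plug-plug S S′ t)
plug-plug S S′ (μ̄dia t) = cong μ̄dia (trans (plug-plug (wk S) (wk S′) t) (cong (λ S″ → plug S″ t) (sym (rename-plug suc S S′))))

isBang? : ∀ A → Dec (IsBang A)
isBang? (pos , X⁺ x)    = no λ ()
isBang? (pos , 𝟏)       = no λ ()
isBang? (pos , (A ⊗ B)) = no λ ()
isBang? (pos , (A ⊕ B)) = no λ ()
isBang? (pos , 𝟎)       = no λ ()
isBang? (pos , (! A))   = yes isBang
isBang? (neg , A)       = no λ ()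

module _ {I J : Set} {a : I → Type} {b : J → Type} where

  str-≗ : {f g : I → J} → (∀ i → f i ≡ g i) → Structural a b f → Structural a b g
  str-≗ eq s = record
    { preserves = λ i → trans (cong b (sym (eq i))) (s .preserves i)
    ; bijective = λ j nb → let (i , p , u) = s .bijective j nb in
        i , trans (sym (eq i)) p , λ i′ q → u i′ (trans (eq i′) q) }
    where open Structural

  str-iso : {f : I → J} (g : J → I) → (∀ i → b (f i) ≡ a i) →
            (∀ j → f (g j) ≡ j) → (∀ i → g (f i) ≡ i) → Structural a b f
  str-iso g pr fg gf = record
    { preserves = pr
    ; bijective = λ j _ → g j , fg j , λ i′ q → trans (cong g (sym q)) (gf i′) }

  str-banged : {f : I → J} → Structural a b f → (∀ i → IsBang (a i)) → ∀ j → IsBang (b j)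
  str-banged s ba j with isBang? (b j)
  ... | yes p = p
  ... | no np with Structural.bijective s j np
  ...   | i , refl , _ = subst IsBang (sym (Structural.preserves s i)) (ba i)

str-id : {I : Set} {a : I → Type} → Structural a a (λ i → i)
str-id = str-iso (λ i → i) (λ _ → refl) (λ _ → refl) (λ _ → refl)

str-∘ : {I J K : Set} {a : I → Type} {b : J → Type} {c : K → Type} {f : I → J} {g : J → K} →
        Structural a b f → Structural b c g → Structural a c (λ i → g (f i))
str-∘ {b = b} {c = c} {f} {g} s r = record
  { preserves = λ i → trans (r .preserves (f i)) (s .preserves i)
  ; bijective = λ k nb →
      let (j , p , u) = r .bijective k nb
          (i , q , v) = s .bijective j (λ x → nb (subst IsBang (trans (sym (r .preserves j)) (cong c p)) x))
      in i , trans (cong g q) p , λ i′ z → v i′ (sym (u (f i′) z)) }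
  where open Structural

str-⊎ : {I I′ J J′ : Set} {a : I → Type} {a′ : I′ → Type} {b : J → Type} {b′ : J′ → Type}
        {f : I → J} {f′ : I′ → J′} → Structural a b f → Structural a′ b′ f′ →
        Structural (Sum.[ a , a′ ]) (Sum.[ b , b′ ]) (Sum.map f f′)
str-⊎ s r = record
  { preserves = λ { (inj₁ i) → s .preserves i ; (inj₂ i) → r .preserves i }
  ; bijective = λ
      { (inj₁ j) nb → let (i , p , u) = s .bijective j nb in
          inj₁ i , cong inj₁ p , λ { (inj₁ i′) q → cong inj₁ (u i′ (inj₁-injective q)) ; (inj₂ _) () }
      ; (inj₂ j) nb → let (i , p , u) = r .bijective j nb in
          inj₂ i , cong inj₂ p , λ { (inj₂ i′) q → cong inj₂ (u i′ (inj₂-injective q)) ; (inj₁ _) () } } }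
  where open Structural

str-assoc : {I J K : Set} {a : I → Type} {b : J → Type} {c : K → Type} →
            Structural (Sum.[ a , Sum.[ b , c ] ]) (Sum.[ Sum.[ a , b ] , c ]) Sum.assocˡ
str-assoc = str-iso Sum.assocʳ
  (λ { (inj₁ _) → refl ; (inj₂ (inj₁ _)) → refl ; (inj₂ (inj₂ _)) → refl })
  (λ { (inj₁ (inj₁ _)) → refl ; (inj₁ (inj₂ _)) → refl ; (inj₂ _) → refl })
  (λ { (inj₁ _) → refl ; (inj₂ (inj₁ _)) → refl ; (inj₂ (inj₂ _)) → refl })

module _ {n m : ℕ} (Γ : Vec Type n) (Γ′ : Vec Type m) where

  lookup-join : ∀ i → lookup (Γ ++ Γ′) (join n m i) ≡ Sum.[ lookup Γ , lookup Γ′ ] i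
  lookup-join (inj₁ i) = lookup-++ˡ Γ Γ′ i
  lookup-join (inj₂ j) = lookup-++ʳ Γ Γ′ j

  str-join : Structural (Sum.[ lookup Γ , lookup Γ′ ]) (lookup (Γ ++ Γ′)) (join n m)
  str-join = str-iso (splitAt n) lookup-join (join-splitAt n m) (splitAt-join n m)

  str-split : Structural (lookup (Γ ++ Γ′)) (Sum.[ lookup Γ , lookup Γ′ ]) (splitAt n)
  str-split = str-iso (join n m)
    (λ i → trans (sym (lookup-join (splitAt n i))) (cong (lookup (Γ ++ Γ′)) (join-splitAt n m i)))
    (splitAt-join n m) (join-splitAt n m)

-- The contexts Γ and Γ′ jointly rename to Θ.

record Glue (Γ : Vec Type n) (Γ′ : Vec Type m) (Θ : Vec Type k)
            (ρ : Fin n → Fin k) (ρ′ : Fin m → Fin k) : Set where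
  constructor gluing
  field
    jointly : Structural Sum.[ lookup Γ , lookup Γ′ ] (lookup Θ) Sum.[ ρ , ρ′ ]
open Glue public

module _ {n m k : ℕ} {Γ : Vec Type n} {Γ′ : Vec Type m} {Θ : Vec Type k}
         {ρ : Fin n → Fin k} {ρ′ : Fin m → Fin k} (g : Glue Γ Γ′ Θ ρ ρ′) where

  glue : (Γ ++ Γ′) ↝ Θ
  glue = along (λ i → Sum.[ ρ , ρ′ ] (splitAt n i)) (str-∘ (str-split Γ Γ′) (jointly g))

  glueˡ : (t : Tm s n) → rename (fun glue) (rename (_↑ˡ m) t) ≡ rename ρ t
  glueˡ = rename-rename (λ i → cong Sum.[ ρ , ρ′ ] (splitAt-↑ˡ n i m))

  glueʳ : (t : Tm s m) → rename (fun glue) (rename (n ↑ʳ_) t) ≡ rename ρ′ t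
  glueʳ = rename-rename (λ i → cong Sum.[ ρ , ρ′ ] (splitAt-↑ʳ n m i))

  T-cut* : ∀ {t e} → Γ ⊢ t ∶ (ε , T) ∣ → Γ′ ⊢ e ∶ (ε , T) ⊢ B →
           Θ ⊢ cut ε (rename ρ t) (rename ρ′ e) ∶ ⊢ B
  T-cut* {t = t} {e} Dt De = subst₂ (λ t e → Θ ⊢ cut _ t e ∶ _) (glueˡ t) (glueʳ e)
    (T-struct glue (T-cut Dt De))

  T-push* : ∀ {V S} → Γ ⊢ V ∶ A ∣ → Γ′ ⊢ S ∶ B ⊢ C →
            Θ ⊢ push (rename ρ V) (rename ρ′ S) ∶ (neg , A ⊸ B) ⊢ C
  T-push* {V = t} {e} Dt De = subst₂ (λ t e → Θ ⊢ push t e ∶ _) (glueˡ t) (glueʳ e)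
    (T-struct glue (T-push Dt De))

  T-pair* : ∀ {V W} → Γ ⊢ V ∶ A ∣ → Γ′ ⊢ W ∶ B ∣ →
            Θ ⊢ pair (rename ρ V) (rename ρ′ W) ∶ (pos , A ⊗ B) ∣
  T-pair* {V = t} {e} Dt De = subst₂ (λ t e → Θ ⊢ pair t e ∶ _) (glueˡ t) (glueʳ e)
    (T-struct glue (T-pair Dt De))

  ≃-cut* : ∀ {t t′ e e′} → Γ ⊢ t ≃ t′ ∶ (ε , T) ∣ → Γ′ ⊢ e ≃ e′ ∶ (ε , T) ⊢ B →
           Θ ⊢ cut ε (rename ρ t) (rename ρ′ e) ≃ cut ε (rename ρ t′) (rename ρ′ e′) ∶ ⊢ B
  ≃-cut* {t = t} {t′} {e} {e′} p q =
    subst₂ (λ t t′ → Θ ⊢ cut _ t _ ≃ cut _ t′ _ ∶ _) (glueˡ t) (glueˡ t′)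
      (subst₂ (λ e e′ → Θ ⊢ cut _ _ e ≃ cut _ _ e′ ∶ _) (glueʳ e) (glueʳ e′)
        (≃-struct glue (≃-cut p q)))

  ≃-push* : ∀ {t t′ e e′} → Γ ⊢ t ≃ t′ ∶ A ∣ → Γ′ ⊢ e ≃ e′ ∶ B ⊢ C →
            Θ ⊢ push (rename ρ t) (rename ρ′ e) ≃ push (rename ρ t′) (rename ρ′ e′) ∶ (neg , A ⊸ B) ⊢ C
  ≃-push* {t = t} {t′} {e} {e′} p q =
    subst₂ (λ t t′ → Θ ⊢ push t _ ≃ push t′ _ ∶ _) (glueˡ t) (glueˡ t′)
      (subst₂ (λ e e′ → Θ ⊢ push _ e ≃ push _ e′ ∶ _) (glueʳ e) (glueʳ e′)
        (≃-struct glue (≃-push p q)))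

  ≃-pair* : ∀ {t t′ e e′} → Γ ⊢ t ≃ t′ ∶ A ∣ → Γ′ ⊢ e ≃ e′ ∶ B ∣ →
            Θ ⊢ pair (rename ρ t) (rename ρ′ e) ≃ pair (rename ρ t′) (rename ρ′ e′) ∶ (pos , A ⊗ B) ∣
  ≃-pair* {t = t} {t′} {e} {e′} p q =
    subst₂ (λ t t′ → Θ ⊢ pair t _ ≃ pair t′ _ ∶ _) (glueˡ t) (glueˡ t′)
      (subst₂ (λ e e′ → Θ ⊢ pair _ e ≃ pair _ e′ ∶ _) (glueʳ e) (glueʳ e′)
        (≃-struct glue (≃-pair p q)))

↝-lift : ∀ A {Γ : Vec Type n} {Γ′ : Vec Type m} → Γ ↝ Γ′ → (A ∷ Γ) ↝ (A ∷ Γ′)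
↝-lift A σ = along (lift (fun σ)) record
  { preserves = λ { zero → refl ; (suc i) → preserves i }
  ; bijective = λ
      { zero _ → zero , refl , λ { zero _ → refl ; (suc _) () }
      ; (suc j) nb → let (i , p , u) = bijective j nb in
          suc i , cong suc p , λ { (suc i′) q → cong suc (u i′ (suc-injective q)) ; zero () } } }
  where open Structural (structural σ)

value-banged : {V : Tm value n} → IsBang A → Γ ⊢ V ∶ A ∣ → Banged Γ
value-banged b T-var zero = b
value-banged b (T-struct σ D) = str-banged (structural σ) (value-banged b D)
value-banged isBang (T-μbang bΓ D) = bΓ

stack-banged : {S : Tm stack n} → Γ ⊢ S ∶ (neg , ◇ A) ⊢ B → Banged Γ
stack-banged T-covar ()
stack-banged (T-struct σ D) = str-banged (structural σ) (stack-banged D)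
stack-banged (T-μ̄dia bΓ D) = bΓ

stack-dia : {S : Tm stack n} → Γ ⊢ S ∶ (neg , ◇ A) ⊢ B → ∃ λ C → B ≡ (neg , ◇ C)
stack-dia T-covar        = _ , refl
stack-dia (T-struct σ D) = stack-dia D
stack-dia (T-μ̄dia _ D)   = _ , refl

banged-++ : {Γ : Vec Type n} {Γ′ : Vec Type m} → Banged Γ → Banged Γ′ → Banged (Γ ++ Γ′)
banged-++ {Γ = Γ} {Γ′} b b′ =
  str-banged (str-join Γ Γ′) λ { (inj₁ i) → b i ; (inj₂ i) → b′ i }

module _ {n m k : ℕ} (Γ : Vec Type n) (Γ′ : Vec Type m) (Ξ : Vec Type k) where

  rotate : Fin (m + k) → Fin ((n + m) + k)
  rotate i = Sum.[ (λ j → (n ↑ʳ j) ↑ˡ k) , ((n + m) ↑ʳ_) ] (splitAt m i)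

  glue-assoc : Glue Γ (Γ′ ++ Ξ) ((Γ ++ Γ′) ++ Ξ) (λ i → (i ↑ˡ m) ↑ˡ k) rotate
  glue-assoc = gluing (str-≗ eq
    (str-∘ (str-⊎ str-id (str-split Γ′ Ξ)) (str-∘ str-assoc
      (str-∘ (str-⊎ (str-join Γ Γ′) str-id) (str-join (Γ ++ Γ′) Ξ)))))
    where
    eq : ∀ i → join (n + m) k (Sum.map (join n m) (λ i → i)
                  (Sum.assocˡ (Sum.map (λ i → i) (splitAt m) i))) ≡
               Sum.[ (λ i → (i ↑ˡ m) ↑ˡ k) , rotate ] i
    eq (inj₁ i) = refl
    eq (inj₂ i) with splitAt m i
    ... | inj₁ _ = refl
    ... | inj₂ _ = refl

  rotate-plug : (S : Tm stack k) (e : Tm s m) →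
    rename rotate (plug (rename (m ↑ʳ_) S) (rename (_↑ˡ k) e)) ≡
    plug (rename ((n + m) ↑ʳ_) S) (rename (_↑ˡ k) (rename (n ↑ʳ_) e))
  rotate-plug S e = trans (rename-plug rotate _ (rename (_↑ˡ k) e))
    (cong₂ (λ S e → plug S e)
      (rename-rename (λ i → cong Sum.[ _ , _ ] (splitAt-↑ʳ m k i)) S)
      (trans (rename-rename (λ i → cong Sum.[ _ , _ ] (splitAt-↑ˡ m i k)) e)
             (sym (rename-rename (λ _ → refl) e))))

glue-++ : {Γ : Vec Type n} {Γ′ : Vec Type m} (σ : Γ ↝ Γ′) (Ξ : Vec Type k) →
          Glue Γ Ξ (Γ′ ++ Ξ) (λ i → fun σ i ↑ˡ k) (m ↑ʳ_)
glue-++ {Γ′ = Γ′} σ Ξ = gluing (str-≗ (λ { (inj₁ _) → refl ; (inj₂ _) → refl })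
  (str-∘ (str-⊎ (structural σ) str-id) (str-join Γ′ Ξ)))

module _ {Ξ : Vec Type k} {S : Tm stack k} {B C : Type} (DS : Ξ ⊢ S ∶ B ⊢ C) where

  private
    under : ∀ {Γ : Vec Type n} c →
            (A ∷ Γ) ++ Ξ ⊢ plug (rename (suc n ↑ʳ_) S) (rename (_↑ˡ k) c) ∶ ⊢ C →
            A ∷ (Γ ++ Ξ) ⊢ plug (wk (rename (n ↑ʳ_) S)) (rename (lift (_↑ˡ k)) c) ∶ ⊢ C
    under {A = A} {Γ = Γ} c = subst₂ (λ S c → A ∷ (Γ ++ Ξ) ⊢ plug S c ∶ ⊢ C)
      (sym (rename-rename (λ _ → refl) S))
      (rename-cong (λ { zero → refl ; (suc _) → refl }) c)

    under₂ : ∀ {A A′} {Γ : Vec Type n} c →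
             (A ∷ A′ ∷ Γ) ++ Ξ ⊢ plug (rename (suc (suc n) ↑ʳ_) S) (rename (_↑ˡ k) c) ∶ ⊢ C →
             A ∷ A′ ∷ (Γ ++ Ξ) ⊢ plug (wk (wk (rename (n ↑ʳ_) S))) (rename (lift (lift (_↑ˡ k))) c) ∶ ⊢ C
    under₂ {A = A} {A′} {Γ = Γ} c = subst₂ (λ S c → A ∷ A′ ∷ (Γ ++ Ξ) ⊢ plug S c ∶ ⊢ C)
      (sym (trans (cong wk (rename-rename (λ _ → refl) S)) (rename-rename (λ _ → refl) S)))
      (rename-cong (λ { zero → refl ; (suc zero) → refl ; (suc (suc _)) → refl }) c)

  plug-glue : {Γ : Vec Type n} {Γ′ : Vec Type m} (σ : Γ ↝ Γ′) (t : Tm s n) →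
    rename (fun (glue (glue-++ σ Ξ))) (plug (rename (n ↑ʳ_) S) (rename (_↑ˡ k) t)) ≡
    plug (rename (m ↑ʳ_) S) (rename (_↑ˡ k) (rename (fun σ) t))
  plug-glue σ t = trans (rename-plug _ _ (rename (_↑ˡ k) t))
    (cong₂ (λ S t → plug S t) (glueʳ (glue-++ σ Ξ) S)
      (trans (glueˡ (glue-++ σ Ξ) t) (sym (rename-rename (λ _ → refl) t))))

  T-plug-co : {Γ : Vec Type n} {e : Tm (coterm ε) n} → Γ ⊢ e ∶ A ⊢ B →
              (Γ ++ Ξ) ⊢ plug (rename (n ↑ʳ_) S) (rename (_↑ˡ k) e) ∶ A ⊢ C
  T-plug-cmd : {Γ : Vec Type n} {c : Tm command n} → Γ ⊢ c ∶ ⊢ B →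
               (Γ ++ Ξ) ⊢ plug (rename (n ↑ʳ_) S) (rename (_↑ˡ k) c) ∶ ⊢ C

  T-plug-co T-covar = subst (λ S → Ξ ⊢ S ∶ _) (sym (rename-id (λ _ → refl) S)) DS
  T-plug-co (T-↓ D) = T-↓ (T-plug-co D)
  T-plug-co (T-μ̄ {c = c} D) = T-μ̄ (under c (T-plug-cmd D))
  T-plug-co (T-struct {Γ = Γ} {t = t} σ D) =
    subst (λ t → _ ⊢ t ∶ _) (plug-glue σ t) (T-struct (glue (glue-++ σ Ξ)) (T-plug-co D))
  T-plug-co (T-push {Γ = Γ} {Γ′} {V} {S′} D D′) =
    subst₂ (λ V S → _ ⊢ push V S ∶ _) (sym (rename-rename (λ _ → refl) V)) (rotate-plug Γ Γ′ Ξ S S′)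
      (T-push* (glue-assoc Γ Γ′ Ξ) D (T-plug-co D′))
  T-plug-co (T-μ̄pair {c = c} D) = T-μ̄pair (under₂ c (T-plug-cmd D))
  T-plug-co (T-π D) = T-π (T-plug-co D)
  T-plug-co (T-case {c = c} {d} D D′) = T-case (under c (T-plug-cmd D)) (under d (T-plug-cmd D′))
  T-plug-co (T-μ̄unit D) = T-μ̄unit (T-plug-cmd D)
  T-plug-co (T-zero D) = T-zero (T-plug-co D)
  T-plug-co (T-bang D) = T-bang (T-plug-co D)
  T-plug-co {Γ = Γ} (T-μ̄dia {c = c} bΓ D) with stack-dia DS
  ... | _ , refl = T-μ̄dia (banged-++ {Γ = Γ} {Ξ} bΓ (stack-banged DS)) (under c (T-plug-cmd D))

  T-plug-cmd (T-cut {Γ = Γ} {Γ′} {t} {e} D D′) =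
    subst₂ (λ t e → _ ⊢ cut _ t e ∶ _) (sym (rename-rename (λ _ → refl) t)) (rotate-plug Γ Γ′ Ξ S e)
      (T-cut* (glue-assoc Γ Γ′ Ξ) D (T-plug-co D′))
  T-plug-cmd (T-struct {t = t} σ D) =
    subst (λ t → _ ⊢ t ∶ _) (plug-glue σ t) (T-struct (glue (glue-++ σ Ξ)) (T-plug-cmd D))

T-plug* : {Γ : Vec Type n} {Ξ : Vec Type m} {Θ : Vec Type k} {ρ : Fin n → Fin k} {ρ′ : Fin m → Fin k} →
          Glue Γ Ξ Θ ρ ρ′ → ∀ {S c} → Ξ ⊢ S ∶ B ⊢ C → Γ ⊢ c ∶ ⊢ B →
          Θ ⊢ plug (rename ρ′ S) (rename ρ c) ∶ ⊢ C
T-plug* g {S} {c} DS Dc = subst (λ c → _ ⊢ c ∶ _)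
  (trans (rename-plug (fun (glue g)) (rename _ S) (rename _ c)) (cong₂ (λ S c → plug S c) (glueʳ g S) (glueˡ g c)))
  (T-struct (glue g) (T-plug-cmd DS Dc))

↝-self : {Γ : Vec Type n} {Γ′ : Vec Type m} (σ : Γ ↝ Γ′) {J : Judgement s} {t : Tm s n} {t′ : Tm s m} →
         t′ ≡ rename (fun σ) t → Γ ⊢ t ∶ J → Γ′ ⊢ t′ ∶ J
↝-self σ refl D = T-struct σ D

total : (Fin n → ℕ) → ℕ
total {zero}  size = 0
total {suc n} size = size zero + total (λ i → size (suc i))

⨁ : {size : Fin n → ℕ} → (∀ i → Vec Type (size i)) → Vec Type (total size)
⨁ {zero}  dom = []
⨁ {suc n} dom = dom zero ++ ⨁ (λ i → dom (suc i))

inject : (size : Fin n → ℕ) → ∀ i → Fin (size i) → Fin (total size)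
inject size zero    j = j ↑ˡ _
inject size (suc i) j = size zero ↑ʳ inject (λ i → size (suc i)) i j

module _ {n : ℕ} (size : Fin (suc n) → ℕ) where
  cons-Σ : Fin (size zero) ⊎ Σ (Fin n) (λ i → Fin (size (suc i))) → Σ (Fin (suc n)) (λ i → Fin (size i))
  cons-Σ (inj₁ j)       = zero , j
  cons-Σ (inj₂ (i , j)) = suc i , j

  uncons-Σ : Σ (Fin (suc n)) (λ i → Fin (size i)) → Fin (size zero) ⊎ Σ (Fin n) (λ i → Fin (size (suc i)))
  uncons-Σ (zero , j)  = inj₁ j
  uncons-Σ (suc i , j) = inj₂ (i , j)

Family : {size : Fin n → ℕ} → (∀ i → Vec Type (size i)) → Σ (Fin n) (λ i → Fin (size i)) → Type
Family dom (i , j) = lookup (dom i) j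

str-inject : {size : Fin n → ℕ} (dom : ∀ i → Vec Type (size i)) →
             Structural (Family dom) (lookup (⨁ dom)) (λ (i , j) → inject size i j)
str-inject {zero}  dom = str-iso (λ ()) (λ ()) (λ ()) (λ ())
str-inject {suc n} {size} dom = str-≗ (λ { (zero , _) → refl ; (suc _ , _) → refl })
  (str-∘ (str-iso {f = uncons-Σ size} (cons-Σ size)
      (λ { (zero , _) → refl ; (suc _ , _) → refl })
      (λ { (inj₁ _) → refl ; (inj₂ _) → refl }) (λ { (zero , _) → refl ; (suc _ , _) → refl }))
  (str-∘ (str-⊎ str-id (str-inject (λ i → dom (suc i)))) (str-join (dom zero) (⨁ (λ i → dom (suc i))))))

str-uninject : {size : Fin n → ℕ} (dom : ∀ i → Vec Type (size i)) →
               Σ (Fin (total size) → Σ (Fin n) (λ i → Fin (size i))) λ f →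
               Structural (lookup (⨁ dom)) (Family dom) f × (∀ i j → f (inject size i j) ≡ (i , j))
str-uninject {zero} dom = (λ ()) , str-iso (λ ()) (λ ()) (λ ()) (λ ()) , λ ()
str-uninject {suc n} {size} dom =
  let (f , sf , eq) = str-uninject (λ i → dom (suc i)) in
  (λ i → cons-Σ size (Sum.map (λ i → i) f (splitAt (size zero) i))) ,
  str-∘ (str-split (dom zero) (⨁ (λ i → dom (suc i))))
  (str-∘ (str-⊎ str-id sf)
    (str-iso {f = cons-Σ size} (uncons-Σ size)
      (λ { (inj₁ _) → refl ; (inj₂ _) → refl })
      (λ { (zero , _) → refl ; (suc _ , _) → refl })
      (λ { (inj₁ _) → refl ; (inj₂ _) → refl }))) ,
  λ { zero j → cong (λ x → cons-Σ size (Sum.map _ f x)) (splitAt-↑ˡ (size zero) j _)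
    ; (suc i) j → trans
        (cong (λ x → cons-Σ size (Sum.map _ f x))
          (splitAt-↑ʳ (size zero) (total (λ i → size (suc i))) (inject _ i j)))
        (cong (λ x → cons-Σ size (inj₂ x)) (eq i j)) }

-- A typed simultaneous substitution: values in disjoint contexts, jointly
-- renamed to Θ.

record _⊩_∶_ {n m} (Θ : Vec Type m) (θ : Fin n → Tm value m) (Γ : Vec Type n) : Set where
  constructor substitution
  field
    size  : Fin n → ℕ
    dom   : ∀ i → Vec Type (size i)
    val   : ∀ i → Tm value (size i)
    typed : ∀ i → dom i ⊢ val i ∶ lookup Γ i ∣
    emb   : ∀ i → Fin (size i) → Fin m
    str   : Structural (Family dom) (lookup Θ) (λ (i , j) → emb i j)
    eq    : ∀ i → θ i ≡ rename (emb i) (val i)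

module _ {Θ : Vec Type m} {θ : Fin n → Tm value m} {Γ : Vec Type n} (S : Θ ⊩ θ ∶ Γ) where
  open _⊩_∶_ S

  ⊩-banged : Banged Γ → Banged Θ
  ⊩-banged b = str-banged str (λ (i , j) → value-banged (b i) (typed i) j)

  ⊩-lift : ∀ A → (A ∷ Θ) ⊩ lifts θ ∶ (A ∷ Γ)
  ⊩-lift A = substitution size′ dom′ val′ typed′ emb′ record { preserves = pr ; bijective = bij } eq′
    where
    size′ : Fin (suc n) → ℕ
    size′ zero    = 1
    size′ (suc i) = size i
    dom′ : ∀ i → Vec Type (size′ i)
    dom′ zero    = A ∷ []
    dom′ (suc i) = dom i
    val′ : ∀ i → Tm value (size′ i)
    val′ zero    = var zero
    val′ (suc i) = val i
    typed′ : ∀ i → dom′ i ⊢ val′ i ∶ lookup (A ∷ Γ) i ∣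
    typed′ zero    = T-var
    typed′ (suc i) = typed i
    emb′ : ∀ i → Fin (size′ i) → Fin (suc m)
    emb′ zero    j = zero
    emb′ (suc i) j = suc (emb i j)
    pr : ∀ i → _
    pr (zero , zero) = refl
    pr (suc i , j)   = Structural.preserves str (i , j)
    bij : ∀ j → _
    bij zero nb = (zero , zero) , refl , λ { (zero , zero) _ → refl ; (suc _ , _) () }
    bij (suc j) nb = let ((i , k) , p , u) = Structural.bijective str j nb in
      (suc i , k) , cong suc p ,
      λ { (suc i′ , k′) q → cong (λ (i , k) → suc i , k) (u (i′ , k′) (suc-injective q)) ; (zero , _) () }
    eq′ : ∀ i → _
    eq′ zero    = refl
    eq′ (suc i) = trans (cong wk (eq i)) (rename-rename (λ _ → refl) (val i))

  ⊩-rename : {Γ₀ : Vec Type k} (σ : Γ₀ ↝ Γ) → Θ ⊩ (λ i → θ (fun σ i)) ∶ Γ₀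
  ⊩-rename {Γ₀ = Γ₀} σ = substitution (λ i → size (f i)) (λ i → dom (f i)) (λ i → val (f i))
    (λ i → subst (λ A → dom (f i) ⊢ val (f i) ∶ A ∣) (S′.preserves i) (typed (f i)))
    (λ i → emb (f i)) (str-∘ {b = Family dom} reindex str) (λ i → eq (f i))
    where
    f : Fin _ → Fin _
    f = fun σ
    module S′ = Structural (structural σ)
    reindex : Structural (Family (λ i → dom (f i))) (Family dom) (λ (i , j) → f i , j)
    reindex = record { preserves = λ _ → refl ; bijective = bij }
      where
      bij : ∀ j → ¬ IsBang (Family dom j) → _
      bij (i , j) nb with S′.bijective i (λ b → nb (value-banged b (typed i) j))
      ... | i₀ , refl , u = (i₀ , j) , refl , λ { (i′ , j′) q → uniq i′ j′ q }
        where
        uniq : ∀ i′ j′ → (f i′ , j′) ≡ (f i₀ , j) → (i₀ , j) ≡ (i′ , j′)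
        uniq i′ j′ q with u i′ (cong proj₁ q)
        uniq i′ j′ refl | refl = refl

module _ (Γ : Vec Type n) (Γ′ : Vec Type m) {Θ : Vec Type k} {θ : Fin (n + m) → Tm value k}
         (S : Θ ⊩ θ ∶ (Γ ++ Γ′)) where
  open _⊩_∶_ S

  private
    sizeˡ : Fin n → ℕ
    sizeˡ i = size (i ↑ˡ m)
    sizeʳ : Fin m → ℕ
    sizeʳ i = size (n ↑ʳ i)
    domˡ : ∀ i → Vec Type (sizeˡ i)
    domˡ i = dom (i ↑ˡ m)
    domʳ : ∀ i → Vec Type (sizeʳ i)
    domʳ i = dom (n ↑ʳ i)

  leftCtx : Vec Type (total sizeˡ)
  leftCtx = ⨁ domˡ

  rightCtx : Vec Type (total sizeʳ)
  rightCtx = ⨁ domʳ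

  leftSub : Fin n → Tm value (total sizeˡ)
  leftSub i = rename (inject sizeˡ i) (val (i ↑ˡ m))

  rightSub : Fin m → Tm value (total sizeʳ)
  rightSub i = rename (inject sizeʳ i) (val (n ↑ʳ i))

  ⊩-left : leftCtx ⊩ leftSub ∶ Γ
  ⊩-left = substitution sizeˡ domˡ _
    (λ i → subst (λ A → _ ⊢ _ ∶ A ∣) (lookup-++ˡ Γ Γ′ i) (typed (i ↑ˡ m)))
    (inject sizeˡ) (str-inject domˡ) (λ _ → refl)

  ⊩-right : rightCtx ⊩ rightSub ∶ Γ′
  ⊩-right = substitution sizeʳ domʳ _
    (λ i → subst (λ A → _ ⊢ _ ∶ A ∣) (lookup-++ʳ Γ Γ′ i) (typed (n ↑ʳ i)))
    (inject sizeʳ) (str-inject domʳ) (λ _ → refl)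

  private
    unˡ = str-uninject domˡ
    unʳ = str-uninject domʳ

  leftRen : Fin (total sizeˡ) → Fin k
  leftRen i = let (j , l) = proj₁ unˡ i in emb (j ↑ˡ m) l

  rightRen : Fin (total sizeʳ) → Fin k
  rightRen i = let (j , l) = proj₁ unʳ i in emb (n ↑ʳ j) l

  private
    regroup : Σ (Fin n) (λ i → Fin (sizeˡ i)) ⊎ Σ (Fin m) (λ i → Fin (sizeʳ i)) →
              Σ (Fin (n + m)) (λ i → Fin (size i))
    regroup (inj₁ (i , j)) = i ↑ˡ m , j
    regroup (inj₂ (i , j)) = n ↑ʳ i , j

    aux : (x : Fin n ⊎ Fin m) → Fin (size (join n m x)) →
          Σ (Fin n) (λ i → Fin (sizeˡ i)) ⊎ Σ (Fin m) (λ i → Fin (sizeʳ i))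
    aux (inj₁ i) j = inj₁ (i , j)
    aux (inj₂ i) j = inj₂ (i , j)

    regroup-aux : ∀ x j → regroup (aux x j) ≡ (join n m x , j)
    regroup-aux (inj₁ i) j = refl
    regroup-aux (inj₂ i) j = refl

    str-regroup : Structural Sum.[ Family domˡ , Family domʳ ] (Family dom) regroup
    str-regroup = record
      { preserves = λ { (inj₁ _) → refl ; (inj₂ _) → refl }
      ; bijective = λ (i , j) _ → onto i j }
      where
      injective : ∀ x y → regroup x ≡ regroup y → x ≡ y
      injective (inj₁ (i , j)) (inj₁ (i′ , j′)) q with ↑ˡ-injective m i i′ (cong proj₁ q)
      injective (inj₁ (i , j)) (inj₁ (i′ , j′)) refl | refl = refl
      injective (inj₂ (i , j)) (inj₂ (i′ , j′)) q with ↑ʳ-injective n i i′ (cong proj₁ q)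
      injective (inj₂ (i , j)) (inj₂ (i′ , j′)) refl | refl = refl
      injective (inj₁ (i , j)) (inj₂ (i′ , j′)) q
        with () ← trans (sym (splitAt-↑ˡ n i m)) (trans (cong (λ x → splitAt n (proj₁ x)) q) (splitAt-↑ʳ n m i′))
      injective (inj₂ (i , j)) (inj₁ (i′ , j′)) q
        with () ← trans (sym (splitAt-↑ʳ n m i)) (trans (cong (λ x → splitAt n (proj₁ x)) q) (splitAt-↑ˡ n i′ m))
      onto : ∀ i j → Σ _ λ x → regroup x ≡ (i , j) × (∀ y → regroup y ≡ (i , j) → x ≡ y)
      onto i j = subst (λ i → (j : Fin (size i)) → Σ _ λ x → regroup x ≡ (i , j) × (∀ y → regroup y ≡ (i , j) → x ≡ y))
        (join-splitAt n m i)
        (λ j → aux (splitAt n i) j , regroup-aux (splitAt n i) j ,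
               λ y q → injective _ y (trans (regroup-aux (splitAt n i) j) (sym q))) j

  ⊩-glue : Glue leftCtx rightCtx Θ leftRen rightRen
  ⊩-glue = gluing (str-≗ (λ { (inj₁ _) → refl ; (inj₂ _) → refl })
    (str-∘ (str-⊎ (proj₁ (proj₂ unˡ)) (proj₁ (proj₂ unʳ))) (str-∘ str-regroup str)))

  ⊩-subˡ : (t : Tm s n) → rename leftRen (sub leftSub t) ≡ sub θ (rename (_↑ˡ m) t)
  ⊩-subˡ t = trans (rename-sub (λ i → trans
      (rename-rename (λ j → cong (λ (i , l) → emb (i ↑ˡ m) l) (proj₂ (proj₂ unˡ) i j)) (val (i ↑ˡ m)))
      (sym (eq (i ↑ˡ m)))) t)
    (sym (sub-rename (λ _ → refl) t))

  ⊩-subʳ : (t : Tm s m) → rename rightRen (sub rightSub t) ≡ sub θ (rename (n ↑ʳ_) t)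
  ⊩-subʳ t = trans (rename-sub (λ i → trans
      (rename-rename (λ j → cong (λ (i , l) → emb (n ↑ʳ i) l) (proj₂ (proj₂ unʳ) i j)) (val (n ↑ʳ i)))
      (sym (eq (n ↑ʳ i)))) t)
    (sym (sub-rename (λ _ → refl) t))

weaken-[] : {Θ : Vec Type m} → Banged Θ → [] ↝ Θ
weaken-[] b = along (λ ()) record { preserves = λ () ; bijective = λ j nb → ⊥-elim (nb (b j)) }

T-sub : {Θ : Vec Type m} {θ : Fin n → Tm value m} {Γ : Vec Type n} → Θ ⊩ θ ∶ Γ →
        {t : Tm s n} → Γ ⊢ t ∶ J → Θ ⊢ sub θ t ∶ J
T-sub S T-var = subst (λ V → _ ⊢ V ∶ _ ∣) (sym (eq zero))
  (T-struct (along (emb zero) (str-∘ {b = Family dom} {f = λ j → zero , j}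
    (str-iso (λ { (zero , j) → j }) (λ _ → refl) (λ { (zero , _) → refl }) (λ _ → refl)) str)) (typed zero))
  where open _⊩_∶_ S
T-sub S T-covar = T-struct (weaken-[] (⊩-banged S λ ())) T-covar
T-sub S (T-↑ D) = T-↑ (T-sub S D)
T-sub S (T-↓ D) = T-↓ (T-sub S D)
T-sub S (T-μ̄ D) = T-μ̄ (T-sub (⊩-lift S _) D)
T-sub S (T-μ D) = T-μ (T-sub S D)
T-sub S (T-cut {Γ = Γ} {Γ′} {t = t} {e} D D′) = subst₂ (λ t e → _ ⊢ cut _ t e ∶ _) (⊩-subˡ Γ Γ′ S t) (⊩-subʳ Γ Γ′ S e)
  (T-cut* (⊩-glue Γ Γ′ S) (T-sub (⊩-left Γ Γ′ S) D) (T-sub (⊩-right Γ Γ′ S) D′))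
T-sub S (T-struct {t = t} σ D) = subst (λ t → _ ⊢ t ∶ _) (sym (sub-rename (λ _ → refl) t))
  (T-sub (⊩-rename S σ) D)
T-sub S (T-push {Γ = Γ} {Γ′} {V = t} {e} D D′) = subst₂ (λ t e → _ ⊢ push t e ∶ _) (⊩-subˡ Γ Γ′ S t) (⊩-subʳ Γ Γ′ S e)
  (T-push* (⊩-glue Γ Γ′ S) (T-sub (⊩-left Γ Γ′ S) D) (T-sub (⊩-right Γ Γ′ S) D′))
T-sub S (T-lam D) = T-lam (T-sub (⊩-lift S _) D)
T-sub S (T-pair {Γ = Γ} {Γ′} {V = t} {e} D D′) = subst₂ (λ t e → _ ⊢ pair t e ∶ _) (⊩-subˡ Γ Γ′ S t) (⊩-subʳ Γ Γ′ S e)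
  (T-pair* (⊩-glue Γ Γ′ S) (T-sub (⊩-left Γ Γ′ S) D) (T-sub (⊩-right Γ Γ′ S) D′))
T-sub S (T-μ̄pair D) = T-μ̄pair (T-sub (⊩-lift (⊩-lift S _) _) D)
T-sub S (T-with D D′) = T-with (T-sub S D) (T-sub S D′)
T-sub S (T-π D) = T-π (T-sub S D)
T-sub S (T-case D D′) = T-case (T-sub (⊩-lift S _) D) (T-sub (⊩-lift S _) D′)
T-sub S (T-ι D) = T-ι (T-sub S D)
T-sub S T-unit = T-struct (weaken-[] (⊩-banged S λ ())) T-unit
T-sub S (T-μ̄unit D) = T-μ̄unit (T-sub S D)
T-sub S (T-top D) = T-top (T-sub S D)
T-sub S (T-zero D) = T-zero (T-sub S D)
T-sub S (T-μbang b D) = T-μbang (⊩-banged S b) (T-sub S D)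
T-sub S (T-bang D) = T-bang (T-sub S D)
T-sub S (T-dia D) = T-dia (T-sub S D)
T-sub S (T-μ̄dia b D) = T-μ̄dia (⊩-banged S b) (T-sub (⊩-lift S _) D)

⊩-id : {Γ : Vec Type n} → Γ ⊩ var ∶ Γ
⊩-id {Γ = Γ} = substitution (λ _ → 1) (λ i → lookup Γ i ∷ []) (λ _ → var zero) (λ _ → T-var) (λ i _ → i)
  (str-iso (λ i → i , zero) (λ { (_ , zero) → refl }) (λ _ → refl) (λ { (_ , zero) → refl })) (λ _ → refl)

⊩-cons : {Γ₁ : Vec Type m} {Γ₂ : Vec Type k} {Γ : Vec Type n} {l : ℕ} {Θ : Vec Type l}
         {ρ₁ : Fin m → Fin l} {ρ₂ : Fin k → Fin l} {V : Tm value m} {θ : Fin n → Tm value k} →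
         Glue Γ₁ Γ₂ Θ ρ₁ ρ₂ → Γ₁ ⊢ V ∶ A ∣ → Γ₂ ⊩ θ ∶ Γ →
         Θ ⊩ rename ρ₁ V ◂ (λ i → rename ρ₂ (θ i)) ∶ (A ∷ Γ)
⊩-cons {m} {n = n} {A = A} {Γ₁} {Γ = Γ} {l} {ρ₁ = ρ₁} {ρ₂} {V} {θ} g D S =
  substitution size′ dom′ val′ typed′ emb′
    (str-≗ (λ { (zero , _) → refl ; (suc _ , _) → refl })
      (str-∘ (str-iso {b = Sum.[ lookup Γ₁ , Family dom ]} {f = uncons-Σ size′} (cons-Σ size′)
        (λ { (zero , _) → refl ; (suc _ , _) → refl })
        (λ { (inj₁ _) → refl ; (inj₂ _) → refl }) (λ { (zero , _) → refl ; (suc _ , _) → refl }))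
      (str-∘ (str-⊎ str-id str) (jointly g)))) eq′
  where
  open _⊩_∶_ S
  size′ : Fin (suc n) → ℕ
  size′ zero    = m
  size′ (suc i) = size i
  dom′ : ∀ i → Vec Type (size′ i)
  dom′ zero    = Γ₁
  dom′ (suc i) = dom i
  val′ : ∀ i → Tm value (size′ i)
  val′ zero    = V
  val′ (suc i) = val i
  typed′ : ∀ i → dom′ i ⊢ val′ i ∶ lookup (A ∷ Γ) i ∣
  typed′ zero    = D
  typed′ (suc i) = typed i
  emb′ : ∀ i → Fin (size′ i) → Fin l
  emb′ zero    j = ρ₁ j
  emb′ (suc i) j = ρ₂ (emb i j)
  eq′ : ∀ i → (rename ρ₁ V ◂ (λ i → rename ρ₂ (θ i))) i ≡ rename (emb′ i) (val′ i)
  eq′ zero    = refl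
  eq′ (suc i) = trans (cong (rename ρ₂) (eq i)) (rename-rename (λ _ → refl) (val i))

module _ {n m k l : ℕ} {Γ : Vec Type n} {Γ′ : Vec Type m} {Ξ : Vec Type k} {Θ : Vec Type l} {N : ℕ} {Ω : Vec Type N}
         {ρ : Fin n → Fin l} {ρ′ : Fin m → Fin l} {σ : Fin l → Fin N} {σ′ : Fin k → Fin N}
         (g : Glue Γ Γ′ Θ ρ ρ′) (h : Glue Θ Ξ Ω σ σ′) where

  outer : Fin (n + k) → Fin N
  outer i = Sum.[ (λ j → σ (ρ j)) , σ′ ] (splitAt n i)

  glue-nest : Structural Sum.[ Sum.[ lookup Γ , lookup Γ′ ] , lookup Ξ ] (lookup Ω)
                         Sum.[ Sum.[ (λ i → σ (ρ i)) , (λ i → σ (ρ′ i)) ] , σ′ ]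
  glue-nest = str-≗ (λ { (inj₁ (inj₁ _)) → refl ; (inj₁ (inj₂ _)) → refl ; (inj₂ _) → refl })
    (str-∘ (str-⊎ (jointly g) (str-id {a = lookup Ξ})) (jointly h))

  glue-move : Glue Γ′ (Γ ++ Ξ) Ω (λ i → σ (ρ′ i)) outer
  glue-move = gluing (str-≗ (λ { (inj₁ _) → refl ; (inj₂ i) → lemma (splitAt n i) })
    (str-∘ (str-⊎ (str-id {a = lookup Γ′}) (str-split Γ Ξ)) (str-∘ shuffle glue-nest)))
    where
    f : Fin m ⊎ (Fin n ⊎ Fin k) → (Fin n ⊎ Fin m) ⊎ Fin k
    f (inj₁ i)        = inj₁ (inj₂ i)
    f (inj₂ (inj₁ i)) = inj₁ (inj₁ i)
    f (inj₂ (inj₂ i)) = inj₂ i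
    f⁻¹ : (Fin n ⊎ Fin m) ⊎ Fin k → Fin m ⊎ (Fin n ⊎ Fin k)
    f⁻¹ (inj₁ (inj₂ i)) = inj₁ i
    f⁻¹ (inj₁ (inj₁ i)) = inj₂ (inj₁ i)
    f⁻¹ (inj₂ i)        = inj₂ (inj₂ i)
    shuffle : Structural Sum.[ lookup Γ′ , Sum.[ lookup Γ , lookup Ξ ] ]
                         Sum.[ Sum.[ lookup Γ , lookup Γ′ ] , lookup Ξ ] f
    shuffle = str-iso f⁻¹
      (λ { (inj₁ _) → refl ; (inj₂ (inj₁ _)) → refl ; (inj₂ (inj₂ _)) → refl })
      (λ { (inj₁ (inj₁ _)) → refl ; (inj₁ (inj₂ _)) → refl ; (inj₂ _) → refl })
      (λ { (inj₁ _) → refl ; (inj₂ (inj₁ _)) → refl ; (inj₂ (inj₂ _)) → refl })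
    lemma : (x : Fin n ⊎ Fin k) →
            Sum.[ Sum.[ (λ i → σ (ρ i)) , (λ i → σ (ρ′ i)) ] , σ′ ] (f (inj₂ x)) ≡
            Sum.[ (λ j → σ (ρ j)) , σ′ ] x
    lemma (inj₁ _) = refl
    lemma (inj₂ _) = refl

glue-swap : {Γ : Vec Type n} {Γ′ : Vec Type m} {Θ : Vec Type k} {ρ : Fin n → Fin k} {ρ′ : Fin m → Fin k} →
            Glue Γ Γ′ Θ ρ ρ′ → Glue Γ′ Γ Θ ρ′ ρ
glue-swap g = gluing (str-≗ (λ { (inj₁ _) → refl ; (inj₂ _) → refl })
  (str-∘ (str-iso {f = Sum.swap} Sum.swap
    (λ { (inj₁ _) → refl ; (inj₂ _) → refl })
    (λ { (inj₁ _) → refl ; (inj₂ _) → refl })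
    (λ { (inj₁ _) → refl ; (inj₂ _) → refl })) (jointly g)))

glue-bangˡ : {Γ : Vec Type n} {Γ′ : Vec Type m} {Θ : Vec Type k} {ρ : Fin n → Fin k} {ρ′ : Fin m → Fin k} →
             Banged Γ → Glue Γ Γ′ Θ ρ ρ′ → Γ′ ↝ Θ
glue-bangˡ {Γ = Γ} {Γ′} {Θ} {ρ} {ρ′} b g = along ρ′ record
  { preserves = λ i → preserves (inj₂ i) ; bijective = bij }
  where
  open Structural (jointly g)
  bij : ∀ j → ¬ IsBang (lookup Θ j) → Σ _ λ i → ρ′ i ≡ j × (∀ i′ → ρ′ i′ ≡ j → i ≡ i′)
  bij j nb with bijective j nb
  ... | inj₁ i , p , _ = ⊥-elim (nb (subst IsBang (trans (sym (preserves (inj₁ i))) (cong (lookup Θ) p)) (b i)))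
  ... | inj₂ i , p , u = i , p , λ i′ q → inj₂-injective (u (inj₂ i′) q)

-- `Over t ρ Γ J` is what inversion gives for t = rename ρ t₁ with Γ ⊢ t₁ ∶ J.

Img : (Fin n → Fin m) → Vec Type n → Tm s m → Judgement s → Set
Img ρ Γ t J = Σ _ λ t₁ → t ≡ rename ρ t₁ × Γ ⊢ t₁ ∶ J

Img-↝ : {Γ : Vec Type n} {Γ′ : Vec Type m} {ρ : Fin n → Fin k} {ρ′ : Fin m → Fin k} {t : Tm s k}
        (σ : Γ ↝ Γ′) → (∀ i → ρ′ (fun σ i) ≡ ρ i) → Img ρ Γ t J → Img ρ′ Γ′ t J
Img-↝ σ eq (t₁ , p , D) = rename (fun σ) t₁ , trans p (sym (rename-rename eq t₁)) , T-struct σ D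

record Split {δ₁ δ₂ : Sort} (ρ : Fin n → Fin m) (Γ : Vec Type n)
             (t : Tm δ₁ m) (u : Tm δ₂ m) (J₁ : Judgement δ₁) (J₂ : Judgement δ₂) : Set where
  constructor splitting
  field
    {n₁ n₂} : ℕ
    {Γ₁}    : Vec Type n₁
    {Γ₂}    : Vec Type n₂
    {ρ₁}    : Fin n₁ → Fin n
    {ρ₂}    : Fin n₂ → Fin n
    glued   : Glue Γ₁ Γ₂ Γ ρ₁ ρ₂
    imgˡ    : Img (λ i → ρ (ρ₁ i)) Γ₁ t J₁
    imgʳ    : Img (λ i → ρ (ρ₂ i)) Γ₂ u J₂

Split-++ : ∀ {δ₁ δ₂} {Γ : Vec Type n} {Γ′ : Vec Type m} {t : Tm δ₁ n} {u : Tm δ₂ m}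
           {J₁ : Judgement δ₁} {J₂ : Judgement δ₂} (ρ : Fin (n + m) → Fin k) → Γ ⊢ t ∶ J₁ → Γ′ ⊢ u ∶ J₂ →
           Split ρ (Γ ++ Γ′) (rename ρ (rename (_↑ˡ m) t)) (rename ρ (rename (n ↑ʳ_) u)) J₁ J₂
Split-++ {Γ = Γ} {Γ′} {t} {u} ρ D D′ = splitting
  (gluing (str-≗ (λ { (inj₁ _) → refl ; (inj₂ _) → refl }) (str-join Γ Γ′)))
  (_ , rename-rename (λ _ → refl) t , D) (_ , rename-rename (λ _ → refl) u , D′)

Split-↝ : ∀ {δ₁ δ₂} {Γ : Vec Type n} {Γ′ : Vec Type m} {ρ : Fin n → Fin k} {ρ′ : Fin m → Fin k}
          {t : Tm δ₁ k} {u : Tm δ₂ k} {J₁ : Judgement δ₁} {J₂ : Judgement δ₂}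
          (σ : Γ ↝ Γ′) → (∀ i → ρ′ (fun σ i) ≡ ρ i) → Split ρ Γ t u J₁ J₂ → Split ρ′ Γ′ t u J₁ J₂
Split-↝ σ eq (splitting {ρ₁ = ρ₁} {ρ₂} g (t , p , D) (u , q , D′)) = splitting
  (gluing (str-≗ (λ { (inj₁ _) → refl ; (inj₂ _) → refl }) (str-∘ (jointly g) (structural σ))))
  (t , trans p (rename-cong (λ i → sym (eq (ρ₁ i))) t) , D)
  (u , trans q (rename-cong (λ i → sym (eq (ρ₂ i))) u) , D′)

Over : Tm s m → (Fin n → Fin m) → Vec Type n → Judgement s → Set
Over (μ ε c) ρ Γ (A ∣)         = Σ (Ty ε) λ T → A ≡ (ε , T) × Img ρ Γ c (⊢ A)
Over (μ̄ ε c) ρ Γ (A ⊢ B)       = Σ (Ty ε) λ T → A ≡ (ε , T) × Img (lift ρ) (A ∷ Γ) c (⊢ B)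
Over (cut ε t e) ρ Γ (⊢ B)     = Σ (Ty ε) λ T → Split ρ Γ t e ((ε , T) ∣) ((ε , T) ⊢ B)
Over (↑ V) ρ Γ (A ∣)           = Img ρ Γ V (A ∣)
Over (↓ S) ρ Γ (A ⊢ B)         = Img ρ Γ S (A ⊢ B)
Over (var i) ρ Γ J             = Unit
Over unit ρ Γ (A ∣)            = Banged Γ × A ≡ (pos , 𝟏)
Over (pair V W) ρ Γ (A ∣)      = ∃ λ B → ∃ λ C → A ≡ (pos , B ⊗ C) × Split ρ Γ V W (B ∣) (C ∣)
Over (ι i V) ρ Γ (A ∣)         = ∃ λ B → ∃ λ C → A ≡ (pos , B ⊕ C) × Img ρ Γ V (pick i B C ∣)
Over (μlam c) ρ Γ (A ∣)        = ∃ λ B → ∃ λ C → A ≡ (neg , B ⊸ C) × Img (lift ρ) (B ∷ Γ) c (⊢ C)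
Over (μwith c d) ρ Γ (A ∣)     = ∃ λ B → ∃ λ C → A ≡ (neg , B & C) × Img ρ Γ c (⊢ B) × Img ρ Γ d (⊢ C)
Over (μtop V) ρ Γ J            = Unit
Over (μbang c) ρ Γ (A ∣)       = ∃ λ B → A ≡ (pos , ! B) × Img ρ Γ c (⊢ B)
Over (dia V) ρ Γ (A ∣)         = ∃ λ B → A ≡ (neg , ◇ B) × Img ρ Γ V (B ∣)
Over covar ρ Γ J               = Unit
Over (μ̄unit c) ρ Γ (A ⊢ B)     = Img ρ Γ c (⊢ B)
Over (μ̄pair c) ρ Γ (A ⊢ B)     = ∃ λ C → ∃ λ D → A ≡ (pos , C ⊗ D) × Img (lift (lift ρ)) (D ∷ C ∷ Γ) c (⊢ B)
Over (μ̄case c d) ρ Γ (A ⊢ B)   = ∃ λ C → ∃ λ D → A ≡ (pos , C ⊕ D) ×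
                                 Img (lift ρ) (C ∷ Γ) c (⊢ B) × Img (lift ρ) (D ∷ Γ) d (⊢ B)
Over (push V S) ρ Γ (A ⊢ B)    = ∃ λ C → ∃ λ D → A ≡ (neg , C ⊸ D) × Split ρ Γ V S (C ∣) (D ⊢ B)
Over (π i S) ρ Γ (A ⊢ B)       = ∃ λ C → ∃ λ D → A ≡ (neg , C & D) × Img ρ Γ S (pick i C D ⊢ B)
Over (μ̄zero S) ρ Γ J           = Unit
Over (bang S) ρ Γ (A ⊢ B)      = ∃ λ C → A ≡ (pos , ! C) × Img ρ Γ S (C ⊢ B)
Over (μ̄dia c) ρ Γ (A ⊢ B)      = ∃ λ C → A ≡ (neg , ◇ C) × Img (lift ρ) (C ∷ Γ) c (⊢ B)

Over-↝ : {Γ : Vec Type n} {Γ′ : Vec Type m} {ρ : Fin n → Fin k} {ρ′ : Fin m → Fin k}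
         (σ : Γ ↝ Γ′) → (∀ i → ρ′ (fun σ i) ≡ ρ i) → (t : Tm s k) (J : Judgement s) →
         Over t ρ Γ J → Over t ρ′ Γ′ J
Over-↝ σ eq (μ ε c) (A ∣) (T , p , x)       = T , p , Img-↝ σ eq x
Over-↝ σ eq (μ̄ ε c) (A ⊢ B) (T , p , x)     = T , p , Img-↝ (↝-lift A σ) (lift-comp eq) x
Over-↝ σ eq (cut ε t e) (⊢ B) (T , x)       = T , Split-↝ σ eq x
Over-↝ σ eq (↑ V) (A ∣) x                   = Img-↝ σ eq x
Over-↝ σ eq (↓ S) (A ⊢ B) x                 = Img-↝ σ eq x
Over-↝ σ eq (var i) J x                     = x
Over-↝ σ eq unit (A ∣) (b , p)              = str-banged (structural σ) b , p
Over-↝ σ eq (pair V W) (A ∣) (B , C , p , x) = B , C , p , Split-↝ σ eq x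
Over-↝ σ eq (ι i V) (A ∣) (B , C , p , x)   = B , C , p , Img-↝ σ eq x
Over-↝ σ eq (μlam c) (A ∣) (B , C , p , x)  = B , C , p , Img-↝ (↝-lift B σ) (lift-comp eq) x
Over-↝ σ eq (μwith c d) (A ∣) (B , C , p , x , y) = B , C , p , Img-↝ σ eq x , Img-↝ σ eq y
Over-↝ σ eq (μtop V) J x                    = x
Over-↝ σ eq (μbang c) (A ∣) (B , p , x)     = B , p , Img-↝ σ eq x
Over-↝ σ eq (dia V) (A ∣) (B , p , x)       = B , p , Img-↝ σ eq x
Over-↝ σ eq covar J x                       = x
Over-↝ σ eq (μ̄unit c) (A ⊢ B) x             = Img-↝ σ eq x
Over-↝ σ eq (μ̄pair c) (A ⊢ B) (C , D , p , x) =
  C , D , p , Img-↝ (↝-lift D (↝-lift C σ)) (lift-comp (lift-comp eq)) x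
Over-↝ σ eq (μ̄case c d) (A ⊢ B) (C , D , p , x , y) =
  C , D , p , Img-↝ (↝-lift C σ) (lift-comp eq) x , Img-↝ (↝-lift D σ) (lift-comp eq) y
Over-↝ σ eq (push V S) (A ⊢ B) (C , D , p , x) = C , D , p , Split-↝ σ eq x
Over-↝ σ eq (π i S) (A ⊢ B) (C , D , p , x) = C , D , p , Img-↝ σ eq x
Over-↝ σ eq (μ̄zero S) J x                   = x
Over-↝ σ eq (bang S) (A ⊢ B) (C , p , x)    = C , p , Img-↝ σ eq x
Over-↝ σ eq (μ̄dia c) (A ⊢ B) (C , p , x)    = C , p , Img-↝ (↝-lift C σ) (lift-comp eq) x

over : {Γ : Vec Type n} {t : Tm s n} {J : Judgement s} → Γ ⊢ t ∶ J → (ρ : Fin n → Fin m) →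
       Over (rename ρ t) ρ Γ J
over T-var ρ                 = _
over T-covar ρ               = _
over (T-↑ D) ρ               = _ , refl , D
over (T-↓ D) ρ               = _ , refl , D
over (T-μ̄ D) ρ               = _ , refl , _ , refl , D
over (T-μ D) ρ               = _ , refl , _ , refl , D
over (T-cut D D′) ρ          = _ , Split-++ ρ D D′
over (T-struct {J = J} {t = t} σ D) ρ =
  Over-↝ σ (λ _ → refl) (rename ρ (rename (fun σ) t)) J
    (subst (λ t → Over t (λ i → ρ (fun σ i)) _ J) (sym (rename-rename (λ _ → refl) t))
      (over D (λ i → ρ (fun σ i))))
over (T-push D D′) ρ         = _ , _ , refl , Split-++ ρ D D′
over (T-lam D) ρ             = _ , _ , refl , _ , refl , D
over (T-pair D D′) ρ         = _ , _ , refl , Split-++ ρ D D′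
over (T-μ̄pair D) ρ           = _ , _ , refl , _ , refl , D
over (T-with D D′) ρ         = _ , _ , refl , (_ , refl , D) , (_ , refl , D′)
over (T-π D) ρ               = _ , _ , refl , _ , refl , D
over (T-case D D′) ρ         = _ , _ , refl , (_ , refl , D) , (_ , refl , D′)
over (T-ι D) ρ               = _ , _ , refl , _ , refl , D
over T-unit ρ                = (λ ()) , refl
over (T-μ̄unit D) ρ           = _ , refl , D
over (T-top D) ρ             = _
over (T-zero D) ρ            = _
over (T-μbang b D) ρ         = _ , refl , _ , refl , D
over (T-bang D) ρ            = _ , refl , _ , refl , D
over (T-dia D) ρ             = _ , refl , _ , refl , D
over (T-μ̄dia b D) ρ          = _ , refl , _ , refl , D

over-Img : {Γ : Vec Type n} {ρ : Fin n → Fin m} {t : Tm s m} → Img ρ Γ t J → Over t ρ Γ J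
over-Img (_ , refl , D) = over D _

over-ret : ∀ ε {Γ : Vec Type n} {ρ : Fin n → Fin m} {V} → Img ρ Γ (ret ε V) (A ∣) → Img ρ Γ V (A ∣)
over-ret pos x = over-Img x
over-ret neg x = x

over-stk : ∀ ε {Γ : Vec Type n} {ρ : Fin n → Fin m} {S} → Img ρ Γ (stk ε S) (A ⊢ B) → Img ρ Γ S (A ⊢ B)
over-stk pos x = x
over-stk neg x = over-Img x

Img-pick : ∀ i {ρ : Fin n → Fin m} {Γ : Vec Type n} {c₁ c₂ : Tm s m} {F : Type → Judgement s} →
           Img ρ Γ c₁ (F A) → Img ρ Γ c₂ (F B) → Img ρ Γ (pick i c₁ c₂) (F (pick i A B))
Img-pick one x y = x
Img-pick two x y = y

Img-case : ∀ i {ρ : Fin (suc n) → Fin m} {Γ : Vec Type n} {c₁ c₂ : Tm s m} →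
           Img ρ (A ∷ Γ) c₁ J → Img ρ (B ∷ Γ) c₂ J → Img ρ (pick i A B ∷ Γ) (pick i c₁ c₂) J
Img-case one x y = x
Img-case two x y = y

Img-[] : {Γ : Vec Type n} {Γ′ : Vec Type m} {Θ : Vec Type k} {ρ : Fin n → Fin k} {ρ′ : Fin m → Fin k} →
         Glue Γ Γ′ Θ ρ ρ′ → {V : Tm value k} {c : Tm s (suc k)} →
         Img ρ Γ V (A ∣) → Img (lift ρ′) (A ∷ Γ′) c J → Θ ⊢ c [ V ] ∶ J
Img-[] g (V , refl , DV) (c , refl , Dc) = subst (λ c → _ ⊢ c ∶ _)
  (sym (sub-rename (λ { zero → refl ; (suc _) → refl }) c)) (T-sub (⊩-cons g DV ⊩-id) Dc)

Img-plug : {Γ : Vec Type n} {Ξ : Vec Type m} {Θ : Vec Type k} {ρ : Fin n → Fin k} {ρ′ : Fin m → Fin k} →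
           Glue Γ Ξ Θ ρ ρ′ → {S : Tm stack k} {c : Tm command k} →
           Img ρ′ Ξ S (B ⊢ C) → Img ρ Γ c (⊢ B) → Θ ⊢ plug S c ∶ ⊢ C
Img-plug g (S , refl , DS) (c , refl , Dc) = T-plug* g DS Dc

glue-join : (Γ : Vec Type n) (Γ′ : Vec Type m) → Glue Γ Γ′ (Γ ++ Γ′) (_↑ˡ m) (n ↑ʳ_)
glue-join Γ Γ′ = gluing (str-≗ (λ { (inj₁ _) → refl ; (inj₂ _) → refl }) (str-join Γ Γ′))

module _ {n m k l N : ℕ} {Γ : Vec Type n} {Γ′ : Vec Type m} {Ξ : Vec Type k} {Θ : Vec Type l} {Ω : Vec Type N}
         {ρ : Fin n → Fin l} {ρ′ : Fin m → Fin l} {σ : Fin l → Fin N} {σ′ : Fin k → Fin N}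
         (h : Glue Γ Γ′ Θ ρ ρ′) (g : Glue Θ Ξ Ω σ σ′) where

  private
    embed : ∀ V i → rename (outer h g) ((rename (_↑ˡ k) V ◂ (λ i → var (n ↑ʳ i))) i) ≡
                    (rename (λ i → σ (ρ i)) V ◂ (λ i → var (σ′ i))) i
    embed V zero    = rename-rename (λ i → cong Sum.[ (λ i → σ (ρ i)) , σ′ ] (splitAt-↑ˡ n i k)) V
    embed V (suc i) = cong (λ x → var (Sum.[ (λ i → σ (ρ i)) , σ′ ] x)) (splitAt-↑ʳ n k i)

  Img-[⨾] : ∀ {V W c} → Img (λ i → σ (ρ i)) Γ V (A ∣) → Img (λ i → σ (ρ′ i)) Γ′ W (B ∣) →
            Img (lift (lift σ′)) (B ∷ A ∷ Ξ) c J → Ω ⊢ c [ V ⨾ W ] ∶ J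
  Img-[⨾] (V , refl , DV) (W , refl , DW) (c , refl , Dc) = subst (λ c → _ ⊢ c ∶ _)
    (trans (sub-cong {θ′ = rename _ W ◂ rename _ V ◂ λ i → var (σ′ i)}
             (λ { zero → refl ; (suc i) → embed V i }) c)
           (sym (sub-rename (λ { zero → refl ; (suc zero) → refl ; (suc (suc _)) → refl }) c)))
    (T-sub (⊩-cons (glue-move h g) DW (⊩-cons (glue-join Γ Ξ) DV ⊩-id)) Dc)

  Img-plug-[] : ∀ {V S c} → Img (λ i → σ (ρ i)) Γ V (A ∣) → Img (λ i → σ (ρ′ i)) Γ′ S (B ⊢ C) →
                Img (lift σ′) (A ∷ Ξ) c (⊢ B) → Ω ⊢ plug S (c [ V ]) ∶ ⊢ C
  Img-plug-[] (V , refl , DV) w (c , refl , Dc) = Img-plug (glue-swap (glue-move h g)) w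
    (_ , trans (sub-rename (λ { zero → refl ; (suc _) → refl }) c)
               (sym (rename-sub (embed V) c)) ,
     T-sub (⊩-cons (glue-join Γ Ξ) DV ⊩-id) Dc)

subject-reduction : {Γ : Vec Type n} {c c′ : Tm command n} → c ⊳ c′ → Γ ⊢ c ∶ ⊢ B → Γ ⊢ c′ ∶ ⊢ B
subject-reduction {c = c} r D with subst (λ c → Over c (λ i → i) _ _) (rename-id (λ _ → refl) c) (over D (λ i → i))
subject-reduction (R-μ̄ ε V c) D | T , splitting g x y with over-Img y
... | _ , refl , z = Img-[] g (over-ret ε x) z
subject-reduction (R-μ ε c S) D | T , splitting g x y with over-Img x
... | _ , refl , z = Img-plug g (over-stk ε y) z
subject-reduction (R-unit c) D | T , splitting g x y with over-Img (over-ret pos x) | over-Img y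
... | b , refl | (c₁ , refl , Dc) = T-struct (glue-bangˡ b g) Dc
subject-reduction (R-pair V W c) D | T , splitting g x y with over-Img (over-ret pos x) | over-Img y
... | _ , _ , refl , splitting h v w | _ , _ , refl , z = Img-[⨾] h g v w z
subject-reduction (R-ι i V c₁ c₂) D | T , splitting g x y with over-Img (over-ret pos x) | over-Img y
... | _ , _ , refl , v | _ , _ , refl , z₁ , z₂ = Img-[] g v (Img-case i z₁ z₂)
subject-reduction (R-lam c V S) D | T , splitting g x y with over-Img x | over-Img (over-stk neg y)
... | _ , _ , refl , z | _ , _ , refl , splitting h v w = Img-plug-[] h (glue-swap g) v w z
subject-reduction (R-with i c₁ c₂ S) D | T , splitting g x y with over-Img x | over-Img (over-stk neg y)
... | _ , _ , refl , z₁ , z₂ | _ , _ , refl , w = Img-plug g w (Img-pick i {F = ⊢_} z₁ z₂)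
subject-reduction (R-bang c S) D | T , splitting g x y with over-Img (over-ret pos x) | over-Img y
... | _ , refl , z | _ , refl , w = Img-plug g w z
subject-reduction (R-dia V c) D | T , splitting g x y with over-Img x | over-Img (over-stk neg y)
... | _ , refl , v | _ , refl , z = Img-[] g v z

R : {Γ : Vec Type n} {c c′ : Tm command n} → c ⊳ c′ → Γ ⊢ c ∶ ⊢ B → Γ ⊢ c ≃ c′ ∶ ⊢ B
R r D = ≃-R r D (subject-reduction r D)

≃-typed : {Γ : Vec Type n} {t u : Tm s n} {J : Judgement s} → Γ ⊢ t ≃ u ∶ J → (Γ ⊢ t ∶ J) × (Γ ⊢ u ∶ J)
≃-typed (≃-R _ D E) = D , E
≃-typed (≃-E _ D E) = D , E
≃-typed (≃-refl D) = D , D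
≃-typed (≃-sym p) = Product.swap (≃-typed p)
≃-typed (≃-trans p q) = proj₁ (≃-typed p) , proj₂ (≃-typed q)
≃-typed (≃-↑ p) = Product.map T-↑ T-↑ (≃-typed p)
≃-typed (≃-↓ p) = Product.map T-↓ T-↓ (≃-typed p)
≃-typed (≃-μ̄ p) = Product.map T-μ̄ T-μ̄ (≃-typed p)
≃-typed (≃-μ p) = Product.map T-μ T-μ (≃-typed p)
≃-typed (≃-cut p q) = Product.zip T-cut T-cut (≃-typed p) (≃-typed q)
≃-typed (≃-struct σ p) = Product.map (T-struct σ) (T-struct σ) (≃-typed p)
≃-typed (≃-push p q) = Product.zip T-push T-push (≃-typed p) (≃-typed q)
≃-typed (≃-lam p) = Product.map T-lam T-lam (≃-typed p)
≃-typed (≃-pair p q) = Product.zip T-pair T-pair (≃-typed p) (≃-typed q)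
≃-typed (≃-μ̄pair p) = Product.map T-μ̄pair T-μ̄pair (≃-typed p)
≃-typed (≃-with p q) = Product.zip T-with T-with (≃-typed p) (≃-typed q)
≃-typed (≃-π p) = Product.map T-π T-π (≃-typed p)
≃-typed (≃-case p q) = Product.zip T-case T-case (≃-typed p) (≃-typed q)
≃-typed (≃-ι p) = Product.map T-ι T-ι (≃-typed p)
≃-typed (≃-μ̄unit p) = Product.map T-μ̄unit T-μ̄unit (≃-typed p)
≃-typed (≃-top p) = Product.map T-top T-top (≃-typed p)
≃-typed (≃-zero p) = Product.map T-zero T-zero (≃-typed p)
≃-typed (≃-μbang b p) = Product.map (T-μbang b) (T-μbang b) (≃-typed p)
≃-typed (≃-bang p) = Product.map T-bang T-bang (≃-typed p)
≃-typed (≃-dia p) = Product.map T-dia T-dia (≃-typed p)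
≃-typed (≃-μ̄dia b p) = Product.map (T-μ̄dia b) (T-μ̄dia b) (≃-typed p)

infixr 2 _⟫_ _⟫≡_ _≡⟫_

_⟫_ : {Γ : Vec Type n} {t u v : Tm s n} → Γ ⊢ t ≃ u ∶ J → Γ ⊢ u ≃ v ∶ J → Γ ⊢ t ≃ v ∶ J
_⟫_ = ≃-trans

_⟫≡_ : {Γ : Vec Type n} {t u v : Tm s n} → Γ ⊢ t ≃ u ∶ J → u ≡ v → Γ ⊢ t ≃ v ∶ J
p ⟫≡ refl = p

_≡⟫_ : {Γ : Vec Type n} {t u v : Tm s n} → t ≡ u → Γ ⊢ u ≃ v ∶ J → Γ ⊢ t ≃ v ∶ J
refl ≡⟫ p = p

closed : Tm s 0 → Tm s n
closed = rename (λ ())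

retn : ∀ ε → Tm value n → Tm command n
retn ε V = cut ε (ret ε V) (stk ε covar)

seq : ∀ ε → Tm command n → Tm command 1 → Tm command n
seq ε c d = cut ε (μ ε c) (closed (μ̄ ε d))

infix 8 _⟪_⟫

_⟪_⟫ : Tm s 1 → Tm value n → Tm s n
t ⟪ V ⟫ = sub (λ _ → V) t

glue-[]ʳ : {Γ : Vec Type n} → Glue Γ [] Γ (λ i → i) (λ ())
glue-[]ʳ = gluing (str-iso inj₁ (λ { (inj₁ _) → refl }) (λ _ → refl) (λ { (inj₁ _) → refl }))

glue-[]ˡ : {Γ : Vec Type n} → Glue [] Γ Γ (λ ()) (λ i → i)
glue-[]ˡ = glue-swap glue-[]ʳ

glue-∷ : {Γ : Vec Type n} → Glue (A ∷ []) Γ (A ∷ Γ) (λ _ → zero) suc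
glue-∷ = gluing (str-iso (λ { zero → inj₁ zero ; (suc i) → inj₂ i })
  (λ { (inj₁ zero) → refl ; (inj₂ _) → refl })
  (λ { zero → refl ; (suc _) → refl })
  (λ { (inj₁ zero) → refl ; (inj₂ _) → refl }))

swap : Fin (suc (suc n)) → Fin (suc (suc n))
swap zero          = suc zero
swap (suc zero)    = zero
swap (suc (suc i)) = suc (suc i)

↝-swap : {Γ : Vec Type n} → (A ∷ B ∷ Γ) ↝ (B ∷ A ∷ Γ)
↝-swap = along swap (str-iso swap
  (λ { zero → refl ; (suc zero) → refl ; (suc (suc _)) → refl }) inv inv)
  where
  inv : ∀ i → swap (swap i) ≡ i
  inv zero          = refl
  inv (suc zero)    = refl
  inv (suc (suc i)) = refl

rename-ret : ∀ ε (ρ : Fin n → Fin m) V → rename ρ (ret ε V) ≡ ret ε (rename ρ V)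
rename-ret pos ρ V = refl
rename-ret neg ρ V = refl

rename-stk : ∀ ε (ρ : Fin n → Fin m) S → rename ρ (stk ε S) ≡ stk ε (rename ρ S)
rename-stk pos ρ S = refl
rename-stk neg ρ S = refl

plug-stk : ∀ ε (S S′ : Tm stack n) → plug S (stk ε S′) ≡ stk ε (plug S S′)
plug-stk pos S S′ = refl
plug-stk neg S S′ = refl

rename-closed : (ρ : Fin n → Fin m) (t : Tm s 0) → rename ρ (closed t) ≡ closed t
rename-closed ρ t = rename-rename (λ ()) t

sub-closed : (θ : Fin n → Tm value m) (t : Tm s 0) → sub θ (closed t) ≡ closed t
sub-closed θ t = trans (sub-rename {θ′ = λ ()} (λ ()) t) (sub-ren (λ ()) t)

sub-seq : ∀ ε (θ : Fin n → Tm value m) c d → sub θ (seq ε c d) ≡ seq ε (sub θ c) d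
sub-seq ε θ c d = cong (cut ε _) (sub-closed θ (μ̄ ε d))

closed-self : (t : Tm s 0) → closed t ≡ t
closed-self = rename-id (λ ())

T-ret : {Γ : Vec Type n} {V : Tm value n} → Γ ⊢ V ∶ (ε , T) ∣ → Γ ⊢ ret ε V ∶ (ε , T) ∣
T-ret {ε = pos} D = T-↑ D
T-ret {ε = neg} D = D

T-stk : {Γ : Vec Type n} {S : Tm stack n} → Γ ⊢ S ∶ (ε , T) ⊢ B → Γ ⊢ stk ε S ∶ (ε , T) ⊢ B
T-stk {ε = pos} D = D
T-stk {ε = neg} D = T-↓ D

≃-ret : {Γ : Vec Type n} {V W : Tm value n} → Γ ⊢ V ≃ W ∶ (ε , T) ∣ → Γ ⊢ ret ε V ≃ ret ε W ∶ (ε , T) ∣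
≃-ret {ε = pos} D = ≃-↑ D
≃-ret {ε = neg} D = D

≃-stk : {Γ : Vec Type n} {S S′ : Tm stack n} → Γ ⊢ S ≃ S′ ∶ (ε , T) ⊢ B → Γ ⊢ stk ε S ≃ stk ε S′ ∶ (ε , T) ⊢ B
≃-stk {ε = pos} D = D
≃-stk {ε = neg} D = ≃-↓ D

T-cutᶜ : {Γ : Vec Type n} {t : Tm (term ε) n} {e : Tm (coterm ε) 0} →
         Γ ⊢ t ∶ (ε , T) ∣ → [] ⊢ e ∶ (ε , T) ⊢ B → Γ ⊢ cut ε t (closed e) ∶ ⊢ B
T-cutᶜ {t = t} D E = subst (λ t → _ ⊢ cut _ t _ ∶ _) (rename-id (λ _ → refl) t) (T-cut* glue-[]ʳ D E)

≃-cutᶜ : {Γ : Vec Type n} {t u : Tm (term ε) n} {e f : Tm (coterm ε) 0} →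
         Γ ⊢ t ≃ u ∶ (ε , T) ∣ → [] ⊢ e ≃ f ∶ (ε , T) ⊢ B → Γ ⊢ cut ε t (closed e) ≃ cut ε u (closed f) ∶ ⊢ B
≃-cutᶜ {t = t} {u} p q = subst₂ (λ t u → _ ⊢ cut _ t _ ≃ cut _ u _ ∶ _)
  (rename-id (λ _ → refl) t) (rename-id (λ _ → refl) u) (≃-cut* glue-[]ʳ p q)

T-covarᶜ : ∀ {T : Ty ε} {Γ : Vec Type n} {t : Tm (term ε) n} →
           Γ ⊢ t ∶ (ε , T) ∣ → Γ ⊢ cut ε t (stk ε covar) ∶ ⊢ (ε , T)
T-covarᶜ {ε = ε} D = subst (λ e → _ ⊢ cut ε _ e ∶ _) (rename-stk ε _ covar) (T-cutᶜ D (T-stk T-covar))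

≃-covarᶜ : ∀ {T : Ty ε} {Γ : Vec Type n} {t u : Tm (term ε) n} →
           Γ ⊢ t ≃ u ∶ (ε , T) ∣ → Γ ⊢ cut ε t (stk ε covar) ≃ cut ε u (stk ε covar) ∶ ⊢ (ε , T)
≃-covarᶜ {ε = ε} p = subst (λ e → _ ⊢ cut ε _ e ≃ cut ε _ e ∶ _) (rename-stk ε _ covar)
  (≃-cutᶜ p (≃-refl (T-stk T-covar)))

T-retn : {Γ : Vec Type n} {V : Tm value n} → Γ ⊢ V ∶ (ε , T) ∣ → Γ ⊢ retn ε V ∶ ⊢ (ε , T)
T-retn D = T-covarᶜ (T-ret D)

≃-retn : {Γ : Vec Type n} {V W : Tm value n} → Γ ⊢ V ≃ W ∶ (ε , T) ∣ → Γ ⊢ retn ε V ≃ retn ε W ∶ ⊢ (ε , T)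
≃-retn p = ≃-covarᶜ (≃-ret p)

T-seq : {Γ : Vec Type n} {c : Tm command n} {d : Tm command 1} →
        Γ ⊢ c ∶ ⊢ (ε , T) → (ε , T) ∷ [] ⊢ d ∶ ⊢ B → Γ ⊢ seq ε c d ∶ ⊢ B
T-seq D E = T-cutᶜ (T-μ D) (T-μ̄ E)

≃-seq : {Γ : Vec Type n} {c c′ : Tm command n} {d d′ : Tm command 1} →
        Γ ⊢ c ≃ c′ ∶ ⊢ (ε , T) → (ε , T) ∷ [] ⊢ d ≃ d′ ∶ ⊢ B → Γ ⊢ seq ε c d ≃ seq ε c′ d′ ∶ ⊢ B
≃-seq p q = ≃-cutᶜ (≃-μ p) (≃-μ̄ q)

T-⟪⟫ : {Γ : Vec Type n} {V : Tm value n} {t : Tm s 1} →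
       Γ ⊢ V ∶ A ∣ → A ∷ [] ⊢ t ∶ J → Γ ⊢ t ⟪ V ⟫ ∶ J
T-⟪⟫ {V = V} {t} D E = subst (λ t → _ ⊢ t ∶ _)
  (sub-cong (λ { zero → rename-id (λ _ → refl) V }) t)
  (T-sub (⊩-cons {θ = λ ()} glue-[]ʳ D (substitution (λ ()) (λ ()) (λ ()) (λ ()) (λ ())
    (str-iso (λ ()) (λ ()) (λ ()) (λ ())) (λ ()))) E)

cut-value : ∀ ε {T : Ty ε} {Γ : Vec Type n} {V : Tm value n} {d : Tm command 1} →
            Γ ⊢ V ∶ (ε , T) ∣ → (ε , T) ∷ [] ⊢ d ∶ ⊢ B →
            Γ ⊢ cut ε (ret ε V) (closed (μ̄ ε d)) ≃ d ⟪ V ⟫ ∶ ⊢ B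
cut-value ε {V = V} {d} D E =
  R (R-μ̄ ε V (rename (lift λ ()) d)) (T-cutᶜ (T-ret D) (T-μ̄ E)) ⟫≡ sub-rename (λ { zero → refl }) d

μ-retn : {Γ : Vec Type n} {V : Tm value n} → Γ ⊢ V ∶ (ε , T) ∣ →
         Γ ⊢ μ ε (retn ε V) ≃ ret ε V ∶ (ε , T) ∣
μ-retn D = ≃-sym (≃-E (E-μ _) (T-ret D) (T-μ (T-retn D)))

seq-retn : {Γ : Vec Type n} {V : Tm value n} {d : Tm command 1} →
           Γ ⊢ V ∶ (ε , T) ∣ → (ε , T) ∷ [] ⊢ d ∶ ⊢ B →
           Γ ⊢ seq ε (retn ε V) d ≃ d ⟪ V ⟫ ∶ ⊢ B
seq-retn D E = ≃-cutᶜ (μ-retn D) (≃-refl (T-μ̄ E)) ⟫ cut-value _ D E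

seq-retn-assoc : {Γ : Vec Type n} {U : Ty δ} {V : Tm value n} {g h : Tm command 1} →
                 Γ ⊢ V ∶ (ε , T) ∣ → (ε , T) ∷ [] ⊢ g ∶ ⊢ (δ , U) → (δ , U) ∷ [] ⊢ h ∶ ⊢ B →
                 Γ ⊢ seq ε (retn ε V) (seq δ g h) ≃ seq δ (seq ε (retn ε V) g) h ∶ ⊢ B
seq-retn-assoc {δ = δ} {g = g} {h} D Dg Dh =
  seq-retn D (T-seq Dg Dh) ⟫ sub-seq δ _ g h ≡⟫ ≃-seq (≃-sym (seq-retn D Dg)) (≃-refl Dh)

μ-covar : ∀ ε {T : Ty ε} {Γ : Vec Type n} {c : Tm command n} → Γ ⊢ c ∶ ⊢ (ε , T) →
          Γ ⊢ cut ε (μ ε c) (stk ε covar) ≃ c ∶ ⊢ (ε , T)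
μ-covar ε {c = c} D = R (R-μ ε c covar) (T-covarᶜ (T-μ D)) ⟫≡ plug-covar c

stk-μ̄ : ∀ ε {T : Ty ε} {S : Tm stack 0} → [] ⊢ S ∶ (ε , T) ⊢ B →
        [] ⊢ μ̄ ε (cut ε (ret ε (var zero)) (closed (stk ε S))) ≃ stk ε S ∶ (ε , T) ⊢ B
stk-μ̄ ε {S = S} D = ≃-sym (≃-E (E-μ̄ (stk ε S)) (T-stk D)
    (T-μ̄ (subst (λ e → _ ⊢ cut ε _ e ∶ _) eq (T-cutᶜ (T-ret T-var) (T-stk D)))) ⟫≡
    cong (λ e → μ̄ ε (cut ε (ret ε (var zero)) e)) (sym eq))
  where
  eq : closed (stk ε S) ≡ wk (stk ε S)
  eq = rename-cong (λ ()) (stk ε S)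

seq-idʳ : ∀ ε {T : Ty ε} {Γ : Vec Type n} {c : Tm command n} → Γ ⊢ c ∶ ⊢ (ε , T) →
          Γ ⊢ seq ε c (retn ε (var zero)) ≃ c ∶ ⊢ (ε , T)
seq-idʳ ε {c = c} D =
  cong (λ e → cut ε (μ ε c) (closed (μ̄ ε (cut ε (ret ε (var zero)) e)))) (sym (rename-stk ε (λ ()) covar)) ≡⟫
  (≃-cutᶜ (≃-refl (T-μ D)) (stk-μ̄ ε T-covar) ⟫≡ cong (cut ε (μ ε c)) (rename-stk ε (λ ()) covar)) ⟫
  μ-covar ε D

seq-idˡ : {d : Tm command 1} → (ε , T) ∷ [] ⊢ d ∶ ⊢ B →
          (ε , T) ∷ [] ⊢ seq ε (retn ε (var zero)) d ≃ d ∶ ⊢ B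
seq-idˡ {d = d} D = seq-retn T-var D ⟫≡ sub-id (λ { zero → refl }) d

sret : ∀ ε → Tm stack 0 → Tm command 1
sret ε S = cut ε (ret ε (var zero)) (closed (stk ε S))

T-sret : ∀ ε {T : Ty ε} {S : Tm stack 0} → [] ⊢ S ∶ (ε , T) ⊢ B → (ε , T) ∷ [] ⊢ sret ε S ∶ ⊢ B
T-sret ε D = T-cutᶜ (T-ret T-var) (T-stk D)

≃-sret : ∀ ε {T : Ty ε} {S S′ : Tm stack 0} → [] ⊢ S ≃ S′ ∶ (ε , T) ⊢ B →
         (ε , T) ∷ [] ⊢ sret ε S ≃ sret ε S′ ∶ ⊢ B
≃-sret ε p = ≃-cutᶜ (≃-refl (T-ret T-var)) (≃-stk p)

cut-stack : ∀ ε {T : Ty ε} {Γ : Vec Type n} {c : Tm command n} {S : Tm stack 0} →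
            Γ ⊢ c ∶ ⊢ (ε , T) → [] ⊢ S ∶ (ε , T) ⊢ B →
            Γ ⊢ cut ε (μ ε c) (closed (stk ε S)) ≃ plug (closed S) c ∶ ⊢ B
cut-stack ε {c = c} {S} D E =
  cong (cut ε (μ ε c)) (rename-stk ε (λ ()) S) ≡⟫
  R (R-μ ε c (closed S)) (subst (λ e → _ ⊢ cut ε _ e ∶ _) (rename-stk ε (λ ()) S) (T-cutᶜ (T-μ D) (T-stk E)))

seq-sret : ∀ ε {T : Ty ε} {Γ : Vec Type n} {c : Tm command n} {S : Tm stack 0} →
           Γ ⊢ c ∶ ⊢ (ε , T) → [] ⊢ S ∶ (ε , T) ⊢ B →
           Γ ⊢ seq ε c (sret ε S) ≃ plug (closed S) c ∶ ⊢ B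
seq-sret ε D E = ≃-cutᶜ (≃-refl (T-μ D)) (stk-μ̄ ε E) ⟫ cut-stack ε D E

plug-seq : ∀ ε (S : Tm stack 0) (c : Tm command n) d →
           plug (closed S) (seq ε c d) ≡ seq ε c (plug (closed S) d)
plug-seq ε S c d = cong (λ d → cut ε (μ ε c) (μ̄ ε d))
  (trans (cong (λ S → plug S (rename (lift λ ()) d))
           (trans (rename-closed suc S) (sym (rename-closed (lift λ ()) S))))
         (sym (rename-plug (lift λ ()) (closed S) d)))

seq-sret-assoc : ∀ ε {T : Ty ε} {U : Ty δ} {f g : Tm command 1} {S : Tm stack 0} →
                 A ∷ [] ⊢ f ∶ ⊢ (δ , U) → (δ , U) ∷ [] ⊢ g ∶ ⊢ (ε , T) → [] ⊢ S ∶ (ε , T) ⊢ B →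
                 A ∷ [] ⊢ seq δ f (seq ε g (sret ε S)) ≃ seq ε (seq δ f g) (sret ε S) ∶ ⊢ B
seq-sret-assoc {δ = δ} ε {f = f} {g} {S} Df Dg E =
  ≃-seq (≃-refl Df) (seq-sret ε Dg E) ⟫ sym (plug-seq δ S f g) ≡⟫ ≃-sym (seq-sret ε (T-seq Df Dg) E)

xy : Tm value 2
xy = pair (var (suc zero)) (var zero)

glue-xy : Glue (A ∷ []) (B ∷ []) (B ∷ A ∷ []) (λ _ → suc zero) (λ _ → zero)
glue-xy = gluing (str-iso (λ { zero → inj₂ zero ; (suc zero) → inj₁ zero })
  (λ { (inj₁ zero) → refl ; (inj₂ zero) → refl })
  (λ { zero → refl ; (suc zero) → refl })
  (λ { (inj₁ zero) → refl ; (inj₂ zero) → refl }))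

T-xy : B ∷ A ∷ [] ⊢ xy ∶ (pos , A ⊗ B) ∣
T-xy = T-pair* glue-xy T-var T-var

pair-η : {d : Tm command 1} → (pos , A ⊗ B) ∷ [] ⊢ d ∶ ⊢ C →
         (pos , A ⊗ B) ∷ [] ⊢ sret pos (μ̄pair (d ⟪ xy ⟫)) ≃ d ∶ ⊢ C
pair-η {A} {B} {C} {d} D =
  ≃-sret pos (≃-sym (≃-E (E-pair (μ̄ pos d)) (T-μ̄ D)
    (T-μ̄pair (subst (λ e → B ∷ A ∷ [] ⊢ cut pos (↑ xy) e ∶ ⊢ C) eq (T-cutᶜ (T-↑ T-xy) (T-μ̄ D)))) ⟫
    cong (λ e → μ̄pair (cut pos (↑ xy) e)) (sym eq) ≡⟫ ≃-μ̄pair (cut-value pos T-xy D))) ⟫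
  (cut-value pos T-var D ⟫≡ sub-id (λ { zero → refl }) d)
  where
  eq : closed (μ̄ pos d) ≡ wk (wk (μ̄ pos d))
  eq = sym (trans (rename-rename (λ _ → refl) (μ̄ pos d)) (rename-cong (λ ()) (μ̄ pos d)))

pair-ext : {d d′ : Tm command 1} → (pos , A ⊗ B) ∷ [] ⊢ d ∶ ⊢ C → (pos , A ⊗ B) ∷ [] ⊢ d′ ∶ ⊢ C →
           B ∷ A ∷ [] ⊢ d ⟪ xy ⟫ ≃ d′ ⟪ xy ⟫ ∶ ⊢ C → (pos , A ⊗ B) ∷ [] ⊢ d ≃ d′ ∶ ⊢ C
pair-ext D D′ p = ≃-sym (pair-η D) ⟫ ≃-sret pos (≃-μ̄pair p) ⟫ pair-η D′

cut-pair : {Γ : Vec Type n} {V W : Tm value n} {d : Tm command 2} →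
           Γ ⊢ pair V W ∶ (pos , A ⊗ B) ∣ → B ∷ A ∷ [] ⊢ d ∶ ⊢ C →
           Γ ⊢ cut pos (↑ pair V W) (closed (μ̄pair d)) ≃ sub (W ◂ V ◂ λ ()) d ∶ ⊢ C
cut-pair {V = V} {W} {d} D E =
  R (R-pair V W (rename (lift (lift λ ())) d)) (T-cutᶜ (T-↑ D) (T-μ̄pair E)) ⟫≡
  sub-rename (λ { zero → refl ; (suc zero) → refl }) d

unit-η : {Γ : Vec Type n} {c : Tm command (suc n)} → (pos , 𝟏) ∷ Γ ⊢ c ∶ ⊢ B →
         (pos , 𝟏) ∷ Γ ⊢ cut pos (↑ var zero) (wk (μ̄unit (c [ unit ]))) ≃ c ∶ ⊢ B
unit-η {B = B} {Γ = Γ} {c = c} D =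
  ≃-cut* glue-∷ (≃-refl (T-↑ T-var))
    (≃-sym (≃-E (E-unit (μ̄ pos c)) (T-μ̄ D) (T-μ̄unit Dc) ⟫ ≃-μ̄unit (R (R-μ̄ pos unit c) Dc))) ⟫
  (R (R-μ̄ pos (var zero) (rename (lift suc) c)) (T-cut* glue-∷ (T-↑ T-var) (T-μ̄ D)) ⟫≡
    trans (sub-rename (λ _ → refl) c) (sub-id (λ { zero → refl ; (suc _) → refl }) c))
  where
  Dc : Γ ⊢ cut pos (↑ unit) (μ̄ pos c) ∶ ⊢ B
  Dc = subst (λ e → Γ ⊢ cut pos (↑ unit) e ∶ ⊢ B) (rename-id (λ _ → refl) (μ̄ pos c))
         (T-cut* glue-[]ˡ (T-↑ T-unit) (T-μ̄ D))

unit-ext : {Γ : Vec Type n} {c c′ : Tm command (suc n)} →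
           (pos , 𝟏) ∷ Γ ⊢ c ∶ ⊢ B → (pos , 𝟏) ∷ Γ ⊢ c′ ∶ ⊢ B →
           Γ ⊢ c [ unit ] ≃ c′ [ unit ] ∶ ⊢ B → (pos , 𝟏) ∷ Γ ⊢ c ≃ c′ ∶ ⊢ B
unit-ext D D′ p = ≃-sym (unit-η D) ⟫
  ≃-cut* glue-∷ (≃-refl (T-↑ T-var)) (≃-μ̄unit p) ⟫ unit-η D′

infix 8 _▹_

_▹_ : Tm command n → Tm stack 1 → Tm command (suc n)
c ▹ S = plug (rename (λ _ → zero) S) (wk c)

arg : Tm stack 1
arg = push (var zero) covar

T-▹ : {Γ : Vec Type n} {c : Tm command n} {S : Tm stack 1} → Γ ⊢ c ∶ ⊢ B → A ∷ [] ⊢ S ∶ B ⊢ C →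
      A ∷ Γ ⊢ c ▹ S ∶ ⊢ C
T-▹ D E = T-plug* (glue-swap glue-∷) E D

T-arg : A ∷ [] ⊢ arg ∶ (neg , A ⊸ B) ⊢ B
T-arg = T-push T-var T-covar

cut-▹ : ∀ ε {T : Ty ε} {Γ : Vec Type n} {c : Tm command n} {S : Tm stack 1} →
        Γ ⊢ c ∶ ⊢ (ε , T) → A ∷ [] ⊢ S ∶ (ε , T) ⊢ C →
        A ∷ Γ ⊢ cut ε (μ ε (wk c)) (rename (λ _ → zero) (stk ε S)) ≃ c ▹ S ∶ ⊢ C
cut-▹ ε {c = c} {S} D E = subst (λ e → _ ⊢ cut ε _ e ≃ _ ∶ _) (sym eq)
  (R (R-μ ε (wk c) (rename (λ _ → zero) S)) (subst (λ e → _ ⊢ cut ε _ e ∶ _) eq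
    (T-cut* (glue-swap glue-∷) (T-μ D) (T-stk E))))
  where
  eq : rename (λ _ → zero) (stk ε S) ≡ stk ε (rename (λ _ → zero) S)
  eq = rename-stk ε _ S

lam-η : {Γ : Vec Type n} {c : Tm command n} → Γ ⊢ c ∶ ⊢ (neg , A ⊸ B) →
        Γ ⊢ cut neg (μlam (c ▹ arg)) (↓ covar) ≃ c ∶ ⊢ (neg , A ⊸ B)
lam-η {c = c} D =
  ≃-covarᶜ (≃-sym (≃-E (E-lam (μ neg c)) (T-μ D) (T-lam (proj₁ (≃-typed (cut-▹ neg D T-arg)))) ⟫
    ≃-lam (cut-▹ neg D T-arg))) ⟫
  μ-covar neg D

lam-ext : {Γ : Vec Type n} {c c′ : Tm command n} → Γ ⊢ c ∶ ⊢ (neg , A ⊸ B) → Γ ⊢ c′ ∶ ⊢ (neg , A ⊸ B) →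
          A ∷ Γ ⊢ c ▹ arg ≃ c′ ▹ arg ∶ ⊢ B → Γ ⊢ c ≃ c′ ∶ ⊢ (neg , A ⊸ B)
lam-ext D D′ p = ≃-sym (lam-η D) ⟫ ≃-covarᶜ (≃-lam p) ⟫ lam-η D′

seq-▹ : ∀ ε (c : Tm command n) d S →
        seq ε c d ▹ S ≡ cut ε (μ ε (wk c)) (rename (λ _ → zero) (μ̄ ε (rename swap (d ▹ S))))
seq-▹ ε c d S = cong (λ d → cut ε (μ ε (wk c)) (μ̄ ε d)) (trans
  (cong₂ (λ S d → plug S d)
    (trans (rename-rename (λ _ → refl) S) (sym (rename-rename (λ _ → refl) S)))
    (trans (rename-rename {ρ″ = λ _ → zero} (λ { zero → refl }) d) (sym (rename-rename (λ { zero → refl }) d))))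
  (sym (trans (rename-rename (λ _ → refl) (d ▹ S)) (rename-plug _ (rename _ S) (wk d)))))

≃-seq-▹ : ∀ {U : Ty δ} {Γ : Vec Type n} {c : Tm command n} {d d′ : Tm command 2} →
          Γ ⊢ c ∶ ⊢ (δ , U) → A ∷ (δ , U) ∷ [] ⊢ d ≃ d′ ∶ ⊢ B →
          A ∷ Γ ⊢ cut δ (μ δ (wk c)) (rename (λ _ → zero) (μ̄ δ (rename swap d))) ≃
                  cut δ (μ δ (wk c)) (rename (λ _ → zero) (μ̄ δ (rename swap d′))) ∶ ⊢ B
≃-seq-▹ D p = ≃-cut* (glue-swap glue-∷) (≃-refl (T-μ D)) (≃-μ̄ (≃-struct ↝-swap p))

seq-lam-assoc : ∀ ε {T : Ty ε} {U : Ty δ} {X Y : Type} {f g h : Tm command 1} {S : Tm stack 1} →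
  A ∷ [] ⊢ f ∶ ⊢ (δ , U) → (δ , U) ∷ [] ⊢ g ∶ ⊢ (ε , T) → (ε , T) ∷ [] ⊢ h ∶ ⊢ (neg , X ⊸ Y) →
  (∀ {B} {k : Tm command 1} → B ∷ [] ⊢ k ∶ ⊢ (ε , T) → X ∷ B ∷ [] ⊢ seq ε k h ▹ arg ≃ k ▹ S ∶ ⊢ Y) →
  A ∷ [] ⊢ seq δ f (seq ε g h) ≃ seq ε (seq δ f g) h ∶ ⊢ (neg , X ⊸ Y)
seq-lam-assoc {δ = δ} ε {f = f} {g} {h} {S} Df Dg Dh p =
  lam-ext (T-seq Df (T-seq Dg Dh)) (T-seq (T-seq Df Dg) Dh)
    (seq-▹ δ f (seq ε g h) arg ≡⟫ ≃-seq-▹ Df (p Dg) ⟫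
     sym (seq-▹ δ f g S) ≡⟫ ≃-sym (p (T-seq Df Dg)))

seq-pair-assoc : ∀ {ε δ} {T : Ty ε} {U : Ty δ} {f g h : Tm command 1} {V : Tm value 2} →
  (pos , A ⊗ B) ∷ [] ⊢ f ∶ ⊢ (ε , T) → (ε , T) ∷ [] ⊢ g ∶ ⊢ (δ , U) → (δ , U) ∷ [] ⊢ h ∶ ⊢ C →
  B ∷ A ∷ [] ⊢ V ∶ (ε , T) ∣ → B ∷ A ∷ [] ⊢ f ⟪ xy ⟫ ≃ retn ε V ∶ ⊢ (ε , T) →
  (pos , A ⊗ B) ∷ [] ⊢ seq ε f (seq δ g h) ≃ seq δ (seq ε f g) h ∶ ⊢ C
seq-pair-assoc {ε = ε} {δ} {f = f} {g} {h} Df Dg Dh DV p =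
  pair-ext (T-seq Df (T-seq Dg Dh)) (T-seq (T-seq Df Dg) Dh)
    (sub-seq ε _ f (seq δ g h) ≡⟫ ≃-seq p (≃-refl (T-seq Dg Dh)) ⟫ seq-retn-assoc DV Dg Dh ⟫
     ≃-sym (trans (sub-seq δ _ (seq ε f g) h) (cong (λ c → seq δ c h) (sub-seq ε _ f g)) ≡⟫
            ≃-seq (≃-seq p (≃-refl Dg)) (≃-refl Dh)))

record NonAssociativeCategory : Set₁ where
  infix  4 _≈_
  infixr 9 _∘_
  field
    Obj           : Set
    Hom           : Obj → Obj → Set
    _≈_           : ∀ {A B} → Hom A B → Hom A B → Set
    isEquivalence : ∀ {A B} → IsEquivalence (_≈_ {A} {B})
    id            : ∀ {A} → Hom A A
    _∘_           : ∀ {A B C} → Hom B C → Hom A B → Hom A C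
    ∘-cong        : ∀ {A B C} {g g′ : Hom B C} {f f′ : Hom A B} → g ≈ g′ → f ≈ f′ → (g ∘ f) ≈ (g′ ∘ f′)
    identityˡ     : ∀ {A B} (f : Hom A B) → (id ∘ f) ≈ f
    identityʳ     : ∀ {A B} (f : Hom A B) → (f ∘ id) ≈ f

  module _ {A B : Obj} where
    open IsEquivalence (isEquivalence {A} {B}) public
      renaming (refl to ≈-refl; sym to ≈-sym; trans to ≈-trans) using ()

  homSetoid : Obj → Obj → Setoid 0ℓ 0ℓ
  homSetoid A B = record { isEquivalence = isEquivalence {A} {B} }

  IsThunkable : ∀ {A B} → Hom A B → Set
  IsThunkable {B = B} f = ∀ {C D} (g : Hom B C) (h : Hom C D) → ((h ∘ g) ∘ f) ≈ (h ∘ (g ∘ f))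

  IsLinear : ∀ {C D} → Hom C D → Set
  IsLinear {C} h = ∀ {A B} (f : Hom A B) (g : Hom B C) → ((h ∘ g) ∘ f) ≈ (h ∘ (g ∘ f))

record Category : Set₁ where
  field
    nonAssociative : NonAssociativeCategory
  open NonAssociativeCategory nonAssociative public
  field
    assoc : ∀ {A B C D} (f : Hom A B) (g : Hom B C) (h : Hom C D) → ((h ∘ g) ∘ f) ≈ (h ∘ (g ∘ f))

module _ (𝒟 : NonAssociativeCategory) {Ob : Set} (F : Ob → NonAssociativeCategory.Obj 𝒟) where
  open NonAssociativeCategory 𝒟

  thunkables : Category
  thunkables = record
    { nonAssociative = record
      { Obj = Ob
      ; Hom = λ X Y → Σ (Hom (F X) (F Y)) IsThunkable
      ; _≈_ = λ f g → proj₁ f ≈ proj₁ g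
      ; isEquivalence = record { refl = ≈-refl ; sym = ≈-sym ; trans = ≈-trans }
      ; id = id , λ g h → ≈-trans (identityʳ (h ∘ g)) (∘-cong ≈-refl (≈-sym (identityʳ g)))
      ; _∘_ = λ (f′ , t′) (f , t) → f′ ∘ f , λ g h →
          ≈-trans (≈-sym (t f′ (h ∘ g)))
          (≈-trans (∘-cong (t′ g h) ≈-refl)
          (≈-trans (t (g ∘ f′) h) (∘-cong ≈-refl (t f′ g))))
      ; ∘-cong = ∘-cong
      ; identityˡ = λ (f , _) → identityˡ f
      ; identityʳ = λ (f , _) → identityʳ f
      }
    ; assoc = λ (f , t) (g , _) (h , _) → t g h
    }

  linears : Category
  linears = record
    { nonAssociative = record
      { Obj = Ob
      ; Hom = λ X Y → Σ (Hom (F X) (F Y)) IsLinear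
      ; _≈_ = λ f g → proj₁ f ≈ proj₁ g
      ; isEquivalence = record { refl = ≈-refl ; sym = ≈-sym ; trans = ≈-trans }
      ; id = id , λ f g → ≈-trans (∘-cong (identityˡ g) ≈-refl) (≈-sym (identityˡ (g ∘ f)))
      ; _∘_ = λ (h , l) (h′ , l′) → h ∘ h′ , λ f g →
          ≈-trans (∘-cong (l g h′) ≈-refl)
          (≈-trans (l f (h′ ∘ g))
          (≈-trans (∘-cong ≈-refl (l′ f g)) (≈-sym (l (g ∘ f) h′))))
      ; ∘-cong = ∘-cong
      ; identityˡ = λ (f , _) → identityˡ f
      ; identityʳ = λ (f , _) → identityʳ f
      }
    ; assoc = λ (f , _) (g , _) (h , l) → l f g
    }

record Functor (𝒜 ℬ : Category) : Set where
  private
    module 𝒜 = Category 𝒜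
    module ℬ = Category ℬ
  field
    F₀     : 𝒜.Obj → ℬ.Obj
    F₁     : ∀ {A B} → 𝒜.Hom A B → ℬ.Hom (F₀ A) (F₀ B)
    F-cong : ∀ {A B} {f g : 𝒜.Hom A B} → f 𝒜.≈ g → F₁ f ℬ.≈ F₁ g
    F-id   : ∀ {A} → F₁ (𝒜.id {A}) ℬ.≈ ℬ.id
    F-∘    : ∀ {A B C} (g : 𝒜.Hom B C) (f : 𝒜.Hom A B) → F₁ (g 𝒜.∘ f) ℬ.≈ (F₁ g ℬ.∘ F₁ f)

record RelativeMonad {𝒜 ℬ : Category} (L : Functor 𝒜 ℬ)
                     (T : Category.Obj 𝒜 → Category.Obj ℬ) : Set where
  open Category ℬ
  open Functor L using () renaming (F₀ to L₀)
  field
    η            : ∀ A → Hom (L₀ A) (T A)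
    extend       : ∀ {A B} → Hom (L₀ A) (T B) → Hom (T A) (T B)
    extend-cong  : ∀ {A B} {f g : Hom (L₀ A) (T B)} → f ≈ g → extend f ≈ extend g
    factor       : ∀ {A B} (f : Hom (L₀ A) (T B)) → f ≈ (extend f ∘ η A)
    extend-η     : ∀ {A} → extend (η A) ≈ id
    extend-∘     : ∀ {A B C} (f : Hom (L₀ B) (T C)) (g : Hom (L₀ A) (T B)) →
                   extend (extend f ∘ g) ≈ (extend f ∘ extend g)

record RelativeComonad {𝒜 ℬ : Category} (R : Functor ℬ 𝒜)
                       (S : Category.Obj ℬ → Category.Obj 𝒜) : Set where
  open Category 𝒜
  open Functor R using () renaming (F₀ to R₀)
  field
    counit          : ∀ B → Hom (S B) (R₀ B)
    coextend        : ∀ {A B} → Hom (S A) (R₀ B) → Hom (S A) (S B)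
    coextend-cong   : ∀ {A B} {f g : Hom (S A) (R₀ B)} → f ≈ g → coextend f ≈ coextend g
    factor          : ∀ {A B} (f : Hom (S A) (R₀ B)) → f ≈ (counit B ∘ coextend f)
    coextend-counit : ∀ {B} → coextend (counit B) ≈ id
    coextend-∘      : ∀ {A B C} (f : Hom (S B) (R₀ C)) (g : Hom (S A) (R₀ B)) →
                      coextend (f ∘ coextend g) ≈ (coextend f ∘ coextend g)

𝒟 : NonAssociativeCategory
𝒟 = record
  { Obj = Type
  ; Hom = λ A B → Σ (Tm command 1) λ c → A ∷ [] ⊢ c ∶ ⊢ B
  ; _≈_ = λ {A} {B} c d → A ∷ [] ⊢ proj₁ c ≃ proj₁ d ∶ ⊢ B
  ; isEquivalence = record { refl = λ {c} → ≃-refl (proj₂ c) ; sym = ≃-sym ; trans = ≃-trans }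
  ; id = λ { {ε , T} → cut ε (ret ε (var zero)) (stk ε covar) , T-retn T-var }
  ; _∘_ = λ { {B = ε , T} (d , D) (c , C) → cut ε (μ ε c) (closed (μ̄ ε d)) , T-seq C D }
  ; ∘-cong = λ p q → ≃-seq q p
  ; identityˡ = λ (c , C) → seq-idʳ _ C
  ; identityʳ = λ (c , C) → seq-idˡ C
  }

module 𝒟 = NonAssociativeCategory 𝒟

𝒫ₜ 𝒩ₗ : Category
𝒫ₜ = thunkables 𝒟 (λ (P : Ty pos) → pos , P)
𝒩ₗ = linears 𝒟 (λ (N : Ty neg) → neg , N)

module 𝒫ₜ = Category 𝒫ₜ
module 𝒩ₗ = Category 𝒩ₗ

private
  variable
    P Q : Ty pos
    N M : Ty neg

thunkable-value : {V : Tm value 1} (D : A ∷ [] ⊢ V ∶ (ε , T) ∣) → 𝒟.IsThunkable {A} (retn ε V , T-retn D)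
thunkable-value D (g , Dg) (h , Dh) = seq-retn-assoc D Dg Dh

linear-stack : ∀ ε {T : Ty ε} {S : Tm stack 0} (D : [] ⊢ S ∶ (ε , T) ⊢ B) →
               𝒟.IsLinear {D = B} (sret ε S , T-sret ε D)
linear-stack ε D (f , Df) (g , Dg) = seq-sret-assoc ε Df Dg D

-- ⟨z‖μ̄(u⊗x).⟨u⊗μα⁻.c‖γ⟩⁺⟩⁺; the variable of c is renamed to x, which is zero.

⇓-command : Tm command 1 → Tm command 1
⇓-command c = cut pos (↑ var zero) (closed (μ̄pair
  (cut pos (↑ pair (var (suc zero)) (μ neg (rename (λ _ → zero) c))) covar)))

⇓-stack : {c : Tm command 1} → (neg , N) ∷ [] ⊢ c ∶ ⊢ (neg , M) →
          (neg , N) ∷ A ∷ [] ⊢ pair (var (suc zero)) (μ neg (rename (λ _ → zero) c)) ∶ (pos , A ⊗ (neg , M)) ∣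
⇓-stack D = T-pair* glue-xy T-var (T-μ D)

T-⇓ : {c : Tm command 1} → (neg , N) ∷ [] ⊢ c ∶ ⊢ (neg , M) →
      (pos , A ⊗ (neg , N)) ∷ [] ⊢ ⇓-command c ∶ ⊢ (pos , A ⊗ (neg , M))
T-⇓ D = T-sret pos (T-μ̄pair (T-retn (⇓-stack D)))

⇓-at : {Γ : Vec Type n} {V W : Tm value n} {c : Tm command 1} →
       Γ ⊢ pair V W ∶ (pos , A ⊗ (neg , N)) ∣ → (neg , N) ∷ [] ⊢ c ∶ ⊢ (neg , M) →
       Γ ⊢ ⇓-command c ⟪ pair V W ⟫ ≃ retn pos (pair V (μ neg (c ⟪ W ⟫))) ∶ ⊢ (pos , A ⊗ (neg , M))
⇓-at {c = c} D E = cong (cut pos (↑ pair _ _)) (sub-closed _ (μ̄pair _)) ≡⟫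
  cut-pair D (T-retn (⇓-stack E)) ⟫≡
  cong (λ c → cut pos (↑ pair _ (μ neg c)) covar) (sub-rename (λ _ → refl) c)

⇓-xy : {c : Tm command 1} → (neg , N) ∷ [] ⊢ c ∶ ⊢ (neg , M) →
       (neg , N) ∷ A ∷ [] ⊢ ⇓-command c ⟪ xy ⟫ ≃
         retn pos (pair (var (suc zero)) (μ neg (rename (λ _ → zero) c))) ∶ ⊢ (pos , A ⊗ (neg , M))
⇓-xy {c = c} D = ⇓-at T-xy D ⟫≡
  cong (λ c → cut pos (↑ pair _ (μ neg c)) covar) (sub-ren (λ _ → refl) c)

≃-⇓ : {c d : Tm command 1} → (neg , N) ∷ [] ⊢ c ≃ d ∶ ⊢ (neg , M) →
      (neg , N) ∷ A ∷ [] ⊢ retn pos (pair (var (suc zero)) (μ neg (rename (λ _ → zero) c))) ≃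
                           retn pos (pair (var (suc zero)) (μ neg (rename (λ _ → zero) d))) ∶
                           ⊢ (pos , A ⊗ (neg , M))
≃-⇓ p = ≃-retn (≃-pair* glue-xy (≃-refl T-var) (≃-μ p))

⇓ : Functor 𝒩ₗ 𝒫ₜ
⇓ = record
  { F₀     = λ N → (pos , 𝟏) ⊗ (neg , N)
  ; F₁     = λ ((c , D) , _) → (⇓-command c , T-⇓ D) ,
               λ (g , Dg) (h , Dh) → seq-pair-assoc (T-⇓ D) Dg Dh (⇓-stack D) (⇓-xy D)
  ; F-cong = λ p → ≃-sret pos (≃-μ̄pair (≃-⇓ p))
  ; F-id   = pair-ext (T-⇓ (T-retn T-var)) (T-retn T-var)
      (⇓-xy (T-retn T-var) ⟫ ≃-retn (≃-pair* glue-xy (≃-refl T-var) (μ-retn T-var)))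
  ; F-∘    = λ ((g , Dg) , _) ((f , Df) , _) → pair-ext (T-⇓ (T-seq Df Dg)) (T-seq (T-⇓ Df) (T-⇓ Dg))
      (⇓-xy (T-seq Df Dg) ⟫ ≃-⇓ (cut-value neg (T-μ Df) Dg) ⟫
       cong (λ c → cut pos (↑ pair _ (μ neg c)) covar) (rename-sub (λ _ → refl) g) ≡⟫
       ≃-sym (sub-seq pos _ (⇓-command f) (⇓-command g) ≡⟫
         ≃-seq (⇓-xy Df) (≃-refl (T-⇓ Dg)) ⟫ seq-retn (⇓-stack Df) (T-⇓ Dg) ⟫ ⇓-at (⇓-stack Df) Dg))
  }

T-unit-pair : {Γ : Vec Type n} {V : Tm value n} → Γ ⊢ V ∶ A ∣ → Γ ⊢ pair unit V ∶ (pos , (pos , 𝟏) ⊗ A) ∣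
T-unit-pair {V = V} D = subst (λ V → _ ⊢ pair unit V ∶ _ ∣) (rename-id (λ _ → refl) V)
  (T-pair* glue-[]ˡ T-unit D)

≃-unit-pair : {Γ : Vec Type n} {V W : Tm value n} → Γ ⊢ V ≃ W ∶ A ∣ →
              Γ ⊢ pair unit V ≃ pair unit W ∶ (pos , (pos , 𝟏) ⊗ A) ∣
≃-unit-pair {V = V} {W} p = subst₂ (λ V W → _ ⊢ pair unit V ≃ pair unit W ∶ _ ∣)
  (rename-id (λ _ → refl) V) (rename-id (λ _ → refl) W) (≃-pair* glue-[]ˡ (≃-refl T-unit) p)

-- ⟨u‖μ̄().⟨x‖α⟩⁻⟩⁺ and the command ⟨z‖μ̄(u⊗x).⟨u‖μ̄().⟨x‖α⟩⁻⟩⁺⟩⁺ for forcing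

force-body : Tm command 2
force-body = cut pos (↑ var (suc zero)) (μ̄unit (cut neg (var zero) (↓ covar)))

force : Tm command 1
force = sret pos (μ̄pair force-body)

T-force-body : (neg , M) ∷ (pos , 𝟏) ∷ [] ⊢ force-body ∶ ⊢ (neg , M)
T-force-body = T-cut* glue-xy (T-↑ T-var) (T-μ̄unit (T-retn T-var))

T-force : (pos , (pos , 𝟏) ⊗ (neg , M)) ∷ [] ⊢ force ∶ ⊢ (neg , M)
T-force = T-sret pos (T-μ̄pair T-force-body)

T-thunk : {c : Tm command 1} → A ∷ [] ⊢ c ∶ ⊢ (neg , M) →
          A ∷ [] ⊢ retn pos (pair unit (μ neg c)) ∶ ⊢ (pos , (pos , 𝟏) ⊗ (neg , M))
T-thunk D = T-retn (T-unit-pair (T-μ D))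

unit-β : {Γ : Vec Type n} {c : Tm command n} → Γ ⊢ c ∶ ⊢ B → Γ ⊢ cut pos (↑ unit) (μ̄unit c) ≃ c ∶ ⊢ B
unit-β {B = B} {Γ = Γ} {c} D = R (R-unit c) (subst (λ e → Γ ⊢ cut pos (↑ unit) e ∶ ⊢ B) (rename-id (λ _ → refl) (μ̄unit c))
  (T-cut* glue-[]ˡ (T-↑ T-unit) (T-μ̄unit D)))

force-thunk : {c : Tm command 1} → A ∷ [] ⊢ c ∶ ⊢ (neg , M) →
              A ∷ [] ⊢ seq pos (retn pos (pair unit (μ neg c))) force ≃ c ∶ ⊢ (neg , M)
force-thunk {c = c} D =
  seq-retn (T-unit-pair (T-μ D)) T-force ⟫
  cong (cut pos (↑ pair unit (μ neg c))) (sub-closed {n = 1} (λ _ → pair unit (μ neg c)) (μ̄pair force-body)) ≡⟫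
  cut-pair (T-unit-pair (T-μ D)) T-force-body ⟫
  unit-β (T-covarᶜ (T-μ D)) ⟫ μ-covar neg D

thunk-force : (pos , (pos , 𝟏) ⊗ (neg , M)) ∷ [] ⊢ seq neg force (retn pos (pair unit (var zero))) ≃
              retn pos (var zero) ∶ ⊢ (pos , (pos , 𝟏) ⊗ (neg , M))
thunk-force {M} = pair-ext (T-seq T-force Dh) (T-retn T-var)
  (sub-seq neg (λ _ → xy) force (retn pos (pair unit (var zero))) ≡⟫ ≃-seq (cong (cut pos (↑ xy)) (sub-closed {n = 1} (λ _ → xy) (μ̄pair force-body)) ≡⟫
     cut-pair T-xy T-force-body) (≃-refl Dh) ⟫
   cut-value neg (T-μ T-force-body) Dh ⟫ swapped)
  where
  Dh : (neg , M) ∷ [] ⊢ retn pos (pair unit (var zero)) ∶ ⊢ (pos , (pos , 𝟏) ⊗ (neg , M))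
  Dh = T-retn (T-unit-pair T-var)
  swapped : (neg , M) ∷ (pos , 𝟏) ∷ [] ⊢ retn pos (pair unit (μ neg force-body)) ≃ retn pos xy ∶
              ⊢ (pos , (pos , 𝟏) ⊗ (neg , M))
  swapped = ≃-struct ↝-swap (unit-ext
    (T-struct ↝-swap (T-retn (T-unit-pair (T-μ T-force-body)))) (T-struct ↝-swap (T-retn T-xy))
    (≃-retn (≃-unit-pair (≃-μ (unit-β (T-retn T-var)) ⟫ μ-retn T-var))))

⇓-bijection : ∀ P M → Inverse (𝒟.homSetoid (pos , P) (neg , M)) (𝒫ₜ.homSetoid P (Functor.F₀ ⇓ M))
⇓-bijection P M = record
  { to        = λ (c , D) → (cut pos (↑ pair unit (μ neg c)) covar , T-thunk D) ,
                            thunkable-value (T-unit-pair (T-μ D))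
  ; from      = λ ((f , D) , _) → seq pos f force , T-seq D T-force
  ; to-cong   = to-cong
  ; from-cong = λ p → ≃-seq p (≃-refl T-force)
  ; inverse   = (λ { {f , t} p → to-cong p ⟫ to-from f t }) ,
                (λ { {c , D} p → ≃-seq p (≃-refl T-force) ⟫ force-thunk D })
  }
  where
  to-cong : ∀ {c d} → (pos , P) ∷ [] ⊢ c ≃ d ∶ ⊢ (neg , M) →
            (pos , P) ∷ [] ⊢ retn pos (pair unit (μ neg c)) ≃ retn pos (pair unit (μ neg d)) ∶ ⊢ _
  to-cong p = ≃-retn (≃-unit-pair (≃-μ p))
  to-from : (f : 𝒟.Hom (pos , P) (pos , (pos , 𝟏) ⊗ (neg , M))) → 𝒟.IsThunkable f →
            (pos , P) ∷ [] ⊢ retn pos (pair unit (μ neg (seq pos (proj₁ f) force))) ≃ proj₁ f ∶ ⊢ _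
  to-from (f , D) t =
    ≃-sym (cut-value neg (T-μ (T-seq D T-force)) (T-retn (T-unit-pair T-var))) ⟫
    ≃-sym (t (force , T-force) (_ , T-retn (T-unit-pair T-var))) ⟫
    ≃-seq (≃-refl D) thunk-force ⟫ seq-idʳ pos D

⇑-body : Tm stack 0 → Tm command 2
⇑-body S = cut neg (var (suc zero)) (↓ push (var zero) (closed S))

-- ⟨μ(u·α).⟨z‖u·μ̄x⁺.c⟩⁻‖γ⟩⁻

⇑-command : Tm command 1 → Tm command 1
⇑-command c = cut neg (μlam (cut neg (var (suc zero)) (↓ push (var zero) (closed (μ̄ pos c))))) (↓ covar)

T-⇑-push : {S : Tm stack 0} → [] ⊢ S ∶ B ⊢ C → A ∷ [] ⊢ push (var zero) (closed S) ∶ (neg , A ⊸ B) ⊢ C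
T-⇑-push D = T-push* glue-[]ʳ T-var D

T-⇑-body : {S : Tm stack 0} → [] ⊢ S ∶ B ⊢ C → A ∷ (neg , A ⊸ B) ∷ [] ⊢ ⇑-body S ∶ ⊢ C
T-⇑-body {S = S} D = subst (λ S → _ ⊢ cut neg _ (↓ push _ S) ∶ _) (rename-closed _ S)
  (T-cut* (glue-swap glue-∷) T-var (T-↓ (T-⇑-push D)))

≃-⇑-body : {S S′ : Tm stack 0} → [] ⊢ S ≃ S′ ∶ B ⊢ C →
           A ∷ (neg , A ⊸ B) ∷ [] ⊢ ⇑-body S ≃ ⇑-body S′ ∶ ⊢ C
≃-⇑-body {S = S} {S′} p = subst₂ (λ S S′ → _ ⊢ cut neg _ (↓ push _ S) ≃ cut neg _ (↓ push _ S′) ∶ _)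
  (rename-closed _ S) (rename-closed _ S′)
  (≃-cut* (glue-swap glue-∷) (≃-refl T-var) (≃-↓ (≃-push* glue-[]ʳ (≃-refl T-var) p)))

T-⇑ : {c : Tm command 1} → (pos , P) ∷ [] ⊢ c ∶ ⊢ B →
      (neg , A ⊸ (pos , P)) ∷ [] ⊢ ⇑-command c ∶ ⊢ (neg , A ⊸ B)
T-⇑ D = T-covarᶜ (T-lam (T-⇑-body (T-μ̄ D)))

⇑-push : {S : Tm stack 0} {c : Tm command 1} → (pos , P) ∷ [] ⊢ c ∶ ⊢ B → [] ⊢ S ∶ B ⊢ C →
         A ∷ (neg , A ⊸ (pos , P)) ∷ [] ⊢ ⇑-command c ▹ push (var zero) (closed S) ≃
                                          ⇑-body (plug S (μ̄ pos c)) ∶ ⊢ C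
⇑-push {S = S} {c} D E =
  R (R-lam (rename (lift suc) (⇑-body (μ̄ pos c))) (var zero) (rename (λ _ → zero) (closed S)))
    (T-▹ (T-⇑ D) (T-⇑-push E)) ⟫≡
  trans (cong₂ (λ S c → plug S c) (rename-closed _ S)
    (trans (sub-rename (λ _ → refl) (⇑-body (μ̄ pos c)))
           (sub-id (λ { zero → refl ; (suc _) → refl }) (⇑-body (μ̄ pos c)))))
    (cong (λ S → cut neg (var (suc zero)) (↓ push (var zero) S)) (sym (rename-plug (λ ()) S (μ̄ pos c))))

⇑-arg : {c : Tm command 1} → (pos , P) ∷ [] ⊢ c ∶ ⊢ B →
        A ∷ (neg , A ⊸ (pos , P)) ∷ [] ⊢ ⇑-command c ▹ arg ≃ ⇑-body (μ̄ pos c) ∶ ⊢ B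
⇑-arg {c = c} D = ⇑-push D T-covar ⟫≡ cong ⇑-body (plug-covar (μ̄ pos c))

seq-⇑ : {k c : Tm command 1} → (pos , P) ∷ [] ⊢ c ∶ ⊢ B → C ∷ [] ⊢ k ∶ ⊢ (neg , A ⊸ (pos , P)) →
        A ∷ C ∷ [] ⊢ seq neg k (⇑-command c) ▹ arg ≃ k ▹ push (var zero) (closed (μ̄ pos c)) ∶ ⊢ B
seq-⇑ {k = k} {c} D Dk =
  seq-▹ neg k (⇑-command c) arg ≡⟫ ≃-seq-▹ Dk (⇑-arg D) ⟫
  ≃-cut* (glue-swap glue-∷) (≃-refl (T-μ Dk))
    (cong (λ S → μ̄ neg (cut neg (var zero) (↓ push (var (suc zero)) S))) eq ≡⟫
     ≃-sym (≃-E (E-μ̄ (↓ S)) (T-↓ (T-⇑-push (T-μ̄ D)))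
       (T-μ̄ (T-cut* glue-∷ T-var (T-↓ (T-⇑-push (T-μ̄ D))))))) ⟫
  cut-▹ neg Dk (T-⇑-push (T-μ̄ D))
  where
  S : Tm stack 1
  S = push (var zero) (closed (μ̄ pos c))
  eq : rename swap (closed (μ̄ pos c)) ≡ wk (closed (μ̄ pos c))
  eq = trans (rename-closed swap (μ̄ pos c)) (sym (rename-closed suc (μ̄ pos c)))

⇑ : Functor 𝒫ₜ 𝒩ₗ
⇑ = record
  { F₀     = λ P → (pos , 𝟏) ⊸ (pos , P)
  ; F₁     = λ ((c , D) , _) → (⇑-command c , T-⇑ D) ,
               λ (f , Df) (g , Dg) → seq-lam-assoc neg {S = push (var zero) (closed (μ̄ pos c))} Df Dg (T-⇑ D) (seq-⇑ D)
  ; F-cong = λ p → ≃-covarᶜ (≃-lam (≃-⇑-body (≃-μ̄ p)))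
  ; F-id   = lam-ext (T-⇑ (T-retn T-var)) (T-retn T-var)
      (⇑-arg (T-retn T-var) ⟫ ≃-⇑-body (stk-μ̄ pos T-covar))
  ; F-∘    = λ ((g , Dg) , _) ((f , Df) , _) → lam-ext (T-⇑ (T-seq Df Dg)) (T-seq (T-⇑ Df) (T-⇑ Dg))
      (⇑-arg (T-seq Df Dg) ⟫
       ≃-⇑-body (≃-μ̄ (cut-stack pos Df (T-μ̄ Dg)) ⟫≡
         cong (λ S → μ̄ pos (plug S f)) (rename-cong (λ ()) (μ̄ pos g))) ⟫
       ≃-sym (seq-⇑ Dg (T-⇑ Df) ⟫ ⇑-push Df (T-μ̄ Dg)))
  }

T-unit-push : {S : Tm stack 0} → [] ⊢ S ∶ A ⊢ B → [] ⊢ push unit S ∶ (neg , (pos , 𝟏) ⊸ A) ⊢ B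
T-unit-push {S = S} D = subst (λ S → [] ⊢ push unit S ∶ _ ⊢ _) (rename-id (λ _ → refl) S)
  (T-push* glue-[]ˡ T-unit D)

≃-unit-push : {S S′ : Tm stack 0} → [] ⊢ S ≃ S′ ∶ A ⊢ B →
              [] ⊢ push unit S ≃ push unit S′ ∶ (neg , (pos , 𝟏) ⊸ A) ⊢ B
≃-unit-push {S = S} {S′} p = subst₂ (λ S S′ → [] ⊢ push unit S ≃ push unit S′ ∶ _ ⊢ _)
  (rename-id (λ _ → refl) S) (rename-id (λ _ → refl) S′) (≃-push* glue-[]ˡ (≃-refl T-unit) p)

-- ⟨u‖μ̄().⟨x‖α⟩⁺⟩⁺ and the command ⟨μ(u·α).⟨u‖μ̄().⟨x‖α⟩⁺⟩⁺‖γ⟩⁻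

delay-body : Tm command 2
delay-body = cut pos (↑ var zero) (μ̄unit (cut pos (↑ var (suc zero)) covar))

delay : Tm command 1
delay = cut neg (μlam delay-body) (↓ covar)

T-delay-body : (pos , 𝟏) ∷ (pos , P) ∷ [] ⊢ delay-body ∶ ⊢ (pos , P)
T-delay-body = T-cut* glue-∷ (T-↑ T-var) (T-μ̄unit (T-retn T-var))

T-delay : (pos , P) ∷ [] ⊢ delay ∶ ⊢ (neg , (pos , 𝟏) ⊸ (pos , P))
T-delay = T-covarᶜ (T-lam T-delay-body)

run : Tm stack 0 → Tm command 1
run S = sret neg (push unit S)

T-run : {S : Tm stack 0} → [] ⊢ S ∶ A ⊢ B → (neg , (pos , 𝟏) ⊸ A) ∷ [] ⊢ run S ∶ ⊢ B
T-run D = T-sret neg (T-unit-push D)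

delay-run : {c : Tm command 1} → (pos , P) ∷ [] ⊢ c ∶ ⊢ B →
            (pos , P) ∷ [] ⊢ seq neg delay (run (μ̄ pos c)) ≃ c ∶ ⊢ B
delay-run {c = c} D =
  seq-sret neg T-delay DS ⟫
  R (R-lam delay-body unit (closed (μ̄ pos c))) (proj₂ (≃-typed (seq-sret neg T-delay DS))) ⟫
  unit-β (T-cutᶜ (T-↑ T-var) (T-μ̄ D)) ⟫ (cut-value pos T-var D ⟫≡ sub-id (λ { zero → refl }) c)
  where
  DS = T-unit-push (T-μ̄ D)

run-seq : {c : Tm command 1} → (pos , P) ∷ [] ⊢ c ∶ ⊢ B →
          (neg , (pos , 𝟏) ⊸ (pos , P)) ∷ [] ⊢ seq pos (run covar) c ≃ run (μ̄ pos c) ∶ ⊢ B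
run-seq D = cut-stack pos (T-run T-covar) (T-μ̄ D)

delay-arg : (pos , 𝟏) ∷ (pos , P) ∷ [] ⊢ delay ▹ arg ≃ delay-body ∶ ⊢ (pos , P)
delay-arg = R (R-lam _ (var zero) covar) (T-▹ T-delay T-arg)

run-delay : (neg , (pos , 𝟏) ⊸ (pos , P)) ∷ [] ⊢ seq pos (run covar) delay ≃
            retn neg (var zero) ∶ ⊢ (neg , (pos , 𝟏) ⊸ (pos , P))
run-delay {P} = lam-ext (T-seq (T-run T-covar) T-delay) (T-retn T-var)
  (seq-▹ pos (run covar) delay arg ≡⟫ ≃-seq-▹ (T-run T-covar) delay-arg ⟫
   cut-▹ pos (T-run T-covar) DS ⟫
   unit-ext (T-▹ (T-run T-covar) DS) (T-▹ (T-retn T-var) T-arg)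
     (≃-sret neg (≃-unit-push (≃-μ̄ (unit-β (T-retn T-var)) ⟫ stk-μ̄ pos T-covar))))
  where
  DS : (pos , 𝟏) ∷ [] ⊢ μ̄ pos (rename swap delay-body) ∶ (pos , P) ⊢ (pos , P)
  DS = T-μ̄ (T-struct ↝-swap T-delay-body)

⇑-bijection : ∀ P N → Inverse (𝒟.homSetoid (pos , P) (neg , N)) (𝒩ₗ.homSetoid (Functor.F₀ ⇑ P) N)
⇑-bijection P N = record
  { to        = λ (c , D) → (cut neg (var zero) (closed (↓ push unit (μ̄ pos c))) , T-run (T-μ̄ D)) ,
                            linear-stack neg (T-unit-push (T-μ̄ D))
  ; from      = λ ((f , D) , _) → seq neg delay f , T-seq T-delay D
  ; to-cong   = to-cong
  ; from-cong = λ p → ≃-seq (≃-refl T-delay) p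
  ; inverse   = (λ { {f , l} p → to-cong p ⟫ to-from f l }) ,
                (λ { {c , D} p → ≃-seq (≃-refl T-delay) p ⟫ delay-run D })
  }
  where
  to-cong : ∀ {c d} → (pos , P) ∷ [] ⊢ c ≃ d ∶ ⊢ (neg , N) →
            (neg , (pos , 𝟏) ⊸ (pos , P)) ∷ [] ⊢ run (μ̄ pos c) ≃ run (μ̄ pos d) ∶ ⊢ (neg , N)
  to-cong p = ≃-sret neg (≃-unit-push (≃-μ̄ p))
  to-from : (f : 𝒟.Hom (neg , (pos , 𝟏) ⊸ (pos , P)) (neg , N)) → 𝒟.IsLinear f →
            (neg , (pos , 𝟏) ⊸ (pos , P)) ∷ [] ⊢ run (μ̄ pos (seq neg delay (proj₁ f))) ≃ proj₁ f ∶ ⊢ _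
  to-from (f , D) l =
    ≃-sym (run-seq (T-seq T-delay D)) ⟫ l (run covar , T-run T-covar) (delay , T-delay) ⟫
    ≃-seq run-delay (≃-refl D) ⟫ seq-idˡ D

dereliction : ∀ N → 𝒟.Hom (pos , ! (neg , N)) (neg , N)
dereliction N = cut pos (↑ var zero) (bang covar) , T-cutᶜ (T-↑ T-var) (T-bang T-covar)

promotion : 𝒟.Hom (pos , ! (neg , N)) (neg , M) → 𝒫ₜ.Hom (! (neg , N)) (! (neg , M))
promotion (c , D) = (cut pos (↑ μbang c) covar , T-retn V) , thunkable-value V
  where
  V = T-μbang (λ { zero → isBang }) D

return : ∀ P → 𝒟.Hom (pos , P) (neg , ◇ (pos , P))
return P = cut neg (dia (var zero)) (↓ covar) , T-retn (T-dia T-var)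

extension : 𝒟.Hom (pos , P) (neg , ◇ (pos , Q)) → 𝒩ₗ.Hom (◇ (pos , P)) (◇ (pos , Q))
extension (c , D) = (cut neg (var zero) (closed (↓ μ̄dia c)) , T-sret neg S) , linear-stack neg S
  where
  S = T-μ̄dia (λ ()) D

{-# OPTIONS --safe #-}
-- Transported along the two bijections, the (co)monad laws become the β- and
-- η-laws of the modalities: coextension is μ!α.c, whose composites are computed
-- by substituting a value, and extension is μ̄◇x.c, whose composites are computed
-- by substituting a stack.
module Submission where

open import Defs
open import Data.Fin.Base using (zero)
open import Data.Product.Base using (Σ; _×_; _,_; proj₁; proj₂)
open import Data.Vec.Base using ([]; _∷_)
open import Function.Bundles using (Inverse)
open import Relation.Binary.PropositionalEquality using (_≡_; refl; sym; trans; cong)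

private
  variable
    A B : Type
    P : Ty pos
    N M : Ty neg

banged-! : ∀ A → Banged ((pos , ! A) ∷ [])
banged-! A zero = isBang

T-promote : {c : Tm command 1} → (pos , ! A) ∷ [] ⊢ c ∶ ⊢ B → (pos , ! A) ∷ [] ⊢ μbang c ∶ (pos , ! B) ∣
T-promote D = T-μbang (banged-! _) D

≃-promote : {c d : Tm command 1} → (pos , ! A) ∷ [] ⊢ c ≃ d ∶ ⊢ B →
            (pos , ! A) ∷ [] ⊢ retn pos (μbang c) ≃ retn pos (μbang d) ∶ ⊢ (pos , ! B)
≃-promote p = ≃-retn (≃-μbang (banged-! _) p)

-- This cut is what remains of dereliction once a promoted value replaces its variable, which is how
-- it enters the `factor` law of the comonad.
bang-β : {c : Tm command 1} → (pos , ! A) ∷ [] ⊢ c ∶ ⊢ B →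
         (pos , ! A) ∷ [] ⊢ cut pos (↑ μbang c) (bang covar) ≃ c ∶ ⊢ B
bang-β {c = c} D =
  R (R-bang c covar) (T-cutᶜ (T-↑ (T-promote D)) (T-bang T-covar)) ⟫≡ plug-covar c

-- The expansion `E-bang` of the variable itself, read backwards; the command being promoted is
-- dereliction.
bang-η : (pos , ! A) ∷ [] ⊢ retn pos (μbang (cut pos (↑ var zero) (bang covar))) ≃
         retn pos (var zero) ∶ ⊢ (pos , ! A)
bang-η = ≃-retn (≃-sym (≃-E (E-bang _) T-var
  (T-promote (T-cutᶜ (T-↑ T-var) (T-bang T-covar)))))

unthunk : 𝒫ₜ.Hom P (Functor.F₀ ⇓ M) → 𝒟.Hom (pos , P) (neg , M)
unthunk = Inverse.from (⇓-bijection _ _)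

-- Rests on thunkability of `f`: it lets `force` be composed first with the rebuilt thunk, and those
-- two cancel.
thunk-unthunk : (f : 𝒫ₜ.Hom P (Functor.F₀ ⇓ M)) → Inverse.to (⇓-bijection P M) (unthunk f) 𝒫ₜ.≈ f
thunk-unthunk {P} {M} f = Inverse.strictlyInverseˡ (⇓-bijection P M) f

!-relativeComonad : RelativeComonad ⇓ (λ N → ! (neg , N))
!-relativeComonad = record
  { counit          = λ N → Inverse.to (⇓-bijection _ N) (dereliction N)
  ; coextend        = λ f → promotion (unthunk f)
  ; coextend-cong   = λ p → ≃-promote (≃-seq p (≃-refl T-force))
  ; factor          = factor
  ; coextend-counit = λ {N} → ≃-promote (force-thunk (proj₂ (dereliction N))) ⟫ bang-η
  ; coextend-∘      = λ f g →
      let Df = proj₂ (proj₁ f)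
          Dg = T-promote (proj₂ (unthunk g))
      -- Since `coextend g` is a value, the composite with `f` and `force` can be reassociated and
      -- then computed by substitution. On the right the same value is substituted under `μbang`,
      -- with which substitution commutes definitionally.
      in ≃-promote (≃-sym (seq-retn-assoc Dg Df T-force) ⟫ seq-retn Dg (T-seq Df T-force)) ⟫
         ≃-sym (seq-retn Dg (T-retn (T-promote (proj₂ (unthunk f)))))
  }
  where
  factor : ∀ {N M} (f : 𝒫ₜ.Hom (! (neg , N)) (Functor.F₀ ⇓ M)) →
           f 𝒫ₜ.≈ (Inverse.to (⇓-bijection _ M) (dereliction M) 𝒫ₜ.∘ promotion (unthunk f))
  factor {M = M} f = ≃-sym
    (seq-retn (T-promote (proj₂ (unthunk f))) (T-thunk (proj₂ (dereliction M))) ⟫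
     ≃-retn (≃-unit-pair (≃-μ (bang-β (proj₂ (unthunk f))))) ⟫
     thunk-unthunk f)

T-extend : {c : Tm command 1} → A ∷ [] ⊢ c ∶ ⊢ (neg , ◇ B) → [] ⊢ μ̄dia c ∶ (neg , ◇ A) ⊢ (neg , ◇ B)
T-extend D = T-μ̄dia (λ ()) D

≃-extend : {c d : Tm command 1} → A ∷ [] ⊢ c ≃ d ∶ ⊢ (neg , ◇ B) →
           (neg , ◇ A) ∷ [] ⊢ sret neg (μ̄dia c) ≃ sret neg (μ̄dia d) ∶ ⊢ (neg , ◇ B)
≃-extend p = ≃-sret neg (≃-μ̄dia (λ ()) p)

-- The stack carries `wk` because it arises by plugging under the binder of `μ̄ pos`.
dia-β : {c : Tm command 1} → A ∷ [] ⊢ c ∶ ⊢ (neg , ◇ B) →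
        A ∷ [] ⊢ cut neg (dia (var zero)) (↓ wk (μ̄dia c)) ≃ c ∶ ⊢ (neg , ◇ B)
dia-β {c = c} D =
  R (R-dia (var zero) _) (T-cut* glue-∷ (T-dia T-var) (T-↓ (T-extend D))) ⟫≡
  trans (sub-rename (λ _ → refl) c) (sub-id (λ { zero → refl }) c)

dia-η : (neg , ◇ A) ∷ [] ⊢ sret neg (μ̄dia (cut neg (dia (var zero)) (↓ covar))) ≃
        retn neg (var zero) ∶ ⊢ (neg , ◇ A)
dia-η = ≃-sret neg (≃-sym (≃-E (E-dia covar) T-covar (T-extend (T-retn (T-dia T-var)))))

-- Following one stack map by another thus gives a stack map again, so the monad laws can be checked
-- on the stacks alone.
plug-sret : ∀ (S S′ : Tm stack 0) → plug (closed S) (sret neg S′) ≡ sret neg (plug S S′)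
plug-sret S S′ = cong (λ S → cut neg (var zero) (↓ S)) (sym (rename-plug (λ ()) S S′))

undelay : 𝒩ₗ.Hom (Functor.F₀ ⇑ P) N → 𝒟.Hom (pos , P) (neg , N)
undelay = Inverse.from (⇑-bijection _ _)

-- Dual to `thunk-unthunk`: linearity of `f` lets `run covar` meet `delay`, and those two cancel.
delay-undelay : (f : 𝒩ₗ.Hom (Functor.F₀ ⇑ P) N) → Inverse.to (⇑-bijection P N) (undelay f) 𝒩ₗ.≈ f
delay-undelay {P} {N} f = Inverse.strictlyInverseˡ (⇑-bijection P N) f

◇-relativeMonad : RelativeMonad ⇑ (λ P → ◇ (pos , P))
◇-relativeMonad = record
  { η           = λ P → Inverse.to (⇑-bijection P _) (return P)
  ; extend      = λ f → extension (undelay f)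
  ; extend-cong = λ p → ≃-extend (≃-seq (≃-refl T-delay) p)
  ; factor      = factor
  ; extend-η    = λ {P} → ≃-extend (delay-run (proj₂ (return P))) ⟫ dia-η
  ; extend-∘    = extend-∘
  }
  where
  factor : ∀ {P Q} (f : 𝒩ₗ.Hom (Functor.F₀ ⇑ P) (◇ (pos , Q))) →
           f 𝒩ₗ.≈ (extension (undelay f) 𝒩ₗ.∘ Inverse.to (⇑-bijection P _) (return P))
  factor {P} f = ≃-sym
    (seq-sret neg (T-run (T-μ̄ (proj₂ (return P)))) (T-extend (proj₂ (undelay f))) ⟫
     plug-sret _ (push unit (μ̄ pos (proj₁ (return P)))) ≡⟫
     ≃-sret neg (≃-unit-push (≃-μ̄ (dia-β (proj₂ (undelay f))))) ⟫
     delay-undelay f)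

  extend-∘ : ∀ {P Q R} (f : 𝒩ₗ.Hom (Functor.F₀ ⇑ Q) (◇ (pos , R)))
             (g : 𝒩ₗ.Hom (Functor.F₀ ⇑ P) (◇ (pos , Q))) →
             extension (undelay (extension (undelay f) 𝒩ₗ.∘ g)) 𝒩ₗ.≈
             (extension (undelay f) 𝒩ₗ.∘ extension (undelay g))
  extend-∘ f g =
    ≃-extend
      -- An extension is given by a stack, hence linear, so `delay` can be composed with `g` first.
      (seq-sret-assoc neg T-delay (proj₂ (proj₁ g)) Df ⟫
       seq-sret neg (proj₂ (undelay g)) Df ⟫≡
       -- Out of the empty scope `closed` and `wk` agree; `wk` is the form that `plug` produces
       -- under `μ̄dia`.
       cong (λ S → plug S (proj₁ (undelay g))) (rename-cong (λ ()) (μ̄dia (proj₁ (undelay f))))) ⟫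
    ≃-sym (seq-sret neg (T-sret neg (T-extend (proj₂ (undelay g)))) Df ⟫≡
           plug-sret _ (μ̄dia (proj₁ (undelay g))))
    where
    Df = T-extend (proj₂ (undelay f))

proposition16 : (Σ (RelativeComonad ⇓ (λ N → ! (neg , N))) λ W → let open RelativeComonad W in
    (∀ N → counit N 𝒫ₜ.≈ Inverse.to (⇓-bijection (! (neg , N)) N) (dereliction N)) ×
    (∀ N M (c : 𝒟.Hom (pos , ! (neg , N)) (neg , M)) →
    coextend {N} {M} (Inverse.to (⇓-bijection (! (neg , N)) M) c) 𝒫ₜ.≈ promotion c)) ×
    (Σ (RelativeMonad ⇑ (λ P → ◇ (pos , P))) λ W → let open RelativeMonad W in
    (∀ P → η P 𝒩ₗ.≈ Inverse.to (⇑-bijection P (◇ (pos , P))) (return P)) ×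
    (∀ P Q (c : 𝒟.Hom (pos , P) (neg , ◇ (pos , Q))) →
    extend {P} {Q} (Inverse.to (⇑-bijection P (◇ (pos , Q))) c) 𝒩ₗ.≈ extension c))
proposition16 =
  (!-relativeComonad ,
    -- The counit is the required morphism by definition. Coextension first applies `unthunk`, which
    -- undoes the bijection by `force-thunk`; `delay-run` does the same for extension.
    (λ N → ≃-refl (T-thunk (proj₂ (dereliction N)))) ,
    λ _ _ (_ , D) → ≃-promote (force-thunk D)) ,
  (◇-relativeMonad ,
    (λ P → ≃-refl (T-run (T-μ̄ (proj₂ (return P))))) ,
    λ _ _ (_ , D) → ≃-extend (delay-run D))
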